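{- Suppose $\Delta\vdash P$ and $\Delta\vdash Q$ in AW$\pi$. If $[\![P]\!]\approx_{\pi}[\![Q]\!]$, where $[\![\cdot]\!]$ is the translation into the asynchronous $\pi$-calculus and $\approx_\pi$ is weak bisimilarity there, then $P\cong_\Delta Q$.
   Context: The calculus AW$\pi$. Names form a countably infinite set. Besides a distinguished set of success names, every name is either an I-name (only input subject) or an O-name (only output subject). Values $v ::= a \mid \star$. Processes: $P ::= 0 \mid P \mid Q \mid a(x).P \mid \overline{b}\langle v\rangle \mid (\nu\, a \leftrightarrow b : T)P \mid\ !a(x).P$; input and restriction are binders; in $(\nu\, a\leftrightarrow b)P$, $a$ is an I-name and $b$ an O-name. Success names are O-names carrying only $\star$, never restricted; a closed process has only success names free. Types $T ::= o\,T \mid i\,T \mid \mathsf{unit}$ (dual of $o\,T$ is $i\,T$ and vice versa). $I(\Gamma)$ is the set of names with input type in environment $\Gamma$; $\Gamma_1,\Gamma_2$ is defined only if they agree on shared names. Typing rules: $\Gamma\vdash 0$; if $\Gamma_1\vdash P_1$, $\Gamma_2\vdash P_2$, $I(\Gamma_1)\cap I(\Gamma_2)=\emptyset$ then $\Gamma_1,\Gamma_2\vdash P_1\mid P_2$; if $\Gamma,a:i\,T,b:o\,T\vdash P$ then $\Gamma\vdash(\nu\,a\leftrightarrow b:i\,T)P$; $\Gamma,a:o\,T,b:T\vdash \overline{a}\langle b\rangle$; if $\Gamma,a:i\,T,b:T\vdash P$ then $\Gamma,a:i\,T\vdash a(b).P$; if $\Gamma_o,b:T\vdash P$ with $\Gamma_o$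 assigning only output types, then $\Gamma_o,a:i\,T,\Gamma'\vdash\ !a(b).P$. Reduction: structural congruence $\equiv$: $|$ associative, commutative with unit $0$, $P\mid(\nu\,a\leftrightarrow b)Q\equiv(\nu\,a\leftrightarrow b)(P\mid Q)$ if $a,b\notin\mathrm{fn}(P)$, restrictions commute, $(\nu\,a\leftrightarrow b)0\equiv0$. Reduction $\to$ closed under $|$, restriction, $\equiv$, with $(\nu\,a\leftrightarrow b)(a(x).P\mid\overline{b}\langle v\rangle\mid Q)\to(\nu\,a\leftrightarrow b)(P\{v/x\}\mid Q)$ and the analogous rule for $!a(x).P$ (which persists). $\Rightarrow$ is the reflexive-transitive closure. $P\downarrow_\omega$ if $P\equiv\overline{\omega}\langle\star\rangle\mid P'$ ($\omega$ success name), $P\Downarrow_\omega$ if $P\Rightarrow\downarrow_\omega$. Barbed bisimilarity $\approx$: largest symmetric relation on closed processes with $P\downarrow_\omega\Rightarrow Q\Downarrow_\omega$ and $P\to P'\Rightarrow \exists Q\Rightarrow Q', P'\approx Q'$. An extension of $\Delta$ adds only O-names; a context $C$ is closing for $\Delta$ if it is typable under an environment with only success names, the hole being typable under an extension of $\Delta$. For $\Delta\vdash P,Q$: $P\cong_\Delta Q$ iff $C[P]\approx C[Q]$ for all contexts $C$ closing for $\Delta$. Asynchronous $\pi$-calculus: processes $P ::= 0 \mid P\mid Q \mid a(x).P \mid \overline{b}\langle v\rangle \mid (\nu a)P \mid\ !a(x).P$ with the standard (ground) labelled transition system; $\approx_\pi$ denotes ordinary (synchronous) weak bisimilarity on it.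 The translation $[\![\cdot]\!]$ from AW$\pi$ is homomorphic on all constructs except restriction: $[\![(\nu\,a\leftrightarrow b)P]\!]=(\nu b)\big([\![P]\!]\{b/a\}\big)$, i.e. each connected pair is identified with its O-name. -}

module Defs where

-- AWπ (asynchronous wired π-calculus) and the asynchronous π-calculus,
-- both in de Bruijn style.  Bound names are de Bruijn indices (Fin n);
-- success names are global free names (sc ω, ω : ℕ).

open import Data.Nat using (ℕ; zero; suc)
open import Data.Fin using (Fin; zero; suc)
open import Data.Maybe using (Maybe; just; nothing; map; zipWith; _>>=_)
open import Data.Vec using (Vec; []; _∷_; lookup)
open import Data.Product using (Σ; ∃; ∃₂; _×_; _,_)
open import Data.Sum using (_⊎_)
open import Relation.Nullary using (¬_)
open import Relation.Binary.PropositionalEquality using (_≡_)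
open import Relation.Binary.Construct.Closure.ReflexiveTransitive using (Star)
open import Function.Definitions using (Injective)

data Ty : Set where
  o_   : Ty → Ty
  i_   : Ty → Ty
  unit : Ty

data IsInput : Ty → Set where
  isInput : ∀ {T} → IsInput (i T)

data IsOutput : Ty → Set where
  isOutput : ∀ {T} → IsOutput (o T)

-- a name in scope n: a de Bruijn variable, or a (free, global) success name
data Subj (n : ℕ) : Set where
  var : Fin n → Subj n
  sc  : ℕ → Subj n

data Val (n : ℕ) : Set where
  nm : Subj n → Val n
  ⋆  : Val n

Ren : ℕ → ℕ → Set
Ren n m = Fin n → Fin m

liftR : ∀ {n m} → Ren n m → Ren (suc n) (suc m)
liftR ρ zero    = zero
liftR ρ (suc x) = suc (ρ x)

renS : ∀ {n m} → Ren n m → Subj n → Subj m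
renS ρ (var x) = var (ρ x)
renS ρ (sc ω)  = sc ω

renV : ∀ {n m} → Ren n m → Val n → Val m
renV ρ (nm a) = nm (renS ρ a)
renV ρ ⋆      = ⋆

wkS : ∀ {n} → Subj n → Subj (suc n)
wkS = renS suc

wkV : ∀ {n} → Val n → Val (suc n)
wkV = renV suc

Sub : ℕ → ℕ → Set
Sub n m = Fin n → Val m

liftσ : ∀ {n m} → Sub n m → Sub (suc n) (suc m)
liftσ σ zero    = nm (var zero)
liftσ σ (suc x) = wkV (σ x)

subS : ∀ {n m} → Sub n m → Subj n → Val m
subS σ (var x) = σ x
subS σ (sc ω)  = nm (sc ω)

subV : ∀ {n m} → Sub n m → Val n → Val m
subV σ (nm a) = subS σ a
subV σ ⋆      = ⋆

sub0 : ∀ {n} → Val n → Sub (suc n) n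
sub0 v zero    = v
sub0 v (suc x) = nm (var x)

-- a value used in subject position must be a name (substituting ⋆ for a
-- name used as a subject is undefined)
asSubj : ∀ {n} → Val n → Maybe (Subj n)
asSubj (nm a) = just a
asSubj ⋆      = nothing

asVar : ∀ {n} → Val n → Maybe (Fin n)
asVar (nm (var x)) = just x
asVar (nm (sc ω))  = nothing
asVar ⋆            = nothing

wk2 : ∀ {n} → Ren n (suc (suc n))
wk2 x = suc (suc x)

swap22 : ∀ {n} → Ren (suc (suc (suc (suc n)))) (suc (suc (suc (suc n))))
swap22 zero                          = suc (suc zero)
swap22 (suc zero)                    = suc (suc (suc zero))
swap22 (suc (suc zero))              = zero
swap22 (suc (suc (suc zero)))        = suc zero
swap22 (suc (suc (suc (suc x))))     = suc (suc (suc (suc x)))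

swap01 : ∀ {n} → Ren (suc (suc n)) (suc (suc n))
swap01 zero          = suc zero
swap01 (suc zero)    = zero
swap01 (suc (suc x)) = suc (suc x)

-- identify the connected pair (a = index 0, b = index 1) with b
merge : ∀ {n} → Ren (suc (suc n)) (suc n)
merge zero          = zero
merge (suc zero)    = zero
merge (suc (suc x)) = suc x

module AW where

  infixr 5 _∣_

  -- (ν T P) binds index 0 = the I-name a and index 1 = the O-name b
  -- of (ν a ↔ b : T) P
  data Proc (n : ℕ) : Set where
    𝟘   : Proc n
    _∣_ : Proc n → Proc n → Proc n
    inp : Fin n → Proc (suc n) → Proc n
    out : Subj n → Val n → Proc n
    ν   : Ty → Proc (suc (suc n)) → Proc n
    rep : Fin n → Proc (suc n) → Proc n

  ren : ∀ {n m} → Ren n m → Proc n → Proc m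
  ren ρ 𝟘         = 𝟘
  ren ρ (P ∣ Q)   = ren ρ P ∣ ren ρ Q
  ren ρ (inp a P) = inp (ρ a) (ren (liftR ρ) P)
  ren ρ (out a v) = out (renS ρ a) (renV ρ v)
  ren ρ (ν T P)   = ν T (ren (liftR (liftR ρ)) P)
  ren ρ (rep a P) = rep (ρ a) (ren (liftR ρ) P)

  sub : ∀ {n m} → Sub n m → Proc n → Maybe (Proc m)
  sub σ 𝟘         = just 𝟘
  sub σ (P ∣ Q)   = zipWith _∣_ (sub σ P) (sub σ Q)
  sub σ (inp a P) = asVar (σ a) >>= λ b → map (inp b) (sub (liftσ σ) P)
  sub σ (out a v) = map (λ b → out b (subV σ v)) (asSubj (subS σ a))
  sub σ (ν T P)   = map (ν T) (sub (liftσ (liftσ σ)) P)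
  sub σ (rep a P) = asVar (σ a) >>= λ b → map (rep b) (sub (liftσ σ) P)

  infix 4 _≡s_
  data _≡s_ : ∀ {n} → Proc n → Proc n → Set where
    ≡refl  : ∀ {n} {P : Proc n} → P ≡s P
    ≡sym   : ∀ {n} {P Q : Proc n} → P ≡s Q → Q ≡s P
    ≡trans : ∀ {n} {P Q R : Proc n} → P ≡s Q → Q ≡s R → P ≡s R
    ∣-assoc : ∀ {n} {P Q R : Proc n} → (P ∣ Q) ∣ R ≡s P ∣ (Q ∣ R)
    ∣-comm  : ∀ {n} {P Q : Proc n} → P ∣ Q ≡s Q ∣ P
    ∣-unit  : ∀ {n} {P : Proc n} → P ∣ 𝟘 ≡s P
    extr    : ∀ {n} {T} {P : Proc n} {Q} → P ∣ ν T Q ≡s ν T (ren wk2 P ∣ Q)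
    ν-comm  : ∀ {n} {T U} {P : Proc (suc (suc (suc (suc n))))} →
              ν T (ν U P) ≡s ν U (ν T (ren swap22 P))
    ν-zero  : ∀ {n} {T} → ν {n} T 𝟘 ≡s 𝟘
    cong-∣  : ∀ {n} {P P' Q : Proc n} → P ≡s P' → P ∣ Q ≡s P' ∣ Q
    cong-inp : ∀ {n} {a : Fin n} {P P'} → P ≡s P' → inp a P ≡s inp a P'
    cong-rep : ∀ {n} {a : Fin n} {P P'} → P ≡s P' → rep a P ≡s rep a P'
    cong-ν   : ∀ {n} {T} {P P' : Proc (suc (suc n))} → P ≡s P' → ν T P ≡s ν T P'

  infix 4 _⟶_
  data _⟶_ : ∀ {n} → Proc n → Proc n → Set where
    com  : ∀ {n} {T} {P : Proc (suc (suc (suc n)))} {v Q P'} →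
           sub (sub0 v) P ≡ just P' →
           ν T (inp zero P ∣ out (var (suc zero)) v ∣ Q) ⟶ ν T (P' ∣ Q)
    rcom : ∀ {n} {T} {P : Proc (suc (suc (suc n)))} {v Q P'} →
           sub (sub0 v) P ≡ just P' →
           ν T (rep zero P ∣ out (var (suc zero)) v ∣ Q) ⟶ ν T (rep zero P ∣ P' ∣ Q)
    par  : ∀ {n} {P P' Q : Proc n} → P ⟶ P' → P ∣ Q ⟶ P' ∣ Q
    res  : ∀ {n} {T} {P P' : Proc (suc (suc n))} → P ⟶ P' → ν T P ⟶ ν T P'
    str  : ∀ {n} {P P₁ Q₁ Q : Proc n} → P ≡s P₁ → P₁ ⟶ Q₁ → Q₁ ≡s Q → P ⟶ Q

  infix 4 _⟹_
  _⟹_ : ∀ {n} → Proc n → Proc n → Set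
  _⟹_ = Star _⟶_

  _↓_ : Proc 0 → ℕ → Set
  P ↓ ω = ∃ λ P' → P ≡s out (sc ω) ⋆ ∣ P'

  _⇓_ : Proc 0 → ℕ → Set
  P ⇓ ω = ∃ λ P' → P ⟹ P' × P' ↓ ω

  record IsBarbedBisim (R : Proc 0 → Proc 0 → Set) : Set where
    field
      symm : ∀ {P Q} → R P Q → R Q P
      barb : ∀ {P Q ω} → R P Q → P ↓ ω → Q ⇓ ω
      step : ∀ {P Q P'} → R P Q → P ⟶ P' → ∃ λ Q' → Q ⟹ Q' × R P' Q'

  infix 4 _≈_
  _≈_ : Proc 0 → Proc 0 → Set₁
  P ≈ Q = Σ (Proc 0 → Proc 0 → Set) λ R → IsBarbedBisim R × R P Q

  Env : ℕ → Set
  Env n = Vec (Maybe Ty) n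

  -- Γ = Γ₁ , Γ₂ with I(Γ₁) ∩ I(Γ₂) = ∅ (agreement on shared names)
  data UnionEntry : Maybe Ty → Maybe Ty → Maybe Ty → Set where
    none  : UnionEntry nothing nothing nothing
    left  : ∀ {t} → UnionEntry (just t) (just t) nothing
    right : ∀ {t} → UnionEntry (just t) nothing (just t)
    both  : ∀ {t} → ¬ IsInput t → UnionEntry (just t) (just t) (just t)

  data Union : ∀ {n} → Env n → Env n → Env n → Set where
    []  : Union [] [] []
    _∷_ : ∀ {n} {x y z} {Γ Γ₁ Γ₂ : Env n} →
          UnionEntry x y z → Union Γ Γ₁ Γ₂ → Union (x ∷ Γ) (y ∷ Γ₁) (z ∷ Γ₂)

  _⊆_ : ∀ {n} → Env n → Env n → Set
  Γ₁ ⊆ Γ₂ = ∀ x t → lookup Γ₁ x ≡ just t → lookup Γ₂ x ≡ just t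

  OnlyOut : ∀ {n} → Env n → Set
  OnlyOut Γ = ∀ x t → lookup Γ x ≡ just t → IsOutput t

  data SubjTy {n} (Γ : Env n) : Subj n → Ty → Set where
    var : ∀ {x t} → lookup Γ x ≡ just t → SubjTy Γ (var x) t
    sc  : ∀ {ω} → SubjTy Γ (sc ω) (o unit)

  data ValTy {n} (Γ : Env n) : Val n → Ty → Set where
    nm : ∀ {a t} → SubjTy Γ a t → ValTy Γ (nm a) t
    ⋆  : ValTy Γ ⋆ unit

  infix 3 _⊢_
  data _⊢_ : ∀ {n} → Env n → Proc n → Set where
    t-nil : ∀ {n} {Γ : Env n} → Γ ⊢ 𝟘
    t-par : ∀ {n} {Γ Γ₁ Γ₂ : Env n} {P Q} →
            Union Γ Γ₁ Γ₂ → Γ₁ ⊢ P → Γ₂ ⊢ Q → Γ ⊢ P ∣ Q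
    t-res : ∀ {n} {Γ : Env n} {T P} →
            just (i T) ∷ just (o T) ∷ Γ ⊢ P → Γ ⊢ ν (i T) P
    t-out : ∀ {n} {Γ : Env n} {a v T} →
            SubjTy Γ a (o T) → ValTy Γ v T → Γ ⊢ out a v
    t-inp : ∀ {n} {Γ : Env n} {a T P} →
            lookup Γ a ≡ just (i T) → just T ∷ Γ ⊢ P → Γ ⊢ inp a P
    t-rep : ∀ {n} {Γ Γo : Env n} {a T P} →
            OnlyOut Γo → Γo ⊆ Γ → lookup Γ a ≡ just (i T) →
            just T ∷ Γo ⊢ P → Γ ⊢ rep a P

  env : ∀ {n} → Vec Ty n → Env n
  env = Data.Vec.map just

  -- contexts: Ctx n m has outer scope n and a hole in scope m

  data Ctx (n : ℕ) : ℕ → Set where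
    hole : Ctx n n
    parL : ∀ {m} → Ctx n m → Proc n → Ctx n m
    parR : ∀ {m} → Proc n → Ctx n m → Ctx n m
    inp  : ∀ {m} → Fin n → Ctx (suc n) m → Ctx n m
    ν    : ∀ {m} → Ty → Ctx (suc (suc n)) m → Ctx n m
    rep  : ∀ {m} → Fin n → Ctx (suc n) m → Ctx n m

  plug : ∀ {n m} → Ctx n m → Proc m → Proc n
  plug hole       R = R
  plug (parL C Q) R = plug C R ∣ Q
  plug (parR P C) R = P ∣ plug C R
  plug (inp a C)  R = inp a (plug C R)
  plug (ν T C)    R = ν T (plug C R)
  plug (rep a C)  R = rep a (plug C R)

  data CtxTy : ∀ {n m} → Env n → Ctx n m → Env m → Set where
    c-hole : ∀ {n} {Γ : Env n} → CtxTy Γ hole Γ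
    c-parL : ∀ {n m} {Γ Γ₁ Γ₂ : Env n} {C : Ctx n m} {Q Γh} →
             Union Γ Γ₁ Γ₂ → CtxTy Γ₁ C Γh → Γ₂ ⊢ Q → CtxTy Γ (parL C Q) Γh
    c-parR : ∀ {n m} {Γ Γ₁ Γ₂ : Env n} {C : Ctx n m} {P Γh} →
             Union Γ Γ₁ Γ₂ → Γ₁ ⊢ P → CtxTy Γ₂ C Γh → CtxTy Γ (parR P C) Γh
    c-res  : ∀ {n m} {Γ : Env n} {T} {C : Ctx (suc (suc n)) m} {Γh} →
             CtxTy (just (i T) ∷ just (o T) ∷ Γ) C Γh → CtxTy Γ (ν (i T) C) Γh
    c-inp  : ∀ {n m} {Γ : Env n} {a T} {C : Ctx (suc n) m} {Γh} →
             lookup Γ a ≡ just (i T) → CtxTy (just T ∷ Γ) C Γh → CtxTy Γ (inp a C) Γh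
    c-rep  : ∀ {n m} {Γ Γo : Env n} {a T} {C : Ctx (suc n) m} {Γh} →
             OnlyOut Γo → Γo ⊆ Γ → lookup Γ a ≡ just (i T) →
             CtxTy (just T ∷ Γo) C Γh → CtxTy Γ (rep a C) Γh

  -- Γh (on the hole's scope m) is an extension of Δ (on scope n), where the
  -- free names of the process are placed in the hole's scope by the
  -- injective renaming ρ: Γh agrees with Δ on the names of Δ, and every
  -- other name of Γh is an O-name (has no input type).
  Extends : ∀ {n m} → Ren n m → Vec Ty n → Env m → Set
  Extends {n} {m} ρ Δ Γh =
    (∀ (x : Fin n) → lookup Γh (ρ x) ≡ just (lookup Δ x)) ×
    (∀ (y : Fin m) t → lookup Γh y ≡ just t →
       (∃ λ (x : Fin n) → ρ x ≡ y) ⊎ ¬ IsInput t)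

  _≅[_]_ : ∀ {n} → Proc n → Vec Ty n → Proc n → Set₁
  _≅[_]_ {n} P Δ Q =
    ∀ {m} (ρ : Ren n m) → Injective _≡_ _≡_ ρ →
    (Γh : Env m) → Extends ρ Δ Γh →
    (C : Ctx 0 m) → CtxTy [] C Γh →
    plug C (ren ρ P) ≈ plug C (ren ρ Q)

module Pi where

  infixr 5 _∣_

  data Proc (n : ℕ) : Set where
    𝟘   : Proc n
    _∣_ : Proc n → Proc n → Proc n
    inp : Subj n → Proc (suc n) → Proc n
    out : Subj n → Val n → Proc n
    ν   : Proc (suc n) → Proc n
    rep : Subj n → Proc (suc n) → Proc n

  ren : ∀ {n m} → Ren n m → Proc n → Proc m
  ren ρ 𝟘         = 𝟘
  ren ρ (P ∣ Q)   = ren ρ P ∣ ren ρ Q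
  ren ρ (inp a P) = inp (renS ρ a) (ren (liftR ρ) P)
  ren ρ (out a v) = out (renS ρ a) (renV ρ v)
  ren ρ (ν P)     = ν (ren (liftR ρ) P)
  ren ρ (rep a P) = rep (renS ρ a) (ren (liftR ρ) P)

  wk : ∀ {n} → Proc n → Proc (suc n)
  wk = ren suc

  sub : ∀ {n m} → Sub n m → Proc n → Maybe (Proc m)
  sub σ 𝟘         = just 𝟘
  sub σ (P ∣ Q)   = zipWith _∣_ (sub σ P) (sub σ Q)
  sub σ (inp a P) = asSubj (subS σ a) >>= λ b → map (inp b) (sub (liftσ σ) P)
  sub σ (out a v) = map (λ b → out b (subV σ v)) (asSubj (subS σ a))
  sub σ (ν P)     = map ν (sub (liftσ σ) P)
  sub σ (rep a P) = asSubj (subS σ a) >>= λ b → map (rep b) (sub (liftσ σ) P)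

  -- actions; Act n m: action in scope n whose residual lives in scope m
  -- (bound output and input bind index 0 in the residual)
  data Act (n : ℕ) : ℕ → Set where
    τ    : Act n n
    out  : Subj n → Val n → Act n n
    bout : Subj n → Act n (suc n)
    inp  : Subj n → Act n (suc n)

  wkAct : ∀ {n m} → Act n m → Act (suc n) (suc m)
  wkAct τ         = τ
  wkAct (out a v) = out (wkS a) (wkV v)
  wkAct (bout a)  = bout (wkS a)
  wkAct (inp a)   = inp (wkS a)

  along : ∀ {n m} → Act n m → Proc n → Proc m
  along τ         P = P
  along (out a v) P = P
  along (bout a)  P = wk P
  along (inp a)   P = wk P

  -- after a transition under ν, put the restricted name back at index 0
  fixν : ∀ {n m} → Act n m → Proc (suc m) → Proc (suc m)
  fixν τ         P = P
  fixν (out a v) P = P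
  fixν (bout a)  P = ren swap01 P
  fixν (inp a)   P = ren swap01 P

  infix 4 _—[_]→_
  data _—[_]→_ : ∀ {n m} → Proc n → Act n m → Proc m → Set where
    inp-ax : ∀ {n} {a : Subj n} {P} → inp a P —[ inp a ]→ P
    out-ax : ∀ {n} {a : Subj n} {v} → out a v —[ out a v ]→ 𝟘
    rep-ax : ∀ {n} {a : Subj n} {P} → rep a P —[ inp a ]→ P ∣ wk (rep a P)
    parL   : ∀ {n m} {α : Act n m} {P P' Q} →
             P —[ α ]→ P' → P ∣ Q —[ α ]→ P' ∣ along α Q
    parR   : ∀ {n m} {α : Act n m} {P Q Q'} →
             Q —[ α ]→ Q' → P ∣ Q —[ α ]→ along α P ∣ Q'
    comL   : ∀ {n} {a : Subj n} {v P P' Q Q' Q''} →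
             P —[ out a v ]→ P' → Q —[ inp a ]→ Q' →
             sub (sub0 v) Q' ≡ just Q'' → P ∣ Q —[ τ ]→ P' ∣ Q''
    comR   : ∀ {n} {a : Subj n} {v P P' P'' Q Q'} →
             P —[ inp a ]→ P' → Q —[ out a v ]→ Q' →
             sub (sub0 v) P' ≡ just P'' → P ∣ Q —[ τ ]→ P'' ∣ Q'
    closeL : ∀ {n} {a : Subj n} {P P' Q Q'} →
             P —[ bout a ]→ P' → Q —[ inp a ]→ Q' → P ∣ Q —[ τ ]→ ν (P' ∣ Q')
    closeR : ∀ {n} {a : Subj n} {P P' Q Q'} →
             P —[ inp a ]→ P' → Q —[ bout a ]→ Q' → P ∣ Q —[ τ ]→ ν (P' ∣ Q')
    res    : ∀ {n m} {α : Act n m} {P P'} →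
             P —[ wkAct α ]→ P' → ν P —[ α ]→ ν (fixν α P')
    opn    : ∀ {n} {a : Subj n} {P P'} →
             P —[ out (wkS a) (nm (var zero)) ]→ P' → ν P —[ bout a ]→ P'

  _—τ→_ : ∀ {n} → Proc n → Proc n → Set
  P —τ→ Q = P —[ τ ]→ Q

  _⇒τ_ : ∀ {n} → Proc n → Proc n → Set
  _⇒τ_ = Star _—τ→_

  _=[_]⇒_ : ∀ {n m} → Proc n → Act n m → Proc m → Set
  P =[ τ ]⇒ Q        = P ⇒τ Q
  P =[ out a v ]⇒ Q  = ∃₂ λ P₁ P₂ → P ⇒τ P₁ × P₁ —[ out a v ]→ P₂ × P₂ ⇒τ Q
  P =[ bout a ]⇒ Q   = ∃₂ λ P₁ P₂ → P ⇒τ P₁ × P₁ —[ bout a ]→ P₂ × P₂ ⇒τ Q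
  P =[ inp a ]⇒ Q    = ∃₂ λ P₁ P₂ → P ⇒τ P₁ × P₁ —[ inp a ]→ P₂ × P₂ ⇒τ Q

  -- (ordinary, synchronous, ground) weak bisimulation
  record IsWeakBisim (R : ∀ {n} → Proc n → Proc n → Set) : Set where
    field
      symm : ∀ {n} {P Q : Proc n} → R P Q → R Q P
      sim  : ∀ {n m} {P Q : Proc n} {α : Act n m} {P'} →
             R P Q → P —[ α ]→ P' → ∃ λ Q' → Q =[ α ]⇒ Q' × R P' Q'

  infix 4 _≈π_
  _≈π_ : ∀ {n} → Proc n → Proc n → Set₁
  P ≈π Q = Σ (∀ {k} → Proc k → Proc k → Set) λ R → IsWeakBisim R × R P Q

⟦_⟧ : ∀ {n} → AW.Proc n → Pi.Proc n
⟦ AW.𝟘 ⟧       = Pi.𝟘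
⟦ P AW.∣ Q ⟧   = ⟦ P ⟧ Pi.∣ ⟦ Q ⟧
⟦ AW.inp a P ⟧ = Pi.inp (var a) ⟦ P ⟧
⟦ AW.out a v ⟧ = Pi.out a v
⟦ AW.ν T P ⟧   = Pi.ν (Pi.ren merge ⟦ P ⟧)
⟦ AW.rep a P ⟧ = Pi.rep (var a) ⟦ P ⟧

{-# OPTIONS --safe #-}
module Submission where

open import Defs
open import Data.Nat using (ℕ; zero; suc)
open import Data.Fin using (Fin; zero; suc)
open import Data.Maybe using (just)
open import Data.Vec using (Vec; lookup; _∷_)
open import Data.Vec.Properties using (lookup-map)
open import Data.Vec.Functional using () renaming (_∷_ to _▹_)
open import Data.Product using (∃; ∃₂; _×_; _,_; proj₂)
open import Data.Sum using (_⊎_; inj₁; inj₂)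
open import Data.Empty using (⊥; ⊥-elim)
open import Function using (_∘_; id)
open import Relation.Binary.Construct.Closure.ReflexiveTransitive using (ε; _◅_)
open import Relation.Binary.PropositionalEquality
open AW using (_≡s_; _⟶_; _⟹_; _⊢_; env; _≅[_]_;
  ≡refl; ≡sym; ≡trans; ∣-assoc; ∣-comm; ∣-unit; extr; ν-comm; cong-∣; cong-ν; str)
open Pi using (_—[_]→_; _⇒τ_; _≈π_; IsWeakBisim)

-- Processes are translated into a π-calculus whose subjects are arbitrary
-- values, so that substitution is total.  There the weak bisimilarity of ⟦P⟧
-- and ⟦Q⟧ is closed under substitutions, parallel composition, prefixes and
-- restriction: asynchrony turns a communication between names that the
-- substitution identifies into an output followed by an input of the original
-- process, and the output can be delayed until the partner is ready.
-- Conversely a typed AWπ process and its translation have the same reductions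
-- up to structural congruence, since an I-name is only read and an O-name only
-- written, so that merging a connected pair creates no other communication.

-- Closure under substitution is forced twice. The transition system is ground, so the value
-- received by an input is filled in only after the bisimulation game has matched it; and every
-- restriction of a closing context applies the non-injective `merge` to all that it encloses. A
-- substitution creates no single labelled transition, only communications. For this reason a
-- communication is not described by the position of its partners but as an output of the whole
-- process followed by an input of the whole residual: two moves, each of which the game can answer
-- on its own. The total calculus could also run communications that the partial substitutions of
-- `Pi` and `AW` reject. Simple sorts on the one side and a typing with polarities on the other
-- exclude them along the reductions that are compared.

private variable
  n m k l : ℕ

-- Syntax with values as subjects, and the algebra of total substitution

infixr 5 _∣_

data Proc (n : ℕ) : Set where
  𝟘   : Proc n
  _∣_ : Proc n → Proc n → Proc n
  inp : Val n → Proc (suc n) → Proc n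
  out : Val n → Val n → Proc n
  ν   : Proc (suc n) → Proc n
  rep : Val n → Proc (suc n) → Proc n

private variable
  P P' P₁ P₂ Q Q' R X Y : Proc n

sub : Sub n m → Proc n → Proc m
sub σ 𝟘         = 𝟘
sub σ (P ∣ Q)   = sub σ P ∣ sub σ Q
sub σ (inp a P) = inp (subV σ a) (sub (liftσ σ) P)
sub σ (out a v) = out (subV σ a) (subV σ v)
sub σ (ν P)     = ν (sub (liftσ σ) P)
sub σ (rep a P) = rep (subV σ a) (sub (liftσ σ) P)

⌜_⌝ : Ren n m → Sub n m
⌜ ρ ⌝ x = nm (var (ρ x))

v0 : Val (suc n)
v0 = nm (var zero)

wk : Proc n → Proc (suc n)
wk = sub ⌜ suc ⌝

swap : Proc (suc (suc n)) → Proc (suc (suc n))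
swap = sub ⌜ swap01 ⌝

renV≗subV : (ρ : Ren n m) (v : Val n) → renV ρ v ≡ subV ⌜ ρ ⌝ v
renV≗subV ρ (nm (var x)) = refl
renV≗subV ρ (nm (sc ω))  = refl
renV≗subV ρ ⋆            = refl

subV-cong : {σ τ : Sub n m} → (∀ x → σ x ≡ τ x) → ∀ v → subV σ v ≡ subV τ v
subV-cong e (nm (var x)) = e x
subV-cong e (nm (sc ω))  = refl
subV-cong e ⋆            = refl

subV-comp : (σ : Sub m l) (τ : Sub n m) (v : Val n) →
            subV σ (subV τ v) ≡ subV (λ x → subV σ (τ x)) v
subV-comp σ τ (nm (var x)) = refl
subV-comp σ τ (nm (sc ω))  = refl
subV-comp σ τ ⋆            = refl

subV-id : (v : Val n) → subV (λ x → nm (var x)) v ≡ v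
subV-id (nm (var x)) = refl
subV-id (nm (sc ω))  = refl
subV-id ⋆            = refl

lift-wk : (σ : Sub n m) (v : Val n) → subV (liftσ σ) (wkV v) ≡ wkV (subV σ v)
lift-wk σ (nm (var x)) = refl
lift-wk σ (nm (sc ω))  = refl
lift-wk σ ⋆            = refl

sub0-wk : (w v : Val n) → subV (sub0 w) (wkV v) ≡ v
sub0-wk w (nm (var x)) = refl
sub0-wk w (nm (sc ω))  = refl
sub0-wk w ⋆            = refl

liftσ-cong : {σ τ : Sub n m} → (∀ x → σ x ≡ τ x) → ∀ x → liftσ σ x ≡ liftσ τ x
liftσ-cong e zero    = refl
liftσ-cong e (suc x) = cong wkV (e x)

sub-cong : {σ τ : Sub n m} → (∀ x → σ x ≡ τ x) → ∀ P → sub σ P ≡ sub τ P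
sub-cong e 𝟘         = refl
sub-cong e (P ∣ Q)   = cong₂ _∣_ (sub-cong e P) (sub-cong e Q)
sub-cong e (inp a P) = cong₂ inp (subV-cong e a) (sub-cong (liftσ-cong e) P)
sub-cong e (out a v) = cong₂ out (subV-cong e a) (subV-cong e v)
sub-cong e (ν P)     = cong ν (sub-cong (liftσ-cong e) P)
sub-cong e (rep a P) = cong₂ rep (subV-cong e a) (sub-cong (liftσ-cong e) P)

liftσ-comp : (σ : Sub m l) (τ : Sub n m) (x : Fin (suc n)) →
             subV (liftσ σ) (liftσ τ x) ≡ liftσ (λ y → subV σ (τ y)) x
liftσ-comp σ τ zero    = refl
liftσ-comp σ τ (suc x) = lift-wk σ (τ x)

sub-comp : (σ : Sub m l) (τ : Sub n m) (P : Proc n) →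
           sub σ (sub τ P) ≡ sub (λ x → subV σ (τ x)) P
sub-comp σ τ 𝟘         = refl
sub-comp σ τ (P ∣ Q)   = cong₂ _∣_ (sub-comp σ τ P) (sub-comp σ τ Q)
sub-comp σ τ (inp a P) = cong₂ inp (subV-comp σ τ a)
  (trans (sub-comp _ _ P) (sub-cong (liftσ-comp σ τ) P))
sub-comp σ τ (out a v) = cong₂ out (subV-comp σ τ a) (subV-comp σ τ v)
sub-comp σ τ (ν P)     = cong ν (trans (sub-comp _ _ P) (sub-cong (liftσ-comp σ τ) P))
sub-comp σ τ (rep a P) = cong₂ rep (subV-comp σ τ a)
  (trans (sub-comp _ _ P) (sub-cong (liftσ-comp σ τ) P))

liftσ-id : {σ : Sub n n} → (∀ x → σ x ≡ nm (var x)) → ∀ x → liftσ σ x ≡ nm (var x)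
liftσ-id e zero    = refl
liftσ-id e (suc x) = cong wkV (e x)

sub-id : {σ : Sub n n} → (∀ x → σ x ≡ nm (var x)) → ∀ P → sub σ P ≡ P
sub-id e 𝟘         = refl
sub-id e (P ∣ Q)   = cong₂ _∣_ (sub-id e P) (sub-id e Q)
sub-id e (inp a P) = cong₂ inp (trans (subV-cong e a) (subV-id a)) (sub-id (liftσ-id e) P)
sub-id e (out a v) = cong₂ out (trans (subV-cong e a) (subV-id a)) (trans (subV-cong e v) (subV-id v))
sub-id e (ν P)     = cong ν (sub-id (liftσ-id e) P)
sub-id e (rep a P) = cong₂ rep (trans (subV-cong e a) (subV-id a)) (sub-id (liftσ-id e) P)

sub₁₁ : {σ : Sub m l} {τ : Sub n m} {σ' : Sub k l} {τ' : Sub n k} →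
        (∀ x → subV σ (τ x) ≡ subV σ' (τ' x)) → ∀ P → sub σ (sub τ P) ≡ sub σ' (sub τ' P)
sub₁₁ e P = trans (sub-comp _ _ P) (trans (sub-cong e P) (sym (sub-comp _ _ P)))

sub₂₁ : {σ : Sub m l} {τ : Sub n m} {σ' : Sub n l} →
        (∀ x → subV σ (τ x) ≡ σ' x) → ∀ P → sub σ (sub τ P) ≡ sub σ' P
sub₂₁ e P = trans (sub-comp _ _ P) (sub-cong e P)

sub₂₀ : {σ : Sub m n} {τ : Sub n m} →
        (∀ x → subV σ (τ x) ≡ nm (var x)) → ∀ P → sub σ (sub τ P) ≡ P
sub₂₀ e P = trans (sub-comp _ _ P) (sub-id e P)

wk-sub : (σ : Sub n m) (P : Proc n) → sub (liftσ σ) (wk P) ≡ wk (sub σ P)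
wk-sub σ = sub₁₁ (λ x → renV≗subV suc (σ x))

sub0-wkP : (v : Val n) (P : Proc n) → sub (sub0 v) (wk P) ≡ P
sub0-wkP v = sub₂₀ (λ x → refl)

swap01-invol : ∀ (x : Fin (suc (suc n))) → swap01 (swap01 x) ≡ x
swap01-invol zero          = refl
swap01-invol (suc zero)    = refl
swap01-invol (suc (suc x)) = refl

swap-invol : (P : Proc (suc (suc n))) → swap (swap P) ≡ P
swap-invol = sub₂₀ (λ x → cong (λ y → nm (var y)) (swap01-invol x))

swapV-wk² : (a : Val n) → subV ⌜ swap01 ⌝ (wkV (wkV a)) ≡ wkV (wkV a)
swapV-wk² (nm (var x)) = refl
swapV-wk² (nm (sc ω))  = refl
swapV-wk² ⋆            = refl

swapV-invol : (a : Val (suc (suc n))) → subV ⌜ swap01 ⌝ (subV ⌜ swap01 ⌝ a) ≡ a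
swapV-invol a = trans (subV-comp _ _ a)
  (trans (subV-cong (λ x → cong (λ y → nm (var y)) (swap01-invol x)) a) (subV-id a))

lift²-swap : (σ : Sub n m) (P : Proc (suc (suc n))) →
             sub (liftσ (liftσ σ)) (swap P) ≡ swap (sub (liftσ (liftσ σ)) P)
lift²-swap σ = sub₁₁ λ where
  zero          → refl
  (suc zero)    → refl
  (suc (suc x)) → sym (swapV-wk² (σ x))

wkV-injective : (u v : Val n) → wkV u ≡ wkV v → u ≡ v
wkV-injective u v e = trans (sym (sub0-wk ⋆ u)) (trans (cong (subV (sub0 ⋆)) e) (sub0-wk ⋆ v))

v0≢wk : (a : Val n) → v0 ≡ wkV a → ⊥
v0≢wk (nm (var x)) ()
v0≢wk (nm (sc ω))  ()
v0≢wk ⋆            ()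

v0-or-wk : (a : Val (suc n)) → a ≡ v0 ⊎ ∃ λ a' → a ≡ wkV a'
v0-or-wk (nm (var zero))    = inj₁ refl
v0-or-wk (nm (var (suc x))) = inj₂ (nm (var x) , refl)
v0-or-wk (nm (sc ω))        = inj₂ (nm (sc ω) , refl)
v0-or-wk ⋆                  = inj₂ (⋆ , refl)

lift-wk⁻ : (σ : Sub n m) (u : Val (suc n)) {a : Val m} → subV (liftσ σ) u ≡ wkV a →
           ∃ λ u' → u ≡ wkV u' × subV σ u' ≡ a
lift-wk⁻ σ u e with v0-or-wk u
... | inj₁ refl        = ⊥-elim (v0≢wk _ e)
... | inj₂ (u' , refl) = u' , refl , wkV-injective _ _ (trans (sym (lift-wk σ u')) e)

lift-v0⁻ : (σ : Sub n m) (u : Val (suc n)) → subV (liftσ σ) u ≡ v0 → u ≡ v0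
lift-v0⁻ σ u e with v0-or-wk u
... | inj₁ refl        = refl
... | inj₂ (u' , refl) = ⊥-elim (v0≢wk _ (trans (sym e) (lift-wk σ u')))

-- Labelled transitions and their behaviour under substitution

data Dir : Set where
  ↑ ↓ : Dir

-- Bound output (`↑`) and input (`↓`) both introduce a name at index 0 of the residual and propagate
-- through parallel composition and restriction in the same way, hence one constructor. There is no
-- silent label; communication is the separate relation `Tau`.
data Lab (n : ℕ) : ℕ → Set where
  ō : Val n → Val n → Lab n n
  β : Dir → Val n → Lab n (suc n)

along : Lab n m → Proc n → Proc m
along (ō a v) P = P
along (β d a) P = wk P

data Tr : ∀ {n m} → Proc n → Lab n m → Proc m → Set where
  out-ax : {a v : Val n} → Tr (out a v) (ō a v) 𝟘
  inp-ax : {a : Val n} → Tr (inp a P) (β ↓ a) P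
  rep-ax : {a : Val n} → Tr (rep a P) (β ↓ a) (P ∣ wk (rep a P))
  parL   : {α : Lab n m} → Tr P α P' → Tr (P ∣ Q) α (P' ∣ along α Q)
  parR   : {α : Lab n m} → Tr Q α Q' → Tr (P ∣ Q) α (along α P ∣ Q')
  res-o  : {a v : Val n} → Tr P (ō (wkV a) (wkV v)) P' → Tr (ν P) (ō a v) (ν P')
  res-β  : {a : Val n} {d : Dir} → Tr P (β d (wkV a)) P' → Tr (ν P) (β d a) (ν (swap P'))
  opn    : {a : Val n} → Tr P (ō (wkV a) v0) P' → Tr (ν P) (β ↑ a) P'

relabel-o : {a a' v v' : Val n} → a ≡ a' → v ≡ v' → Tr P (ō a v) P' → Tr P (ō a' v') P'
relabel-o refl refl t = t

relabel-β : {a a' : Val n} {d : Dir} → a ≡ a' → Tr P (β d a) P' → Tr P (β d a') P'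
relabel-β refl t = t

retarget : {α : Lab n m} → P₁ ≡ P₂ → Tr P α P₁ → Tr P α P₂
retarget refl t = t

sub-o : (σ : Sub n m) {a v : Val n} → Tr P (ō a v) P' →
        Tr (sub σ P) (ō (subV σ a) (subV σ v)) (sub σ P')
sub-o σ out-ax    = out-ax
sub-o σ (parL t)  = parL (sub-o σ t)
sub-o σ (parR t)  = parR (sub-o σ t)
sub-o σ (res-o {a = a} {v} t) =
  res-o (relabel-o (lift-wk σ a) (lift-wk σ v) (sub-o (liftσ σ) t))

lift-swap∘lift : (σ : Sub n m) {P : Proc (suc (suc n))} →
  ν (swap (sub (liftσ (liftσ σ)) P)) ≡ sub (liftσ σ) (ν (swap P))
lift-swap∘lift σ = cong ν (sym (lift²-swap σ _))

sub-β : (σ : Sub n m) {d : Dir} {a : Val n} → Tr P (β d a) P' →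
        Tr (sub σ P) (β d (subV σ a)) (sub (liftσ σ) P')
sub-β σ inp-ax            = inp-ax
sub-β σ (rep-ax {P = P} {a = a}) =
  retarget (cong (sub (liftσ σ) P ∣_) (sym (wk-sub σ (rep a P)))) rep-ax
sub-β σ (parL {Q = Q} t)  = retarget (cong (_ ∣_) (sym (wk-sub σ Q))) (parL (sub-β σ t))
sub-β σ (parR {P = P} t)  = retarget (cong (_∣ _) (sym (wk-sub σ P))) (parR (sub-β σ t))
sub-β σ (res-β {a = a} t) =
  retarget (lift-swap∘lift σ) (res-β (relabel-β (lift-wk σ a) (sub-β (liftσ σ) t)))
sub-β σ (opn {a = a} t) = opn (relabel-o (lift-wk σ a) refl (sub-o (liftσ σ) t))

-- Substitution keeps the shape of a process, and a single transition depends on one prefix only, so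
-- none is created. Below `ν` the bound name is the only one that `liftσ σ` sends to index 0, so a
-- label that avoids the binder after substitution avoided it before.
inv-o : (σ : Sub n m) (P : Proc n) {a v : Val m} {X : Proc m} → Tr (sub σ P) (ō a v) X →
        ∃₂ λ a' v' → ∃ λ P' →
        Tr P (ō a' v') P' × subV σ a' ≡ a × subV σ v' ≡ v × X ≡ sub σ P'
inv-o σ (P ∣ Q) (parL t) with inv-o σ P t
... | _ , _ , _ , t' , refl , refl , refl = _ , _ , _ , parL t' , refl , refl , refl
inv-o σ (P ∣ Q) (parR t) with inv-o σ Q t
... | _ , _ , _ , t' , refl , refl , refl = _ , _ , _ , parR t' , refl , refl , refl
inv-o σ (out a v) out-ax = _ , _ , _ , out-ax , refl , refl , refl
inv-o σ (ν P) (res-o t) with inv-o (liftσ σ) P t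
... | a' , v' , _ , t' , ea , ev , refl with lift-wk⁻ σ a' ea | lift-wk⁻ σ v' ev
... | _ , refl , ea' | _ , refl , ev' = _ , _ , _ , res-o t' , ea' , ev' , refl

inv-β : (σ : Sub n m) (P : Proc n) {d : Dir} {a : Val m} {X : Proc (suc m)} →
        Tr (sub σ P) (β d a) X →
        ∃₂ λ a' P' → Tr P (β d a') P' × subV σ a' ≡ a × X ≡ sub (liftσ σ) P'
inv-β σ (P ∣ Q) (parL t) with inv-β σ P t
... | _ , _ , t' , refl , refl = _ , _ , parL t' , refl , cong (_ ∣_) (sym (wk-sub σ Q))
inv-β σ (P ∣ Q) (parR t) with inv-β σ Q t
... | _ , _ , t' , refl , refl = _ , _ , parR t' , refl , cong (_∣ _) (sym (wk-sub σ P))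
inv-β σ (inp a P) inp-ax = _ , _ , inp-ax , refl , refl
inv-β σ (rep a P) rep-ax = _ , _ , rep-ax , refl , cong (sub (liftσ σ) P ∣_) (sym (wk-sub σ (rep a P)))
inv-β σ (ν P) (res-β t) with inv-β (liftσ σ) P t
... | a' , _ , t' , ea , refl with lift-wk⁻ σ a' ea
... | _ , refl , ea' = _ , _ , res-β t' , ea' , lift-swap∘lift σ
inv-β σ (ν P) (opn t) with inv-o (liftσ σ) P t
... | a' , v' , _ , t' , ea , ev , refl with lift-wk⁻ σ a' ea | lift-v0⁻ σ v' ev
... | _ , refl , ea' | refl = _ , _ , opn t' , ea' , refl

-- Structural congruence is a strong bisimulation

infix 4 _≋_
data _≋_ : ∀ {n} → Proc n → Proc n → Set where
  ≋-refl   : P ≋ P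
  ≋-sym    : P ≋ Q → Q ≋ P
  ≋-trans  : P ≋ Q → Q ≋ R → P ≋ R
  ≋-assoc  : (P ∣ Q) ∣ R ≋ P ∣ (Q ∣ R)
  ≋-comm   : P ∣ Q ≋ Q ∣ P
  ≋-unit   : P ∣ 𝟘 ≋ P
  ≋-extr   : P ∣ ν Q ≋ ν (wk P ∣ Q)
  ≋-ν-swap : ν (ν P) ≋ ν (ν (swap P))
  ≋-ν-zero : ν {n} 𝟘 ≋ 𝟘
  ≋-par    : P ≋ P' → P ∣ Q ≋ P' ∣ Q
  ≋-inp    : {a : Val n} → P ≋ P' → inp a P ≋ inp a P'
  ≋-rep    : {a : Val n} → P ≋ P' → rep a P ≋ rep a P'
  ≋-ν      : P ≋ P' → ν P ≋ ν P'

≡⇒≋ : P ≡ Q → P ≋ Q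
≡⇒≋ refl = ≋-refl

≋-parʳ : Q ≋ Q' → P ∣ Q ≋ P ∣ Q'
≋-parʳ e = ≋-trans ≋-comm (≋-trans (≋-par e) ≋-comm)

≋-unitˡ : 𝟘 ∣ P ≋ P
≋-unitˡ = ≋-trans ≋-comm ≋-unit

≋-extrˡ : ν P ∣ Q ≋ ν (P ∣ wk Q)
≋-extrˡ = ≋-trans ≋-comm (≋-trans ≋-extr (≋-ν ≋-comm))

≋-exchange : P ∣ (Q ∣ R) ≋ Q ∣ (P ∣ R)
≋-exchange = ≋-trans (≋-sym ≋-assoc) (≋-trans (≋-par ≋-comm) ≋-assoc)

sub-≋ : (σ : Sub n m) → P ≋ Q → sub σ P ≋ sub σ Q
sub-≋ σ ≋-refl        = ≋-refl
sub-≋ σ (≋-sym e)     = ≋-sym (sub-≋ σ e)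
sub-≋ σ (≋-trans e f) = ≋-trans (sub-≋ σ e) (sub-≋ σ f)
sub-≋ σ ≋-assoc       = ≋-assoc
sub-≋ σ ≋-comm        = ≋-comm
sub-≋ σ ≋-unit        = ≋-unit
sub-≋ σ (≋-extr {P = P}) = ≋-trans ≋-extr (≋-ν (≋-par (≡⇒≋ (sym (wk-sub σ P)))))
sub-≋ σ (≋-ν-swap {P = P}) =
  ≋-trans ≋-ν-swap (≋-ν (≋-ν (≡⇒≋ (sym (lift²-swap σ P)))))
sub-≋ σ ≋-ν-zero      = ≋-ν-zero
sub-≋ σ (≋-par e)     = ≋-par (sub-≋ σ e)
sub-≋ σ (≋-inp e)     = ≋-inp (sub-≋ (liftσ σ) e)
sub-≋ σ (≋-rep e)     = ≋-rep (sub-≋ (liftσ σ) e)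
sub-≋ σ (≋-ν e)       = ≋-ν (sub-≋ (liftσ σ) e)

along-≋ : (α : Lab n m) → P ≋ Q → along α P ≋ along α Q
along-≋ (ō a v) e = e
along-≋ (β d a) e = sub-≋ ⌜ suc ⌝ e

along-par : (α : Lab n m) → along α (P ∣ Q) ≋ along α P ∣ along α Q
along-par (ō a v) = ≋-refl
along-par (β d a) = ≋-refl

along-𝟘 : (α : Lab n m) → along α 𝟘 ≋ 𝟘
along-𝟘 (ō a v) = ≋-refl
along-𝟘 (β d a) = ≋-refl

wkV-subV : (v : Val n) → subV ⌜ suc ⌝ v ≡ wkV v
wkV-subV v = sym (renV≗subV suc v)

wk-subV-injective : (u v : Val n) → subV ⌜ suc ⌝ u ≡ subV ⌜ suc ⌝ v → u ≡ v
wk-subV-injective u v e =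
  wkV-injective u v (trans (sym (wkV-subV u)) (trans e (wkV-subV v)))

wk-subV≢v0 : (u : Val n) → subV ⌜ suc ⌝ u ≡ v0 → ⊥
wk-subV≢v0 u e = v0≢wk u (trans (sym e) (wkV-subV u))

wk-o : {a v : Val n} → Tr P (ō a v) P' → Tr (wk P) (ō (wkV a) (wkV v)) (wk P')
wk-o {a = a} {v} t = relabel-o (wkV-subV a) (wkV-subV v) (sub-o ⌜ suc ⌝ t)

wk-β : {d : Dir} {a : Val n} → Tr P (β d a) P' →
       Tr (wk P) (β d (wkV a)) (sub (liftσ ⌜ suc ⌝) P')
wk-β {a = a} t = relabel-β (wkV-subV a) (sub-β ⌜ suc ⌝ t)

wk-o⁻ : (P : Proc n) {a v : Val n} → Tr (wk P) (ō (wkV a) (wkV v)) X →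
        ∃ λ P' → Tr P (ō a v) P' × X ≡ wk P'
wk-o⁻ P t with inv-o ⌜ suc ⌝ P t
... | a' , v' , P' , t' , ea , ev , ex =
  P' , relabel-o (wk-subV-injective a' _ (trans ea (sym (wkV-subV _))))
                 (wk-subV-injective v' _ (trans ev (sym (wkV-subV _)))) t' , ex

wk-β⁻ : (P : Proc n) {d : Dir} {a : Val n} → Tr (wk P) (β d (wkV a)) X →
        ∃ λ P' → Tr P (β d a) P' × X ≡ sub (liftσ ⌜ suc ⌝) P'
wk-β⁻ P t with inv-β ⌜ suc ⌝ P t
... | a' , P' , t' , ea , ex =
  P' , relabel-β (wk-subV-injective a' _ (trans ea (sym (wkV-subV _)))) t' , ex

swap-lift-wk : (P : Proc (suc n)) → swap (sub (liftσ ⌜ suc ⌝) P) ≡ wk P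
swap-lift-wk = sub₂₁ λ where
  zero    → refl
  (suc x) → refl

swap-wk : (P : Proc (suc n)) → swap (wk P) ≡ sub (liftσ ⌜ suc ⌝) P
swap-wk = sub₂₁ λ where
  zero    → refl
  (suc x) → refl

swap-wk² : (P : Proc n) → swap (wk (wk P)) ≡ wk (wk P)
swap-wk² P = trans (swap-wk (wk P)) (wk-sub ⌜ suc ⌝ P)

sub-comp₃ : (σ : Sub m l) (τ : Sub k m) (υ : Sub n k) (P : Proc n) →
            sub σ (sub τ (sub υ P)) ≡ sub (λ x → subV σ (subV τ (υ x))) P
sub-comp₃ σ τ υ P = trans (cong (sub σ) (sub-comp τ υ P)) (sub-comp σ _ P)

-- The braid relation for the two adjacent transpositions of three indices: an action with a bound
-- name leaves two restrictions, and these may be exchanged before or after.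
swap-braid : (P : Proc (suc (suc (suc n)))) →
  swap (sub (liftσ ⌜ swap01 ⌝) (swap P)) ≡
  sub (liftσ ⌜ swap01 ⌝) (swap (sub (liftσ ⌜ swap01 ⌝) P))
swap-braid P = trans (sub-comp₃ _ _ _ P) (trans (sub-cong pointwise P) (sym (sub-comp₃ _ _ _ P)))
  where
  pointwise : ∀ {n} (x : Fin (suc (suc (suc n)))) →
    subV ⌜ swap01 ⌝ (subV (liftσ ⌜ swap01 ⌝) (⌜ swap01 ⌝ x)) ≡
    subV (liftσ ⌜ swap01 ⌝) (subV ⌜ swap01 ⌝ (liftσ ⌜ swap01 ⌝ x))
  pointwise zero                = refl
  pointwise (suc zero)          = refl
  pointwise (suc (suc zero))    = refl
  pointwise (suc (suc (suc x))) = refl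

swap-o : {a v : Val n} → Tr P (ō (wkV (wkV a)) (wkV (wkV v))) P' →
         Tr (swap P) (ō (wkV (wkV a)) (wkV (wkV v))) (swap P')
swap-o {a = a} {v} t = relabel-o (swapV-wk² a) (swapV-wk² v) (sub-o ⌜ swap01 ⌝ t)

swap-β : {d : Dir} {a : Val n} → Tr P (β d (wkV (wkV a))) P' →
         Tr (swap P) (β d (wkV (wkV a))) (sub (liftσ ⌜ swap01 ⌝) P')
swap-β {a = a} t = relabel-β (swapV-wk² a) (sub-β ⌜ swap01 ⌝ t)

-- When one of the two names is extruded, the exchange moves its binder to the other level, so
-- `res-β (opn _)` and `opn (res-o _)` answer each other.
harmony-ν-swap : {α : Lab n m} → Tr (ν (ν P)) α X → ∃ λ Y → Tr (ν (ν (swap P))) α Y × X ≋ Y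
harmony-ν-swap (res-o (res-o t)) = _ , res-o (res-o (swap-o t)) , ≋-ν-swap
harmony-ν-swap (res-β (res-β {P' = P'} t)) =
  _ , res-β (res-β (swap-β t)) , ≋-trans ≋-ν-swap (≋-ν (≋-ν (≡⇒≋ (swap-braid P'))))
harmony-ν-swap (res-β {a = a} (opn t)) =
  _ , opn (res-o (relabel-o (swapV-wk² a) refl (sub-o ⌜ swap01 ⌝ t))) , ≋-refl
harmony-ν-swap (opn {a = a} (res-o {P' = P'} t)) =
  _ , res-β (opn (relabel-o (swapV-wk² a) refl (sub-o ⌜ swap01 ⌝ t))) ,
  ≋-ν (≡⇒≋ (sym (swap-invol P')))

harmony-extr : {α : Lab n m} → Tr (P ∣ ν Q) α X → ∃ λ Y → Tr (ν (wk P ∣ Q)) α Y × X ≋ Y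
harmony-extr {α = ō a v} (parL t) = _ , res-o (parL (wk-o t)) , ≋-extr
harmony-extr {Q = Q} {α = β d a} (parL {P' = P'} t) =
  _ , res-β (parL (wk-β t)) ,
  ≋-trans ≋-extr (≋-ν (≡⇒≋ (cong₂ _∣_ (sym (swap-lift-wk P')) (sym (swap-wk Q)))))
harmony-extr (parR (res-o t)) = _ , res-o (parR t) , ≋-extr
harmony-extr {P = P} (parR (res-β t)) =
  _ , res-β (parR t) , ≋-trans ≋-extr (≋-ν (≡⇒≋ (cong (_∣ _) (sym (swap-wk² P)))))
harmony-extr (parR (opn t)) = _ , opn (parR t) , ≋-refl

-- The restricted name is fresh for `wk P`: a label of `wk P` that avoids it comes from `P`, and
-- `wk P` can never be the component that extrudes it.
harmony-extr⁻ : {α : Lab n m} → Tr (ν (wk P ∣ Q)) α X → ∃ λ Y → Tr (P ∣ ν Q) α Y × X ≋ Y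
harmony-extr⁻ {P = P} (res-o (parL t)) with wk-o⁻ P t
... | P' , t' , refl = _ , parL t' , ≋-sym ≋-extr
harmony-extr⁻ (res-o (parR t)) = _ , parR (res-o t) , ≋-sym ≋-extr
harmony-extr⁻ {P = P} {Q = Q} (res-β (parL t)) with wk-β⁻ P t
... | P' , t' , refl =
  _ , parL t' ,
  ≋-trans (≋-ν (≡⇒≋ (cong₂ _∣_ (swap-lift-wk P') (swap-wk Q)))) (≋-sym ≋-extr)
harmony-extr⁻ {P = P} (res-β (parR t)) =
  _ , parR (res-β t) , ≋-trans (≋-ν (≡⇒≋ (cong (_∣ _) (swap-wk² P)))) (≋-sym ≋-extr)
harmony-extr⁻ {P = P} (opn (parL t)) with inv-o ⌜ suc ⌝ P t
... | _ , v' , _ , _ , _ , ev , _ = ⊥-elim (wk-subV≢v0 v' ev)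
harmony-extr⁻ (opn (parR t)) = _ , parR (opn t) , ≋-refl

mutual
  -- Symmetry is a constructor of `≋`, so the two directions go by one simultaneous induction.
  harmony : {α : Lab n m} → P ≋ Q → Tr P α P' → ∃ λ Q' → Tr Q α Q' × P' ≋ Q'
  harmony ≋-refl t = _ , t , ≋-refl
  harmony (≋-sym e) t with harmony⁻ e t
  ... | _ , t' , f = _ , t' , ≋-sym f
  harmony (≋-trans e₁ e₂) t with harmony e₁ t
  ... | _ , t₁ , f₁ with harmony e₂ t₁
  ... | _ , t₂ , f₂ = _ , t₂ , ≋-trans f₁ f₂
  harmony {α = α} ≋-assoc (parL (parL t)) =
    _ , parL t , ≋-trans ≋-assoc (≋-parʳ (≋-sym (along-par α)))
  harmony ≋-assoc (parL (parR t)) = _ , parR (parL t) , ≋-assoc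
  harmony {α = α} ≋-assoc (parR t) = _ , parR (parR t) , ≋-trans (≋-par (along-par α)) ≋-assoc
  harmony ≋-comm (parL t) = _ , parR t , ≋-comm
  harmony ≋-comm (parR t) = _ , parL t , ≋-comm
  harmony {α = α} ≋-unit (parL t) = _ , t , ≋-trans (≋-parʳ (along-𝟘 α)) ≋-unit
  harmony ≋-extr t = harmony-extr t
  harmony ≋-ν-swap t = harmony-ν-swap t
  harmony ≋-ν-zero (res-o ())
  harmony ≋-ν-zero (res-β ())
  harmony ≋-ν-zero (opn ())
  harmony (≋-par e) (parL t) with harmony e t
  ... | _ , t' , f = _ , parL t' , ≋-par f
  harmony {α = α} (≋-par e) (parR t) = _ , parR t , ≋-par (along-≋ α e)
  harmony (≋-inp e) inp-ax = _ , inp-ax , e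
  harmony (≋-rep {a = a} e) rep-ax = _ , rep-ax , ≋-trans (≋-par e) (≋-parʳ (sub-≋ ⌜ suc ⌝ (≋-rep {a = a} e)))
  harmony (≋-ν e) (res-o t) with harmony e t
  ... | _ , t' , f = _ , res-o t' , ≋-ν f
  harmony (≋-ν e) (res-β t) with harmony e t
  ... | _ , t' , f = _ , res-β t' , ≋-ν (sub-≋ ⌜ swap01 ⌝ f)
  harmony (≋-ν e) (opn t) with harmony e t
  ... | _ , t' , f = _ , opn t' , f

  harmony⁻ : {α : Lab n m} → P ≋ Q → Tr Q α Q' → ∃ λ P' → Tr P α P' × P' ≋ Q'
  harmony⁻ ≋-refl t = _ , t , ≋-refl
  harmony⁻ (≋-sym e) t with harmony e t
  ... | _ , t' , f = _ , t' , ≋-sym f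
  harmony⁻ (≋-trans e₁ e₂) t with harmony⁻ e₂ t
  ... | _ , t₁ , f₁ with harmony⁻ e₁ t₁
  ... | _ , t₂ , f₂ = _ , t₂ , ≋-trans f₂ f₁
  harmony⁻ {α = α} ≋-assoc (parL t) =
    _ , parL (parL t) , ≋-trans ≋-assoc (≋-parʳ (≋-sym (along-par α)))
  harmony⁻ ≋-assoc (parR (parL t)) = _ , parL (parR t) , ≋-assoc
  harmony⁻ {α = α} ≋-assoc (parR (parR t)) =
    _ , parR t , ≋-trans (≋-par (along-par α)) ≋-assoc
  harmony⁻ ≋-comm (parL t) = _ , parR t , ≋-comm
  harmony⁻ ≋-comm (parR t) = _ , parL t , ≋-comm
  harmony⁻ {α = α} ≋-unit t = _ , parL t , ≋-trans (≋-parʳ (along-𝟘 α)) ≋-unit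
  harmony⁻ ≋-extr t with harmony-extr⁻ t
  ... | _ , t' , f = _ , t' , ≋-sym f
  -- `swap` is an involution, so the forward direction applied to `swap P` is the backward one.
  harmony⁻ (≋-ν-swap {P = P}) t
    with harmony-ν-swap t
  ... | Y , t' , f = Y , subst (λ Q → Tr (ν (ν Q)) _ Y) (swap-invol P) t' , ≋-sym f
  harmony⁻ (≋-par e) (parL t) with harmony⁻ e t
  ... | _ , t' , f = _ , parL t' , ≋-par f
  harmony⁻ {α = α} (≋-par e) (parR t) = _ , parR t , ≋-par (along-≋ α e)
  harmony⁻ (≋-inp e) inp-ax = _ , inp-ax , e
  harmony⁻ (≋-rep {a = a} e) rep-ax = _ , rep-ax , ≋-trans (≋-par e) (≋-parʳ (sub-≋ ⌜ suc ⌝ (≋-rep {a = a} e)))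
  harmony⁻ (≋-ν e) (res-o t) with harmony⁻ e t
  ... | _ , t' , f = _ , res-o t' , ≋-ν f
  harmony⁻ (≋-ν e) (res-β t) with harmony⁻ e t
  ... | _ , t' , f = _ , res-β t' , ≋-ν (sub-≋ ⌜ swap01 ⌝ f)
  harmony⁻ (≋-ν e) (opn t) with harmony⁻ e t
  ... | _ , t' , f = _ , opn t' , f

-- Communication

-- In an asynchronous calculus a communication on a visible channel is an
-- output followed by an input, wherever the two partners sit.
data Seq {n} (a : Val n) (P : Proc n) : Proc n → Set where
  com   : ∀ {v P₁ P₂} → Tr P (ō a v) P₁ → Tr P₁ (β ↓ a) P₂ → Seq a P (sub (sub0 v) P₂)
  close : ∀ {P₁ P₂} → Tr P (β ↑ a) P₁ → Tr P₁ (β ↓ (wkV a)) P₂ →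
          Seq a P (ν (sub (sub0 v0) P₂))

-- `res` is what hides a channel: a communication on a restricted name is a `Seq` somewhere beneath
-- its binder, while one on a free name can be lifted, up to `≋`, to a `Seq` of the whole process.
data Tau : ∀ {n} → Proc n → Proc n → Set where
  seq  : {a : Val n} → Seq a P X → Tau P X
  parL : Tau P P' → Tau (P ∣ Q) (P' ∣ Q)
  parR : Tau Q Q' → Tau (P ∣ Q) (P ∣ Q')
  res  : Tau P P' → Tau (ν P) (ν P')

tau-retarget : X ≡ Y → Tau P X → Tau P Y
tau-retarget refl t = t

seq-harmony : {a : Val n} → P ≋ Q → Seq a P X → ∃ λ Y → Seq a Q Y × X ≋ Y
seq-harmony e (com t u) with harmony e t
... | _ , t' , f with harmony f u
... | _ , u' , g = _ , com t' u' , sub-≋ (sub0 _) g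
seq-harmony e (close t u) with harmony e t
... | _ , t' , f with harmony f u
... | _ , u' , g = _ , close t' u' , ≋-ν (sub-≋ (sub0 v0) g)

seq-parL : {a : Val n} → Seq a P X → ∃ λ Y → Seq a (P ∣ Q) Y × X ∣ Q ≋ Y
seq-parL {Q = Q} (com t u) =
  _ , com (parL t) (parL u) , ≋-parʳ (≡⇒≋ (sym (sub0-wkP _ Q)))
seq-parL {Q = Q} (close t u) =
  _ , close (parL t) (parL u) ,
  ≋-trans ≋-extrˡ (≋-ν (≋-parʳ (≡⇒≋ (sym (sub0-wkP v0 (wk Q))))))

seq-parR : {a : Val n} → Seq a Q X → ∃ λ Y → Seq a (P ∣ Q) Y × P ∣ X ≋ Y
seq-parR s with seq-parL s
... | _ , s' , f with seq-harmony ≋-comm s'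
... | _ , s'' , g = _ , s'' , ≋-trans ≋-comm (≋-trans f g)

sub0-swap : (v : Val n) (P : Proc (suc (suc n))) →
            sub (liftσ (sub0 v)) (swap P) ≡ sub (sub0 (wkV v)) P
sub0-swap v = sub₂₁ λ where
  zero          → refl
  (suc zero)    → refl
  (suc (suc x)) → refl

sub0-lift-swap : (P : Proc (suc (suc (suc n)))) →
  swap (sub (sub0 v0) P) ≡ sub (liftσ (sub0 v0)) (swap (sub (liftσ ⌜ swap01 ⌝) P))
sub0-lift-swap P = trans (sub-comp _ _ P)
  (trans (sub-cong pointwise P) (sym (sub-comp₃ _ _ _ P)))
  where
  pointwise : ∀ {n} (x : Fin (suc (suc (suc n)))) →
    subV ⌜ swap01 ⌝ (sub0 v0 x) ≡
    subV (liftσ (sub0 v0)) (subV ⌜ swap01 ⌝ (liftσ ⌜ swap01 ⌝ x))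
  pointwise zero                = refl
  pointwise (suc zero)          = refl
  pointwise (suc (suc zero))    = refl
  pointwise (suc (suc (suc x))) = refl

-- If the message carries the name bound by this very `ν`, the `close` above is a `com` of `v0`
-- beneath, and the `ν` that `close` reinstates is the original binder. If it carries another
-- private name, the two binders end up exchanged.
seq-ν⁻ : {a : Val n} → Seq a (ν P) X → ∃ λ Y → Seq (wkV a) P Y × ν Y ≋ X
seq-ν⁻ (com {v = v} (res-o t) (res-β {P' = P'} u)) =
  _ , com t u , ≋-ν (≡⇒≋ (sym (sub0-swap v P')))
seq-ν⁻ {a = a} (close (res-β {P' = P₁} t) (res-β u)) with inv-β ⌜ swap01 ⌝ P₁ u
... | b , P₂ , u' , eb , refl =
  _ ,
  close t (relabel-β (trans (sym (swapV-invol b)) (trans (cong (subV ⌜ swap01 ⌝) eb) (swapV-wk² a))) u') ,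
  ≋-trans ≋-ν-swap (≋-ν (≋-ν (≡⇒≋ (sub0-lift-swap P₂))))
seq-ν⁻ (close (opn t) u) = _ , com t u , ≋-refl

tau-ν⁻ : Tau (ν P) X → ∃ λ Y → Tau P Y × ν Y ≋ X
tau-ν⁻ (seq s) with seq-ν⁻ s
... | _ , s' , f = _ , seq s' , f
tau-ν⁻ (res t) = _ , t , ≋-refl

seq-ν : {a : Val n} → Seq (wkV a) P X → ∃ λ Y → Seq a (ν P) Y × ν X ≋ Y
seq-ν (com {v = v} t u) with v0-or-wk v
... | inj₁ refl = _ , close (opn t) u , ≋-refl
... | inj₂ (v' , refl) =
  _ , com (res-o t) (res-β u) , ≋-ν (≡⇒≋ (sym (sub0-swap v' _)))
seq-ν (close {P₂ = P₂} t u) =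
  _ , close (res-β t) (res-β (swap-β u)) ,
  ≋-trans ≋-ν-swap (≋-ν (≋-ν (≡⇒≋ (sub0-lift-swap P₂))))

sub-sub0 : (σ : Sub n m) (v : Val n) (P : Proc (suc n)) →
           sub σ (sub (sub0 v) P) ≡ sub (sub0 (subV σ v)) (sub (liftσ σ) P)
sub-sub0 σ v = sub₁₁ λ where
  zero    → refl
  (suc x) → sym (sub0-wk _ (σ x))

tau-sub : (σ : Sub n m) → Tau P X → Tau (sub σ P) (sub σ X)
tau-sub σ (seq (com {v = v} {P₂ = P₂} t u)) =
  tau-retarget (sym (sub-sub0 σ v P₂)) (seq (com (sub-o σ t) (sub-β σ u)))
tau-sub σ (seq {a = a} (close {P₂ = P₂} t u)) =
  tau-retarget (cong ν (sym (sub-sub0 (liftσ σ) v0 P₂)))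
    (seq (close (sub-β σ t) (relabel-β (lift-wk σ a) (sub-β (liftσ σ) u))))
tau-sub σ (parL t) = parL (tau-sub σ t)
tau-sub σ (parR t) = parR (tau-sub σ t)
tau-sub σ (res t)  = res (tau-sub (liftσ σ) t)

-- A communication of sub σ P on a, traced back to P: σ may have identified
-- the channels c and d of the two partners.
data Fused {n m} (σ : Sub n m) (a : Val m) (P : Proc n) : Proc m → Set where
  com   : ∀ {c d v P₁ P₂} → subV σ c ≡ a → subV σ d ≡ a →
          Tr P (ō c v) P₁ → Tr P₁ (β ↓ d) P₂ →
          Fused σ a P (sub (sub0 (subV σ v)) (sub (liftσ σ) P₂))
  close : ∀ {c d P₁ P₂} → subV σ c ≡ a → subV σ d ≡ a →
          Tr P (β ↑ c) P₁ → Tr P₁ (β ↓ (wkV d)) P₂ →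
          Fused σ a P (ν (sub (sub0 v0) (sub (liftσ (liftσ σ)) P₂)))

seq-sub⁻ : (σ : Sub n m) (P : Proc n) {a : Val m} → Seq a (sub σ P) X → Fused σ a P X
seq-sub⁻ σ P (com t u) with inv-o σ P t
... | _ , _ , P₁ , t' , ec , refl , refl with inv-β σ P₁ u
... | _ , _ , u' , ed , refl = com ec ed t' u'
seq-sub⁻ σ P (close t u) with inv-β σ P t
... | _ , P₁ , t' , ec , refl with inv-β (liftσ σ) P₁ u
... | d , _ , u' , ed , refl with lift-wk⁻ σ d ed
... | _ , refl , ed' = close ec ed' t' u'

-- A communication on `a` can be new only if two distinct names lie over `a`; injectivity over that
-- single name turns it back into one of `P`.
unfuse : (σ : Sub n m) {a : Val m} → (∀ c d → subV σ c ≡ a → subV σ d ≡ a → c ≡ d) →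
         Fused σ a P X → ∃ λ Y → Tau P Y × X ≡ sub σ Y
unfuse σ uniq (com {c} {d} {v} {P₂ = P₂} ec ed t u) with uniq c d ec ed
... | refl = _ , seq (com t u) , sym (sub-sub0 σ v P₂)
unfuse σ uniq (close {c} {d} {P₂ = P₂} ec ed t u) with uniq c d ec ed
... | refl = _ , seq (close t u) , cong ν (sym (sub-sub0 (liftσ σ) v0 P₂))

-- A substitution identifies free names only, so a communication it creates is on a visible channel.
-- At `ν` the channel decides: a `Seq` on another name crosses the binder and stays visible, one on
-- the bound name is unfused, since `liftσ σ` sends nothing else there.
tau-sub⁻ : (σ : Sub n m) (P : Proc n) → Tau (sub σ P) X →
           (∃ λ Y → Tau P Y × X ≋ sub σ Y) ⊎
           (∃₂ λ a Y → Seq a (sub σ P) Y × X ≋ Y)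
tau-sub⁻ σ 𝟘         (seq s) = inj₂ (_ , _ , s , ≋-refl)
tau-sub⁻ σ (inp _ _) (seq s) = inj₂ (_ , _ , s , ≋-refl)
tau-sub⁻ σ (out _ _) (seq s) = inj₂ (_ , _ , s , ≋-refl)
tau-sub⁻ σ (rep _ _) (seq s) = inj₂ (_ , _ , s , ≋-refl)
tau-sub⁻ σ (P ∣ Q)   (seq s) = inj₂ (_ , _ , s , ≋-refl)
tau-sub⁻ σ (ν P)     (seq s) = inj₂ (_ , _ , s , ≋-refl)
tau-sub⁻ σ (P ∣ Q) (parL t) with tau-sub⁻ σ P t
... | inj₁ (_ , t' , f) = inj₁ (_ , parL t' , ≋-par f)
... | inj₂ (_ , _ , s , f) with seq-parL s
... | _ , s' , g = inj₂ (_ , _ , s' , ≋-trans (≋-par f) g)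
tau-sub⁻ σ (P ∣ Q) (parR t) with tau-sub⁻ σ Q t
... | inj₁ (_ , t' , f) = inj₁ (_ , parR t' , ≋-parʳ f)
... | inj₂ (_ , _ , s , f) with seq-parR s
... | _ , s' , g = inj₂ (_ , _ , s' , ≋-trans (≋-parʳ f) g)
tau-sub⁻ σ (ν P) (res t) with tau-sub⁻ (liftσ σ) P t
... | inj₁ (_ , t' , f) = inj₁ (_ , res t' , ≋-ν f)
... | inj₂ (a , _ , s , f) with v0-or-wk a
... | inj₂ (_ , refl) with seq-ν s
... | _ , s' , g = inj₂ (_ , _ , s' , ≋-trans (≋-ν f) g)
tau-sub⁻ σ (ν P) (res t) | inj₂ (a , _ , s , f) | inj₁ refl
  with unfuse (liftσ σ) (λ c d ec ed → trans (lift-v0⁻ σ c ec) (sym (lift-v0⁻ σ d ed)))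
              (seq-sub⁻ (liftσ σ) P s)
... | _ , t' , refl = inj₁ (_ , res t' , ≋-ν f)

tau-wk⁻ : (P : Proc n) → Tau (wk P) X → ∃ λ Y → Tau P Y × X ≋ wk Y
tau-wk⁻ P t with tau-sub⁻ ⌜ suc ⌝ P t
... | inj₁ r = r
... | inj₂ (_ , _ , s , f)
  with unfuse ⌜ suc ⌝ (λ c d ec ed → wk-subV-injective c d (trans ec (sym ed)))
              (seq-sub⁻ ⌜ suc ⌝ P s)
... | _ , t' , refl = _ , t' , f

wk≁v0 : (P : Proc n) → ∀ {d} → Tr (wk P) (β d v0) X → ⊥
wk≁v0 P t with inv-β ⌜ suc ⌝ P t
... | a , _ , _ , e , _ = wk-subV≢v0 a e

-- `wk P` does not know the name at index 0 and can neither send nor receive on it, so both partners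
-- are in `Q`.
seq-v0-par-wk : (P : Proc n) → Seq v0 (wk P ∣ Q) X → ∃ λ Y → Tau Q Y × wk P ∣ Y ≋ X
seq-v0-par-wk P (com (parL t) u) with inv-o ⌜ suc ⌝ P t
... | a , _ , _ , _ , e , _ , _ = ⊥-elim (wk-subV≢v0 a e)
seq-v0-par-wk P (com (parR t) (parL u)) = ⊥-elim (wk≁v0 P u)
seq-v0-par-wk P (com (parR t) (parR u)) =
  _ , seq (com t u) , ≋-par (≡⇒≋ (sym (sub0-wkP _ (wk P))))
seq-v0-par-wk P (close (parL t) u) = ⊥-elim (wk≁v0 P t)
seq-v0-par-wk P (close (parR t) (parL u)) with inv-β ⌜ suc ⌝ (wk P) u
... | a , _ , u' , e , _ = ⊥-elim (wk≁v0 P (relabel-β (wkV-injective a v0 (trans (sym (wkV-subV a)) e)) u'))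
seq-v0-par-wk P (close (parR t) (parR u)) =
  _ , seq (close t u) ,
  ≋-trans ≋-extr (≋-ν (≋-par (≡⇒≋ (sym (sub0-wkP v0 (wk (wk P)))))))

-- A communication on the restricted name takes place inside `Q` and survives narrowing of the
-- scope; one on any other name is visible outside `ν`, where `seq-harmony` applies.
tau-extr⁻ : Tau (wk P ∣ Q) X → ∃ λ Y → Tau (P ∣ ν Q) Y × ν X ≋ Y
tau-extr⁻ {P = P} (parL t) with tau-wk⁻ P t
... | _ , t' , f = _ , parL t' , ≋-trans (≋-ν (≋-par f)) (≋-sym ≋-extr)
tau-extr⁻ (parR t) = _ , parR (res t) , ≋-sym ≋-extr
tau-extr⁻ {P = P} (seq {a = a} s) with v0-or-wk a
... | inj₁ refl with seq-v0-par-wk P s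
... | _ , t , f = _ , parR (res t) , ≋-trans (≋-ν (≋-sym f)) (≋-sym ≋-extr)
tau-extr⁻ {P = P} (seq s) | inj₂ (_ , refl) with seq-ν s
... | _ , s' , f with seq-harmony (≋-sym ≋-extr) s'
... | _ , s'' , g = _ , seq s'' , ≋-trans f g

tau-seq-harmony : {a : Val n} → P ≋ Q → Seq a P X → ∃ λ Y → Tau Q Y × X ≋ Y
tau-seq-harmony e s with seq-harmony e s
... | _ , s' , f = _ , seq s' , f

tau-ν-swap : Tau (ν P) X → ∃ λ Y → Tau (ν (ν (swap P))) Y × ν X ≋ Y
tau-ν-swap t with tau-ν⁻ t
... | _ , t' , f = _ , res (res (tau-sub ⌜ swap01 ⌝ t')) , ≋-trans (≋-ν (≋-sym f)) ≋-ν-swap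

mutual
  -- A visible communication consists of two transitions, so its case is uniform in the congruence.
  -- The remaining clauses meet only steps already located in a component or under a binder.
  tau-harmony : P ≋ Q → Tau P X → ∃ λ Y → Tau Q Y × X ≋ Y
  tau-harmony e (seq s) = tau-seq-harmony e s
  tau-harmony ≋-refl t = _ , t , ≋-refl
  tau-harmony (≋-sym e) t with tau-harmony⁻ e t
  ... | _ , t' , f = _ , t' , ≋-sym f
  tau-harmony (≋-trans e₁ e₂) t with tau-harmony e₁ t
  ... | _ , t₁ , f₁ with tau-harmony e₂ t₁
  ... | _ , t₂ , f₂ = _ , t₂ , ≋-trans f₁ f₂
  -- Regrouping may separate the two partners, so the communication is first lifted to the whole
  -- process.
  tau-harmony ≋-assoc (parL (seq s)) with seq-parL s
  ... | _ , s' , f with tau-seq-harmony ≋-assoc s'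
  ... | _ , t , g = _ , t , ≋-trans f g
  tau-harmony ≋-assoc (parL (parL t)) = _ , parL t , ≋-assoc
  tau-harmony ≋-assoc (parL (parR t)) = _ , parR (parL t) , ≋-assoc
  tau-harmony ≋-assoc (parR t) = _ , parR (parR t) , ≋-assoc
  tau-harmony ≋-comm (parL t) = _ , parR t , ≋-comm
  tau-harmony ≋-comm (parR t) = _ , parL t , ≋-comm
  tau-harmony ≋-unit (parL t) = _ , t , ≋-unit
  tau-harmony ≋-unit (parR (seq (com () _)))
  tau-harmony ≋-unit (parR (seq (close () _)))
  tau-harmony ≋-extr (parL t) = _ , res (parL (tau-sub ⌜ suc ⌝ t)) , ≋-extr
  tau-harmony ≋-extr (parR t) with tau-ν⁻ t
  ... | _ , t' , f = _ , res (parR t') , ≋-trans (≋-parʳ (≋-sym f)) ≋-extr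
  tau-harmony ≋-ν-swap (res t) = tau-ν-swap t
  tau-harmony ≋-ν-zero (res (seq (com () _)))
  tau-harmony ≋-ν-zero (res (seq (close () _)))
  tau-harmony (≋-par e) (parL t) with tau-harmony e t
  ... | _ , t' , f = _ , parL t' , ≋-par f
  tau-harmony (≋-par e) (parR t) = _ , parR t , ≋-par e
  tau-harmony (≋-ν e) (res t) with tau-harmony e t
  ... | _ , t' , f = _ , res t' , ≋-ν f

  tau-harmony⁻ : P ≋ Q → Tau Q X → ∃ λ Y → Tau P Y × Y ≋ X
  tau-harmony⁻ e (seq s) with tau-seq-harmony (≋-sym e) s
  ... | _ , t , f = _ , t , ≋-sym f
  tau-harmony⁻ ≋-refl t = _ , t , ≋-refl
  tau-harmony⁻ (≋-sym e) t with tau-harmony e t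
  ... | _ , t' , f = _ , t' , ≋-sym f
  tau-harmony⁻ (≋-trans e₁ e₂) t with tau-harmony⁻ e₂ t
  ... | _ , t₁ , f₁ with tau-harmony⁻ e₁ t₁
  ... | _ , t₂ , f₂ = _ , t₂ , ≋-trans f₂ f₁
  tau-harmony⁻ ≋-assoc (parR (seq s)) with seq-parR s
  ... | _ , s' , f with tau-seq-harmony (≋-sym ≋-assoc) s'
  ... | _ , t , g = _ , t , ≋-sym (≋-trans f g)
  tau-harmony⁻ ≋-assoc (parR (parL t)) = _ , parL (parR t) , ≋-assoc
  tau-harmony⁻ ≋-assoc (parR (parR t)) = _ , parR t , ≋-assoc
  tau-harmony⁻ ≋-assoc (parL t) = _ , parL (parL t) , ≋-assoc
  tau-harmony⁻ ≋-comm (parL t) = _ , parR t , ≋-comm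
  tau-harmony⁻ ≋-comm (parR t) = _ , parL t , ≋-comm
  tau-harmony⁻ ≋-unit t = _ , parL t , ≋-unit
  tau-harmony⁻ ≋-extr (res t) with tau-extr⁻ t
  ... | _ , t' , f = _ , t' , ≋-sym f
  tau-harmony⁻ (≋-ν-swap {P = P}) (res t) with tau-ν-swap t
  ... | Y , t' , f = Y , subst (λ Q → Tau (ν (ν Q)) Y) (swap-invol P) t' , ≋-sym f
  tau-harmony⁻ (≋-par e) (parL t) with tau-harmony⁻ e t
  ... | _ , t' , f = _ , parL t' , ≋-par f
  tau-harmony⁻ (≋-par e) (parR t) = _ , parR t , ≋-par e
  tau-harmony⁻ (≋-ν e) (res t) with tau-harmony⁻ e t
  ... | _ , t' , f = _ , res t' , ≋-ν f

-- Weak transitions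

infix 4 _⇛_
data _⇛_ {n} : Proc n → Proc n → Set where
  done : P ≋ Q → P ⇛ Q
  step : Tau P P₁ → P₁ ⇛ Q → P ⇛ Q

≋-⇛ : P ≋ P' → P' ⇛ Q → P ⇛ Q
≋-⇛ e (done f) = done (≋-trans e f)
≋-⇛ e (step t r) with tau-harmony⁻ e t
... | _ , t' , f = step t' (≋-⇛ f r)

⇛-trans : P ⇛ Q → Q ⇛ R → P ⇛ R
⇛-trans (done e) r   = ≋-⇛ e r
⇛-trans (step t q) r = step t (⇛-trans q r)

⇛-parˡ : P ⇛ P' → P ∣ Q ⇛ P' ∣ Q
⇛-parˡ (done e)   = done (≋-par e)
⇛-parˡ (step t r) = step (parL t) (⇛-parˡ r)

⇛-parʳ : Q ⇛ Q' → P ∣ Q ⇛ P ∣ Q'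
⇛-parʳ (done e)   = done (≋-parʳ e)
⇛-parʳ (step t r) = step (parR t) (⇛-parʳ r)

⇛-ν : P ⇛ P' → ν P ⇛ ν P'
⇛-ν (done e)   = done (≋-ν e)
⇛-ν (step t r) = step (res t) (⇛-ν r)

⇛-sub : (σ : Sub n m) → P ⇛ P' → sub σ P ⇛ sub σ P'
⇛-sub σ (done e)   = done (sub-≋ σ e)
⇛-sub σ (step t r) = step (tau-sub σ t) (⇛-sub σ r)

WTr : Proc n → Lab n m → Proc m → Set
WTr P α Q = ∃₂ λ P₁ P₂ → P ⇛ P₁ × Tr P₁ α P₂ × P₂ ⇛ Q

-- A message has no continuation and guards nothing, and a free output avoids every binder above it,
-- so it floats out by scope extrusion.
async-ō : {a v : Val n} → Tr P (ō a v) P' → P ≋ out a v ∣ P'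
async-ō out-ax = ≋-sym ≋-unit
async-ō (parL t) = ≋-trans (≋-par (async-ō t)) ≋-assoc
async-ō (parR t) = ≋-trans (≋-parʳ (async-ō t)) ≋-exchange
async-ō (res-o {a = a} {v} t) = ≋-trans (≋-ν (async-ō t))
  (≋-trans (≋-ν (≋-par (≡⇒≋ (cong₂ out (sym (wkV-subV a)) (sym (wkV-subV v)))))) (≋-sym ≋-extr))

-- The binder of the extruded name is moved outward past the other restrictions by `≋-ν-swap`;
-- beneath it the output is free.
async-β↑ : {a : Val n} → Tr P (β ↑ a) P' → P ≋ ν (out (wkV a) v0 ∣ P')
async-β↑ (parL t) = ≋-trans (≋-par (async-β↑ t)) (≋-trans ≋-extrˡ (≋-ν ≋-assoc))
async-β↑ (parR t) = ≋-trans (≋-parʳ (async-β↑ t)) (≋-trans ≋-extr (≋-ν ≋-exchange))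
async-β↑ (res-β {a = a} t) = ≋-trans (≋-ν (async-β↑ t)) (≋-trans ≋-ν-swap (≋-ν
  (≋-trans (≋-ν (≋-par (≡⇒≋ (cong (λ b → out b (nm (var (suc zero))))
    (trans (swapV-wk² a) (sym (wkV-subV (wkV a)))))))) (≋-sym ≋-extr))))
async-β↑ (opn t) = ≋-ν (async-ō t)

-- Asynchrony: the pending message can wait while the emitter goes on to the input.
weak-com : {a v : Val n} → WTr P (ō a v) Q → WTr Q (β ↓ a) R → P ⇛ sub (sub0 v) R
weak-com {v = v} (_ , _ , r₁ , t , r₂) (_ , _ , r₃ , u , r₄) =
  ⇛-trans r₁ (≋-⇛ (async-ō t) (⇛-trans (⇛-parʳ (⇛-trans r₂ r₃))
    (step (seq (com (parL out-ax) (parR u))) (≋-⇛ ≋-unitˡ (⇛-sub (sub0 v) r₄)))))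

weak-close : {a : Val n} → WTr P (β ↑ a) Q → WTr Q (β ↓ (wkV a)) R → P ⇛ ν (sub (sub0 v0) R)
weak-close (_ , _ , r₁ , t , r₂) (_ , _ , r₃ , u , r₄) =
  ⇛-trans r₁ (≋-⇛ (async-β↑ t) (⇛-ν (⇛-trans (⇛-parʳ (⇛-trans r₂ r₃))
    (step (seq (com (parL out-ax) (parR u))) (≋-⇛ ≋-unitˡ (⇛-sub (sub0 v0) r₄))))))

weak-parˡ : {α : Lab n m} → WTr P α P' → WTr (P ∣ Q) α (P' ∣ along α Q)
weak-parˡ (_ , _ , r₁ , t , r₂) = _ , _ , ⇛-parˡ r₁ , parL t , ⇛-parˡ r₂

weak-parʳ : {α : Lab n m} → WTr Q α Q' → WTr (P ∣ Q) α (along α P ∣ Q')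
weak-parʳ (_ , _ , r₁ , t , r₂) = _ , _ , ⇛-parʳ r₁ , parR t , ⇛-parʳ r₂

weak-ν-ō : {a v : Val n} → WTr P (ō (wkV a) (wkV v)) P' → WTr (ν P) (ō a v) (ν P')
weak-ν-ō (_ , _ , r₁ , t , r₂) = _ , _ , ⇛-ν r₁ , res-o t , ⇛-ν r₂

weak-ν-β : {d : Dir} {a : Val n} → WTr P (β d (wkV a)) P' → WTr (ν P) (β d a) (ν (swap P'))
weak-ν-β (_ , _ , r₁ , t , r₂) = _ , _ , ⇛-ν r₁ , res-β t , ⇛-ν (⇛-sub ⌜ swap01 ⌝ r₂)

weak-opn : {a : Val n} → WTr P (ō (wkV a) v0) P' → WTr (ν P) (β ↑ a) P'
weak-opn (_ , _ , r₁ , t , r₂) = _ , _ , ⇛-ν r₁ , opn t , r₂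

≋-weak : {α : Lab n m} → P ≋ Q → WTr Q α R → WTr P α R
≋-weak e (_ , _ , r₁ , t , r₂) = _ , _ , ≋-⇛ e r₁ , t , r₂

weak-ō-sub : (σ : Sub n m) {a v : Val n} → WTr P (ō a v) P' →
             WTr (sub σ P) (ō (subV σ a) (subV σ v)) (sub σ P')
weak-ō-sub σ (_ , _ , r₁ , t , r₂) = _ , _ , ⇛-sub σ r₁ , sub-o σ t , ⇛-sub σ r₂

weak-β-sub : (σ : Sub n m) {d : Dir} {a : Val n} → WTr P (β d a) P' →
             WTr (sub σ P) (β d (subV σ a)) (sub (liftσ σ) P')
weak-β-sub σ (_ , _ , r₁ , t , r₂) = _ , _ , ⇛-sub σ r₁ , sub-β σ t , ⇛-sub (liftσ σ) r₂

-- The asynchronous π-calculus and its simple sorts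

⟨_⟩ : Pi.Proc n → Proc n
⟨ Pi.𝟘 ⟩       = 𝟘
⟨ P Pi.∣ Q ⟩   = ⟨ P ⟩ ∣ ⟨ Q ⟩
⟨ Pi.inp a P ⟩ = inp (nm a) ⟨ P ⟩
⟨ Pi.out a v ⟩ = out (nm a) v
⟨ Pi.ν P ⟩     = ν ⟨ P ⟩
⟨ Pi.rep a P ⟩ = rep (nm a) ⟨ P ⟩

liftσ-⌜⌝ : (ρ : Ren n m) (x : Fin (suc n)) → liftσ ⌜ ρ ⌝ x ≡ ⌜ liftR ρ ⌝ x
liftσ-⌜⌝ ρ zero    = refl
liftσ-⌜⌝ ρ (suc x) = refl

mutual
  ⟨⟩-ren : (ρ : Ren n m) (P : Pi.Proc n) → ⟨ Pi.ren ρ P ⟩ ≡ sub ⌜ ρ ⌝ ⟨ P ⟩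
  ⟨⟩-ren ρ Pi.𝟘         = refl
  ⟨⟩-ren ρ (P Pi.∣ Q)   = cong₂ _∣_ (⟨⟩-ren ρ P) (⟨⟩-ren ρ Q)
  ⟨⟩-ren ρ (Pi.inp a P) = cong₂ inp (renV≗subV ρ (nm a)) (⟨⟩-liftR ρ P)
  ⟨⟩-ren ρ (Pi.out a v) = cong₂ out (renV≗subV ρ (nm a)) (renV≗subV ρ v)
  ⟨⟩-ren ρ (Pi.ν P)     = cong ν (⟨⟩-liftR ρ P)
  ⟨⟩-ren ρ (Pi.rep a P) = cong₂ rep (renV≗subV ρ (nm a)) (⟨⟩-liftR ρ P)

  ⟨⟩-liftR : (ρ : Ren n m) (P : Pi.Proc (suc n)) → ⟨ Pi.ren (liftR ρ) P ⟩ ≡ sub (liftσ ⌜ ρ ⌝) ⟨ P ⟩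
  ⟨⟩-liftR ρ P = trans (⟨⟩-ren (liftR ρ) P) (sub-cong (λ x → sym (liftσ-⌜⌝ ρ x)) ⟨ P ⟩)

asSubj-just : (v : Val n) {b : Subj n} → asSubj v ≡ just b → v ≡ nm b
asSubj-just (nm a) refl = refl

⟨⟩-sub : (σ : Sub n m) (P : Pi.Proc n) {P' : Pi.Proc m} → Pi.sub σ P ≡ just P' →
         ⟨ P' ⟩ ≡ sub σ ⟨ P ⟩
⟨⟩-sub σ Pi.𝟘 refl = refl
⟨⟩-sub σ (P Pi.∣ Q) e with Pi.sub σ P in eP | Pi.sub σ Q in eQ
⟨⟩-sub σ (P Pi.∣ Q) refl | just _ | just _ = cong₂ _∣_ (⟨⟩-sub σ P eP) (⟨⟩-sub σ Q eQ)
⟨⟩-sub σ (Pi.inp a P) e with asSubj (subS σ a) in ea | Pi.sub (liftσ σ) P in eP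
⟨⟩-sub σ (Pi.inp a P) refl | just _ | just _ =
  cong₂ inp (sym (asSubj-just (subS σ a) ea)) (⟨⟩-sub (liftσ σ) P eP)
⟨⟩-sub σ (Pi.out a v) e with asSubj (subS σ a) in ea
⟨⟩-sub σ (Pi.out a v) refl | just _ = cong₂ out (sym (asSubj-just (subS σ a) ea)) refl
⟨⟩-sub σ (Pi.ν P) e with Pi.sub (liftσ σ) P in eP
⟨⟩-sub σ (Pi.ν P) refl | just _ = cong ν (⟨⟩-sub (liftσ σ) P eP)
⟨⟩-sub σ (Pi.rep a P) e with asSubj (subS σ a) in ea | Pi.sub (liftσ σ) P in eP
⟨⟩-sub σ (Pi.rep a P) refl | just _ | just _ =
  cong₂ rep (sym (asSubj-just (subS σ a) ea)) (⟨⟩-sub (liftσ σ) P eP)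

-- Sorts ensure that `Pi.sub` is defined, that is, that `⋆` never replaces a subject. They carry no
-- polarity, because in the translation one channel stands for both ends of a pair.
data Sort : Set where
  ch  : Sort → Sort
  val : Sort

ch-injective : ∀ {s t} → ch s ≡ ch t → s ≡ t
ch-injective refl = refl

SEnv : ℕ → Set
SEnv n = Fin n → Sort

sortV : SEnv n → Val n → Sort
sortV Φ (nm (var x)) = Φ x
sortV Φ (nm (sc ω))  = ch val
sortV Φ ⋆            = val

data Sorted : ∀ {n} → SEnv n → Pi.Proc n → Set where
  s-𝟘   : {Φ : SEnv n} → Sorted Φ Pi.𝟘
  s-∣   : ∀ {Φ : SEnv n} {P Q} → Sorted Φ P → Sorted Φ Q → Sorted Φ (P Pi.∣ Q)
  s-inp : ∀ {Φ : SEnv n} {a s P} → sortV Φ (nm a) ≡ ch s → Sorted (s ▹ Φ) P → Sorted Φ (Pi.inp a P)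
  s-out : ∀ {Φ : SEnv n} {a v} → sortV Φ (nm a) ≡ ch (sortV Φ v) → Sorted Φ (Pi.out a v)
  s-ν   : ∀ {Φ : SEnv n} {s P} → Sorted (s ▹ Φ) P → Sorted Φ (Pi.ν P)
  s-rep : ∀ {Φ : SEnv n} {a s P} → sortV Φ (nm a) ≡ ch s → Sorted (s ▹ Φ) P → Sorted Φ (Pi.rep a P)

private variable
  Φ : SEnv n
  Ψ : SEnv m
  s t : Sort

sortV-ren : {ρ : Ren n m} → (∀ x → Ψ (ρ x) ≡ Φ x) → ∀ v → sortV Ψ (renV ρ v) ≡ sortV Φ v
sortV-ren h (nm (var x)) = h x
sortV-ren h (nm (sc ω))  = refl
sortV-ren h ⋆            = refl

sortV-wk : (v : Val n) → sortV (s ▹ Φ) (wkV v) ≡ sortV Φ v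
sortV-wk = sortV-ren (λ x → refl)

liftR-sort : {ρ : Ren n m} → (∀ x → Ψ (ρ x) ≡ Φ x) → ∀ x → (s ▹ Ψ) (liftR ρ x) ≡ (s ▹ Φ) x
liftR-sort h zero    = refl
liftR-sort h (suc x) = h x

sorted-ren : ∀ {P} {ρ : Ren n m} → (∀ x → Ψ (ρ x) ≡ Φ x) → Sorted Φ P → Sorted Ψ (Pi.ren ρ P)
sorted-ren h s-𝟘 = s-𝟘
sorted-ren h (s-∣ p q) = s-∣ (sorted-ren h p) (sorted-ren h q)
sorted-ren h (s-inp {a = a} e p) =
  s-inp (trans (sortV-ren h (nm a)) e) (sorted-ren (liftR-sort h) p)
sorted-ren h (s-out {a = a} {v} e) =
  s-out (trans (sortV-ren h (nm a)) (trans e (cong ch (sym (sortV-ren h v)))))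
sorted-ren h (s-ν p) = s-ν (sorted-ren (liftR-sort h) p)
sorted-ren h (s-rep {a = a} e p) =
  s-rep (trans (sortV-ren h (nm a)) e) (sorted-ren (liftR-sort h) p)

sorted-wk : ∀ {P} → Sorted Φ P → Sorted (s ▹ Φ) (Pi.wk P)
sorted-wk = sorted-ren (λ x → refl)

sorted-swap : ∀ {P} → Sorted (s ▹ (t ▹ Φ)) P → Sorted (t ▹ (s ▹ Φ)) (Pi.ren swap01 P)
sorted-swap = sorted-ren λ where
  zero          → refl
  (suc zero)    → refl
  (suc (suc x)) → refl

sortV-sub : {σ : Sub n m} → (∀ x → sortV Ψ (σ x) ≡ Φ x) → ∀ v → sortV Ψ (subV σ v) ≡ sortV Φ v
sortV-sub h (nm (var x)) = h x
sortV-sub h (nm (sc ω))  = refl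
sortV-sub h ⋆            = refl

liftσ-sort : {σ : Sub n m} → (∀ x → sortV Ψ (σ x) ≡ Φ x) →
             ∀ x → sortV (s ▹ Ψ) (liftσ σ x) ≡ (s ▹ Φ) x
liftσ-sort h zero            = refl
liftσ-sort {σ = σ} h (suc x) = trans (sortV-wk (σ x)) (h x)

sub0-sort : (v : Val n) → sortV Φ v ≡ s → ∀ x → sortV Φ (sub0 v x) ≡ (s ▹ Φ) x
sub0-sort v e zero    = e
sub0-sort v e (suc x) = refl

ch-is-name : (v : Val n) → sortV Φ v ≡ ch s → ∃ λ b → v ≡ nm b
ch-is-name (nm b) e = b , refl

sorted-sub : ∀ {P} (Ψ : SEnv m) (σ : Sub n m) → (∀ x → sortV Ψ (σ x) ≡ Φ x) → Sorted Φ P →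
             ∃ λ P' → Pi.sub σ P ≡ just P' × Sorted Ψ P'
sorted-sub Ψ σ h s-𝟘 = _ , refl , s-𝟘
sorted-sub Ψ σ h (s-∣ p q) with sorted-sub Ψ σ h p | sorted-sub Ψ σ h q
... | _ , e₁ , p' | _ , e₂ , q' rewrite e₁ | e₂ = _ , refl , s-∣ p' q'
sorted-sub Ψ σ h (s-inp {a = a} e p)
  with trans (sortV-sub {Ψ = Ψ} {σ = σ} h (nm a)) e | sorted-sub (_ ▹ Ψ) (liftσ σ) (liftσ-sort h) p
... | ea | _ , e₁ , p' with ch-is-name (subS σ a) ea
... | _ , eb rewrite e₁ | eb = _ , refl , s-inp ea p'
sorted-sub Ψ σ h (s-out {a = a} {v} e)
  with trans (sortV-sub {Ψ = Ψ} {σ = σ} h (nm a)) (trans e (cong ch (sym (sortV-sub {Ψ = Ψ} {σ = σ} h v))))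
... | ea with ch-is-name (subS σ a) ea
... | _ , eb rewrite eb = _ , refl , s-out ea
sorted-sub Ψ σ h (s-ν p) with sorted-sub (_ ▹ Ψ) (liftσ σ) (liftσ-sort h) p
... | _ , e₁ , p' rewrite e₁ = _ , refl , s-ν p'
sorted-sub Ψ σ h (s-rep {a = a} e p)
  with trans (sortV-sub {Ψ = Ψ} {σ = σ} h (nm a)) e | sorted-sub (_ ▹ Ψ) (liftσ σ) (liftσ-sort h) p
... | ea | _ , e₁ , p' with ch-is-name (subS σ a) ea
... | _ , eb rewrite e₁ | eb = _ , refl , s-rep ea p'

sorted-sub0 : ∀ {P Q} (v : Val n) → sortV Φ v ≡ s → Sorted (s ▹ Φ) P →
              Pi.sub (sub0 v) P ≡ just Q → Sorted Φ Q
sorted-sub0 v e p eq with sorted-sub _ (sub0 v) (sub0-sort v e) p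
... | _ , eq' , p' with trans (sym eq) eq'
... | refl = p'

Residual : SEnv n → Pi.Act n m → Pi.Proc m → Set
Residual Φ Pi.τ P              = Sorted Φ P
Residual Φ (Pi.out a v) P   = sortV Φ (nm a) ≡ ch (sortV Φ v) × Sorted Φ P
Residual Φ (Pi.bout a) P       = ∃ λ s → sortV Φ (nm a) ≡ ch s × Sorted (s ▹ Φ) P
Residual Φ (Pi.inp a) P     = ∃ λ s → sortV Φ (nm a) ≡ ch s × Sorted (s ▹ Φ) P

residual-par : ∀ {P Q} (α : Pi.Act n m) → Residual Φ α P → Sorted Φ Q → Residual Φ α (P Pi.∣ Pi.along α Q)
residual-par Pi.τ p q                      = s-∣ p q
residual-par (Pi.out _ _) (e , p) q     = e , s-∣ p q
residual-par (Pi.bout _) (_ , e , p) q     = _ , e , s-∣ p (sorted-wk q)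
residual-par (Pi.inp _) (_ , e , p) q   = _ , e , s-∣ p (sorted-wk q)

residual-parʳ : ∀ {P Q} (α : Pi.Act n m) → Sorted Φ P → Residual Φ α Q → Residual Φ α (Pi.along α P Pi.∣ Q)
residual-parʳ Pi.τ q p                     = s-∣ q p
residual-parʳ (Pi.out _ _) q (e , p)    = e , s-∣ q p
residual-parʳ (Pi.bout _) q (_ , e , p)    = _ , e , s-∣ (sorted-wk q) p
residual-parʳ (Pi.inp _) q (_ , e , p)  = _ , e , s-∣ (sorted-wk q) p

residual-ν : ∀ {P} (α : Pi.Act n m) → Residual (s ▹ Φ) (Pi.wkAct α) P → Residual Φ α (Pi.ν (Pi.fixν α P))
residual-ν Pi.τ p = s-ν p
residual-ν (Pi.out a v) (e , p) =
  trans (sym (sortV-wk (nm a))) (trans e (cong ch (sortV-wk v))) , s-ν p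
residual-ν (Pi.bout a) (_ , e , p) =
  _ , trans (sym (sortV-wk (nm a))) e , s-ν (sorted-swap p)
residual-ν (Pi.inp a) (_ , e , p) =
  _ , trans (sym (sortV-wk (nm a))) e , s-ν (sorted-swap p)

subject-reduction : ∀ {P P'} {α : Pi.Act n m} → P —[ α ]→ P' → Sorted Φ P → Residual Φ α P'
subject-reduction Pi.inp-ax (s-inp e p) = _ , e , p
subject-reduction Pi.out-ax (s-out e) = e , s-𝟘
subject-reduction Pi.rep-ax (s-rep e p) = _ , e , s-∣ p (sorted-wk (s-rep e p))
subject-reduction {α = α} (Pi.parL t) (s-∣ p q) = residual-par α (subject-reduction t p) q
subject-reduction {α = α} (Pi.parR t) (s-∣ p q) = residual-parʳ α p (subject-reduction t q)
subject-reduction (Pi.comL {v = v} t u e) (s-∣ p q)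
  with subject-reduction t p | subject-reduction u q
... | ea , p' | _ , eb , q' =
  s-∣ p' (sorted-sub0 v (ch-injective (trans (sym ea) eb)) q' e)
subject-reduction (Pi.comR {v = v} t u e) (s-∣ p q)
  with subject-reduction t p | subject-reduction u q
... | _ , ea , p' | eb , q' =
  s-∣ (sorted-sub0 v (ch-injective (trans (sym eb) ea)) p' e) q'
subject-reduction (Pi.closeL t u) (s-∣ p q)
  with subject-reduction t p | subject-reduction u q
... | _ , ea , p' | _ , eb , q' with ch-injective (trans (sym ea) eb)
... | refl = s-ν (s-∣ p' q')
subject-reduction (Pi.closeR t u) (s-∣ p q)
  with subject-reduction t p | subject-reduction u q
... | _ , ea , p' | _ , eb , q' with ch-injective (trans (sym ea) eb)
... | refl = s-ν (s-∣ p' q')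
subject-reduction (Pi.res {α = α} t) (s-ν p) = residual-ν α (subject-reduction t p)
subject-reduction (Pi.opn {a = a} t) (s-ν p) with subject-reduction t p
... | e , p' = _ , trans (sym (sortV-wk (nm a))) e , p'

-- Transitions of the π-calculus against those of the total calculus

Image : Pi.Act n m → Pi.Proc n → Pi.Proc m → Set
Image Pi.τ P P'            = ∃ λ X → Tau ⟨ P ⟩ X × X ≋ ⟨ P' ⟩
Image (Pi.out a v) P P' = Tr ⟨ P ⟩ (ō (nm a) v) ⟨ P' ⟩
Image (Pi.bout a) P P'     = Tr ⟨ P ⟩ (β ↑ (nm a)) ⟨ P' ⟩
Image (Pi.inp a) P P'   = Tr ⟨ P ⟩ (β ↓ (nm a)) ⟨ P' ⟩

⟨⟩-wk : (P : Pi.Proc n) → ⟨ Pi.wk P ⟩ ≡ wk ⟨ P ⟩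
⟨⟩-wk = ⟨⟩-ren suc

image-parL : ∀ (α : Pi.Act n m) {P P' Q} → Image α P P' → Image α (P Pi.∣ Q) (P' Pi.∣ Pi.along α Q)
image-parL Pi.τ (_ , t , f)  = _ , parL t , ≋-par f
image-parL (Pi.out _ _) t = parL t
image-parL (Pi.bout _) {Q = Q} t   = retarget (cong (_ ∣_) (sym (⟨⟩-wk Q))) (parL t)
image-parL (Pi.inp _) {Q = Q} t = retarget (cong (_ ∣_) (sym (⟨⟩-wk Q))) (parL t)

image-parR : ∀ (α : Pi.Act n m) {P Q Q'} → Image α Q Q' → Image α (P Pi.∣ Q) (Pi.along α P Pi.∣ Q')
image-parR Pi.τ (_ , t , f)  = _ , parR t , ≋-parʳ f
image-parR (Pi.out _ _) t = parR t
image-parR (Pi.bout _) {P} t   = retarget (cong (_∣ _) (sym (⟨⟩-wk P))) (parR t)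
image-parR (Pi.inp _) {P} t = retarget (cong (_∣ _) (sym (⟨⟩-wk P))) (parR t)

image-res : ∀ (α : Pi.Act n m) {P P'} → Image (Pi.wkAct α) P P' → Image α (Pi.ν P) (Pi.ν (Pi.fixν α P'))
image-res Pi.τ (_ , t , f)       = _ , res t , ≋-ν f
image-res (Pi.out _ _) t      = res-o t
image-res (Pi.bout _) {P' = P'} t   = retarget (cong ν (sym (⟨⟩-ren swap01 P'))) (res-β t)
image-res (Pi.inp _) {P' = P'} t = retarget (cong ν (sym (⟨⟩-ren swap01 P'))) (res-β t)

-- In a `close` the receiver is weakened by the extruded name before it inputs, so its residual has
-- two fresh names. Receiving the extruded name identifies them and undoes the weakening.
sub0-lift-suc : (P : Proc (suc n)) → sub (sub0 v0) (sub (liftσ ⌜ suc ⌝) P) ≡ P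
sub0-lift-suc = sub₂₀ λ where
  zero    → refl
  (suc x) → refl

image : ∀ {P P'} {α : Pi.Act n m} → P —[ α ]→ P' → Image α P P'
image Pi.inp-ax = inp-ax
image Pi.out-ax = out-ax
image (Pi.rep-ax {a = a} {P}) = retarget (cong (⟨ P ⟩ ∣_) (sym (⟨⟩-wk (Pi.rep a P)))) rep-ax
image (Pi.parL {α = α} t) = image-parL α (image t)
image (Pi.parR {α = α} t) = image-parR α (image t)
image (Pi.comL {v = v} {P' = P'} {Q' = Q'} t u e) =
  _ , seq (com (parL (image t)) (parR (image u))) ,
  ≡⇒≋ (cong₂ _∣_ (sub0-wkP v ⟨ P' ⟩) (sym (⟨⟩-sub (sub0 v) Q' e)))
image (Pi.comR {v = v} {P' = P'} {Q' = Q'} t u e) =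
  _ , seq (com (parR (image u)) (parL (image t))) ,
  ≡⇒≋ (cong₂ _∣_ (sym (⟨⟩-sub (sub0 v) P' e)) (sub0-wkP v ⟨ Q' ⟩))
image (Pi.closeL {P' = P'} {Q' = Q'} t u) =
  _ , seq (close (parL (image t)) (parR (wk-β (image u)))) ,
  ≋-ν (≡⇒≋ (cong₂ _∣_ (sub0-wkP v0 ⟨ P' ⟩) (sub0-lift-suc ⟨ Q' ⟩)))
image (Pi.closeR {P' = P'} {Q' = Q'} t u) =
  _ , seq (close (parR (image u)) (parL (wk-β (image t)))) ,
  ≋-ν (≡⇒≋ (cong₂ _∣_ (sub0-lift-suc ⟨ P' ⟩) (sub0-wkP v0 ⟨ Q' ⟩)))
image (Pi.res {α = α} t) = image-res α (image t)
image (Pi.opn t) = opn (image t)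

nm-injective : {a b : Subj n} → nm a ≡ nm b → a ≡ b
nm-injective refl = refl

wkV-nm⁻ : (a : Val n) {b : Subj (suc n)} → wkV a ≡ nm b → ∃ λ c → a ≡ nm c × b ≡ wkS c
wkV-nm⁻ (nm c) refl = c , refl , refl

image-ō⁻ : (P : Pi.Proc n) {a v : Val n} {X : Proc n} → Tr ⟨ P ⟩ (ō a v) X →
           ∃₂ λ b P' → a ≡ nm b × P —[ Pi.out b v ]→ P' × X ≡ ⟨ P' ⟩
image-ō⁻ (P Pi.∣ Q) (parL t) with image-ō⁻ P t
... | _ , _ , ea , t' , refl = _ , _ , ea , Pi.parL t' , refl
image-ō⁻ (P Pi.∣ Q) (parR t) with image-ō⁻ Q t
... | _ , _ , ea , t' , refl = _ , _ , ea , Pi.parR t' , refl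
image-ō⁻ (Pi.out a v) out-ax = _ , _ , refl , Pi.out-ax , refl
image-ō⁻ (Pi.ν P) (res-o {a = a} {v} t) with image-ō⁻ P t
... | _ , _ , ea , t' , refl with wkV-nm⁻ a ea
... | c , refl , refl = _ , _ , refl , Pi.res {α = Pi.out c v} t' , refl

dirAct : Dir → Subj n → Pi.Act n (suc n)
dirAct ↑ = Pi.bout
dirAct ↓ = Pi.inp

dir-parL : ∀ d {a : Subj n} {P P' Q} → P —[ dirAct d a ]→ P' →
           P Pi.∣ Q —[ dirAct d a ]→ P' Pi.∣ Pi.wk Q
dir-parL ↑ = Pi.parL
dir-parL ↓ = Pi.parL

dir-parR : ∀ d {a : Subj n} {P Q Q'} → Q —[ dirAct d a ]→ Q' →
           P Pi.∣ Q —[ dirAct d a ]→ Pi.wk P Pi.∣ Q'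
dir-parR ↑ = Pi.parR
dir-parR ↓ = Pi.parR

dir-res : ∀ d {a : Subj n} {P P'} → P —[ dirAct d (wkS a) ]→ P' →
          Pi.ν P —[ dirAct d a ]→ Pi.ν (Pi.ren swap01 P')
dir-res ↑ {a} = Pi.res {α = Pi.bout a}
dir-res ↓ {a} = Pi.res {α = Pi.inp a}

image-β⁻ : (P : Pi.Proc n) {d : Dir} {a : Val n} {X : Proc (suc n)} → Tr ⟨ P ⟩ (β d a) X →
           ∃₂ λ b P' → a ≡ nm b × P —[ dirAct d b ]→ P' × X ≡ ⟨ P' ⟩
image-β⁻ (P Pi.∣ Q) {d} (parL t) with image-β⁻ P t
... | _ , _ , ea , t' , refl = _ , _ , ea , dir-parL d t' , cong (_ ∣_) (sym (⟨⟩-wk Q))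
image-β⁻ (P Pi.∣ Q) {d} (parR t) with image-β⁻ Q t
... | _ , _ , ea , t' , refl = _ , _ , ea , dir-parR d t' , cong (_∣ _) (sym (⟨⟩-wk P))
image-β⁻ (Pi.inp a P) inp-ax = _ , _ , refl , Pi.inp-ax , refl
image-β⁻ (Pi.rep a P) rep-ax = _ , _ , refl , Pi.rep-ax , cong (⟨ P ⟩ ∣_) (sym (⟨⟩-wk (Pi.rep a P)))
image-β⁻ (Pi.ν P) {d} (res-β {a = a} t) with image-β⁻ P t
... | _ , P' , ea , t' , refl with wkV-nm⁻ a ea
... | c , refl , refl = _ , _ , refl , dir-res d t' , cong ν (sym (⟨⟩-ren swap01 P'))
image-β⁻ (Pi.ν P) (opn {a = a} t) with image-ō⁻ P t
... | _ , _ , ea , t' , refl with wkV-nm⁻ a ea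
... | c , refl , refl = _ , _ , refl , Pi.opn t' , refl

-- Sorting matters where a free output of one component meets an input of the other: both fix the
-- sort carried by the channel, so the value fits the bound name and the partial substitution is
-- defined.
image-τ⁻ : ∀ {Φ : SEnv n} {P} → Sorted Φ P → {X : Proc n} → Tau ⟨ P ⟩ X →
           ∃ λ P' → P —[ Pi.τ ]→ P' × X ≋ ⟨ P' ⟩
image-τ⁻ (s-∣ p q) (parL t) with image-τ⁻ p t
... | _ , t' , f = _ , Pi.parL t' , ≋-par f
image-τ⁻ (s-∣ p q) (parR t) with image-τ⁻ q t
... | _ , t' , f = _ , Pi.parR t' , ≋-parʳ f
image-τ⁻ (s-∣ {Q = Q} p q) (seq (com {v = v} (parL t) (parL u))) with image-τ⁻ p (seq (com t u))
... | _ , t' , f = _ , Pi.parL t' , ≋-trans (≋-parʳ (≡⇒≋ (sub0-wkP v ⟨ Q ⟩))) (≋-par f)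
image-τ⁻ (s-∣ {P = P} p q) (seq (com {v = v} (parR t) (parR u))) with image-τ⁻ q (seq (com t u))
... | _ , t' , f = _ , Pi.parR t' , ≋-trans (≋-par (≡⇒≋ (sub0-wkP v ⟨ P ⟩))) (≋-parʳ f)
image-τ⁻ (s-∣ {P = P} {Q} p q) (seq (com {v = v} (parL t) (parR u)))
  with image-ō⁻ P t | image-β⁻ Q u
... | _ , P' , refl , t' , refl | _ , Q' , refl , u' , refl
  with subject-reduction t' p | subject-reduction u' q
... | ea , _ | _ , eb , q' with sorted-sub _ (sub0 v) (sub0-sort v (ch-injective (trans (sym ea) eb))) q'
... | _ , e , _ = _ , Pi.comL t' u' e ,
  ≡⇒≋ (cong₂ _∣_ (sub0-wkP v ⟨ P' ⟩) (sym (⟨⟩-sub (sub0 v) Q' e)))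
image-τ⁻ (s-∣ {P = P} {Q} p q) (seq (com {v = v} (parR t) (parL u)))
  with image-ō⁻ Q t | image-β⁻ P u
... | _ , Q' , refl , t' , refl | _ , P' , refl , u' , refl
  with subject-reduction t' q | subject-reduction u' p
... | ea , _ | _ , eb , p' with sorted-sub _ (sub0 v) (sub0-sort v (ch-injective (trans (sym ea) eb))) p'
... | _ , e , _ = _ , Pi.comR u' t' e ,
  ≡⇒≋ (cong₂ _∣_ (sym (⟨⟩-sub (sub0 v) P' e)) (sub0-wkP v ⟨ Q' ⟩))
image-τ⁻ (s-∣ {Q = Q} p q) (seq (close (parL t) (parL u))) with image-τ⁻ p (seq (close t u))
... | _ , t' , f = _ , Pi.parL t' ,
  ≋-trans (≋-ν (≋-parʳ (≡⇒≋ (sub0-wkP v0 (wk ⟨ Q ⟩))))) (≋-trans (≋-sym ≋-extrˡ) (≋-par f))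
image-τ⁻ (s-∣ {P = P} p q) (seq (close (parR t) (parR u))) with image-τ⁻ q (seq (close t u))
... | _ , t' , f = _ , Pi.parR t' ,
  ≋-trans (≋-ν (≋-par (≡⇒≋ (sub0-wkP v0 (wk ⟨ P ⟩))))) (≋-trans (≋-sym ≋-extr) (≋-parʳ f))
image-τ⁻ (s-∣ {P = P} {Q} p q) (seq (close (parL t) (parR u))) with wk-β⁻ ⟨ Q ⟩ u
... | _ , u₁ , refl with image-β⁻ P t | image-β⁻ Q u₁
... | _ , P' , refl , t' , refl | _ , Q' , refl , u' , refl = _ , Pi.closeL t' u' ,
  ≋-ν (≡⇒≋ (cong₂ _∣_ (sub0-wkP v0 ⟨ P' ⟩) (sub0-lift-suc ⟨ Q' ⟩)))
image-τ⁻ (s-∣ {P = P} {Q} p q) (seq (close (parR t) (parL u))) with wk-β⁻ ⟨ P ⟩ u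
... | _ , u₁ , refl with image-β⁻ Q t | image-β⁻ P u₁
... | _ , Q' , refl , t' , refl | _ , P' , refl , u' , refl = _ , Pi.closeR u' t' ,
  ≋-ν (≡⇒≋ (cong₂ _∣_ (sub0-lift-suc ⟨ P' ⟩) (sub0-wkP v0 ⟨ Q' ⟩)))
image-τ⁻ (s-out e) (seq (com out-ax ()))
-- A silent step of `Pi.ν` is always one of its body, so a `Seq` seen above the binder is first
-- pushed below it.
image-τ⁻ (s-ν p) t with tau-ν⁻ t
... | _ , t' , f with image-τ⁻ p t'
... | _ , t'' , g = _ , Pi.res t'' , ≋-trans (≋-sym f) (≋-ν g)
image-τ⁻ s-𝟘 (seq (com () _))
image-τ⁻ s-𝟘 (seq (close () _))
image-τ⁻ (s-inp _ _) (seq (com () _))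
image-τ⁻ (s-inp _ _) (seq (close () _))
image-τ⁻ (s-rep _ _) (seq (com () _))
image-τ⁻ (s-rep _ _) (seq (close () _))

-- Congruence closure of a weak bisimulation

sorted-⇒τ : ∀ {Φ : SEnv n} {P Q} → P ⇒τ Q → Sorted Φ P → Sorted Φ Q
sorted-⇒τ ε       p = p
sorted-⇒τ (t ◅ r) p = sorted-⇒τ r (subject-reduction t p)

image-⇒τ : {P Q : Pi.Proc n} → P ⇒τ Q → ⟨ P ⟩ ⇛ ⟨ Q ⟩
image-⇒τ ε = done ≋-refl
image-⇒τ (t ◅ r) with image t
... | _ , t' , f = step t' (≋-⇛ f (image-⇒τ r))

module _ (R : ∀ {k} → Pi.Proc k → Pi.Proc k → Set) (bisim : IsWeakBisim R) where
  open IsWeakBisim bisim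

  -- A base pair keeps its substitution apart: `R` is consulted on the unsubstituted processes, and
  -- `σ` accumulates what inputs and restrictions do to them. Both are sorted in one environment, so
  -- that reducts are again translations of π-processes.
  data Cong {n} : Proc n → Proc n → Set where
    base  : ∀ {P Q : Pi.Proc m} {Φ : SEnv m} → Sorted Φ P → Sorted Φ Q → R P Q →
            (σ : Sub m n) → Cong (sub σ ⟨ P ⟩) (sub σ ⟨ Q ⟩)
    c-≋   : ∀ {P P' Q Q'} → P ≋ P' → Cong P' Q' → Q' ≋ Q → Cong P Q
    c-𝟘   : Cong 𝟘 𝟘
    c-∣   : ∀ {P P' Q Q'} → Cong P Q → Cong P' Q' → Cong (P ∣ P') (Q ∣ Q')
    c-inp : ∀ {a P Q} → Cong P Q → Cong (inp a P) (inp a Q)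
    c-out : ∀ {a v} → Cong (out a v) (out a v)
    c-ν   : ∀ {P Q} → Cong P Q → Cong (ν P) (ν Q)
    c-rep : ∀ {a P Q} → Cong P Q → Cong (rep a P) (rep a Q)

  cong-refl : (P : Proc n) → Cong P P
  cong-refl 𝟘         = c-𝟘
  cong-refl (P ∣ Q)   = c-∣ (cong-refl P) (cong-refl Q)
  cong-refl (inp a P) = c-inp (cong-refl P)
  cong-refl (out a v) = c-out
  cong-refl (ν P)     = c-ν (cong-refl P)
  cong-refl (rep a P) = c-rep (cong-refl P)

  cong-sym : {P Q : Proc n} → Cong P Q → Cong Q P
  cong-sym (base p q r σ) = base q p (symm r) σ
  cong-sym (c-≋ e c f)    = c-≋ (≋-sym f) (cong-sym c) (≋-sym e)
  cong-sym c-𝟘            = c-𝟘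
  cong-sym (c-∣ c d)      = c-∣ (cong-sym c) (cong-sym d)
  cong-sym (c-inp c)      = c-inp (cong-sym c)
  cong-sym c-out          = c-out
  cong-sym (c-ν c)        = c-ν (cong-sym c)
  cong-sym (c-rep c)      = c-rep (cong-sym c)

  cong-sub : (σ : Sub n m) {P Q : Proc n} → Cong P Q → Cong (sub σ P) (sub σ Q)
  cong-sub σ (base {P = P} {Q} p q r υ) =
    c-≋ (≡⇒≋ (sub-comp σ υ ⟨ P ⟩)) (base p q r (λ x → subV σ (υ x)))
        (≡⇒≋ (sym (sub-comp σ υ ⟨ Q ⟩)))
  cong-sub σ (c-≋ e c f) = c-≋ (sub-≋ σ e) (cong-sub σ c) (sub-≋ σ f)
  cong-sub σ c-𝟘         = c-𝟘
  cong-sub σ (c-∣ c d)   = c-∣ (cong-sub σ c) (cong-sub σ d)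
  cong-sub σ (c-inp c)   = c-inp (cong-sub (liftσ σ) c)
  cong-sub σ c-out       = c-out
  cong-sub σ (c-ν c)     = c-ν (cong-sub (liftσ σ) c)
  cong-sub σ (c-rep c)   = c-rep (cong-sub (liftσ σ) c)

  cong-along : (α : Lab n m) {P Q : Proc n} → Cong P Q → Cong (along α P) (along α Q)
  cong-along (ō a v) c = c
  cong-along (β d a) c = cong-sub ⌜ suc ⌝ c

  -- The two residuals need a common sort for the fresh name; it is determined by the sort of the
  -- channel `a`, which both sides share. The clauses coincide, but the weak arrow unfolds only once
  -- the direction is known.
  sim-dir : ∀ d {a : Subj n} {P Q P'} {Φ : SEnv n} → Sorted Φ P → Sorted Φ Q → R P Q →
            P —[ dirAct d a ]→ P' →
            ∃₂ λ s Q' → WTr ⟨ Q ⟩ (β d (nm a)) ⟨ Q' ⟩ × R P' Q' ×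
            Sorted (s ▹ Φ) P' × Sorted (s ▹ Φ) Q'
  sim-dir ↑ p q r t with sim r t
  ... | _ , (_ , _ , r₁ , u , r₂) , r'
    with subject-reduction t p | subject-reduction u (sorted-⇒τ r₁ q)
  ... | _ , e₁ , p' | _ , e₂ , q' with ch-injective (trans (sym e₁) e₂)
  ... | refl = _ , _ , (_ , _ , image-⇒τ r₁ , image u , image-⇒τ r₂) , r' , p' , sorted-⇒τ r₂ q'
  sim-dir ↓ p q r t with sim r t
  ... | _ , (_ , _ , r₁ , u , r₂) , r'
    with subject-reduction t p | subject-reduction u (sorted-⇒τ r₁ q)
  ... | _ , e₁ , p' | _ , e₂ , q' with ch-injective (trans (sym e₁) e₂)
  ... | refl = _ , _ , (_ , _ , image-⇒τ r₁ , image u , image-⇒τ r₂) , r' , p' , sorted-⇒τ r₂ q'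

  cong-sim : {α : Lab n m} {P Q : Proc n} {P' : Proc m} → Cong P Q → Tr P α P' →
             ∃ λ Q' → WTr Q α Q' × Cong P' Q'
  cong-sim {α = ō a v} (base {P = P} p q r σ) t with inv-o σ ⟨ P ⟩ t
  ... | _ , _ , _ , t₁ , refl , refl , refl with image-ō⁻ P t₁
  ... | _ , _ , refl , t₂ , refl with sim r t₂
  ... | _ , (_ , _ , r₁ , u , r₂) , r' =
    _ , weak-ō-sub σ (_ , _ , image-⇒τ r₁ , image u , image-⇒τ r₂) ,
    base (proj₂ (subject-reduction t₂ p))
         (sorted-⇒τ r₂ (proj₂ (subject-reduction u (sorted-⇒τ r₁ q)))) r' σ
  cong-sim {α = β d a} (base {P = P} p q r σ) t with inv-β σ ⟨ P ⟩ t
  ... | _ , _ , t₁ , refl , refl with image-β⁻ P t₁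
  ... | _ , _ , refl , t₂ , refl with sim-dir d p q r t₂
  ... | _ , _ , w , r' , p' , q' = _ , weak-β-sub σ w , base p' q' r' (liftσ σ)
  cong-sim (c-≋ e c f) t with harmony e t
  ... | _ , t' , e' with cong-sim c t'
  ... | _ , w , c' = _ , ≋-weak (≋-sym f) w , c-≋ e' c' ≋-refl
  cong-sim {α = α} (c-∣ c d) (parL t) with cong-sim c t
  ... | _ , w , c' = _ , weak-parˡ w , c-∣ c' (cong-along α d)
  cong-sim {α = α} (c-∣ c d) (parR t) with cong-sim d t
  ... | _ , w , d' = _ , weak-parʳ w , c-∣ (cong-along α c) d'
  cong-sim (c-inp c) inp-ax = _ , (_ , _ , done ≋-refl , inp-ax , done ≋-refl) , c
  cong-sim c-out out-ax = _ , (_ , _ , done ≋-refl , out-ax , done ≋-refl) , c-𝟘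
  cong-sim (c-rep {a} c) rep-ax =
    _ , (_ , _ , done ≋-refl , rep-ax , done ≋-refl) , c-∣ c (cong-sub ⌜ suc ⌝ (c-rep {a = a} c))
  cong-sim (c-ν c) (res-o t) with cong-sim c t
  ... | _ , w , c' = _ , weak-ν-ō w , c-ν c'
  cong-sim (c-ν c) (res-β t) with cong-sim c t
  ... | _ , w , c' = _ , weak-ν-β w , c-ν (cong-sub ⌜ swap01 ⌝ c')
  cong-sim (c-ν c) (opn t) with cong-sim c t
  ... | _ , w , c' = _ , weak-opn w , c'

  -- The game is played on the output and then on the input of the residual, wherever the partners
  -- sit and even if `σ` has fused their channels; `weak-com` and `weak-close` assemble the two
  -- answers.
  cong-sim-seq : {a : Val n} {P Q X : Proc n} → Cong P Q → Seq a P X → ∃ λ Y → Q ⇛ Y × Cong X Y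
  cong-sim-seq c (com {v = v} t u) with cong-sim c t
  ... | _ , w , c₁ with cong-sim c₁ u
  ... | _ , w' , c₂ = _ , weak-com w w' , cong-sub (sub0 v) c₂
  cong-sim-seq c (close t u) with cong-sim c t
  ... | _ , w , c₁ with cong-sim c₁ u
  ... | _ , w' , c₂ = _ , weak-close w w' , c-ν (cong-sub (sub0 v0) c₂)

  cong-sim-τ : {P Q X : Proc n} → Cong P Q → Tau P X → ∃ λ Y → Q ⇛ Y × Cong X Y
  cong-sim-τ (base {P = P} p q r σ) t with tau-sub⁻ σ ⟨ P ⟩ t
  ... | inj₁ (_ , t₁ , f) with image-τ⁻ p t₁
  ... | _ , t₂ , g with sim r t₂
  ... | _ , r₁ , r' =
    _ , ⇛-sub σ (image-⇒τ r₁) ,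
    c-≋ (≋-trans f (sub-≋ σ g)) (base (subject-reduction t₂ p) (sorted-⇒τ r₁ q) r' σ) ≋-refl
  -- Here the communication may be the work of `σ`, with no silent step of the original process for
  -- `R` to answer.
  cong-sim-τ (base p q r σ) t | inj₂ (_ , _ , s , f) with cong-sim-seq (base p q r σ) s
  ... | _ , w , c = _ , w , c-≋ f c ≋-refl
  cong-sim-τ (c-≋ e c f) t with tau-harmony e t
  ... | _ , t' , e' with cong-sim-τ c t'
  ... | _ , w , c' = _ , ≋-⇛ (≋-sym f) w , c-≋ e' c' ≋-refl
  cong-sim-τ (c-∣ c d) (parL t) with cong-sim-τ c t
  ... | _ , w , c' = _ , ⇛-parˡ w , c-∣ c' d
  cong-sim-τ (c-∣ c d) (parR t) with cong-sim-τ d t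
  ... | _ , w , d' = _ , ⇛-parʳ w , c-∣ c d'
  cong-sim-τ (c-∣ c d) (seq s)       = cong-sim-seq (c-∣ c d) s
  cong-sim-τ (c-inp {a} c) (seq s)   = cong-sim-seq (c-inp {a = a} c) s
  cong-sim-τ c-out (seq s)           = cong-sim-seq c-out s
  cong-sim-τ c-𝟘 (seq s)             = cong-sim-seq c-𝟘 s
  cong-sim-τ (c-rep {a} c) (seq s)   = cong-sim-seq (c-rep {a = a} c) s
  cong-sim-τ (c-ν c) (seq s)         = cong-sim-seq (c-ν c) s
  cong-sim-τ (c-ν c) (res t) with cong-sim-τ c t
  ... | _ , w , c' = _ , ⇛-ν w , c-ν c'

-- Types of AWπ without linearity

TEnv : ℕ → Set
TEnv n = Fin n → Ty

typeV : TEnv n → Val n → Ty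
typeV Γ (nm (var x)) = Γ x
typeV Γ (nm (sc ω))  = o unit
typeV Γ ⋆            = unit

-- A non-linear weakening of ⊢ with total environments: it keeps only the
-- polarity of subjects and the agreement of carried types.
infix 3 _⊩_
data _⊩_ : ∀ {n} → TEnv n → AW.Proc n → Set where
  ⊩-𝟘   : {Γ : TEnv n} → Γ ⊩ AW.𝟘
  ⊩-∣   : ∀ {Γ : TEnv n} {P Q} → Γ ⊩ P → Γ ⊩ Q → Γ ⊩ P AW.∣ Q
  -- The annotation U is ignored, since νU 𝟘 ≡s 𝟘 for every U.
  ⊩-ν   : ∀ {Γ : TEnv n} {T U P} → (i T ▹ (o T ▹ Γ)) ⊩ P → Γ ⊩ AW.ν U P
  ⊩-out : ∀ {Γ : TEnv n} {a v} → typeV Γ (nm a) ≡ o (typeV Γ v) → Γ ⊩ AW.out a v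
  ⊩-inp : ∀ {Γ : TEnv n} {a T P} → Γ a ≡ i T → (T ▹ Γ) ⊩ P → Γ ⊩ AW.inp a P
  ⊩-rep : ∀ {Γ : TEnv n} {a T P} → Γ a ≡ i T → (T ▹ Γ) ⊩ P → Γ ⊩ AW.rep a P

i-injective : ∀ {S T} → i S ≡ i T → S ≡ T
i-injective refl = refl

o-injective : ∀ {S T} → o S ≡ o T → S ≡ T
o-injective refl = refl

private variable
  Γ : TEnv n
  Δ : TEnv m
  S T : Ty

typeV-ren : {ρ : Ren n m} → (∀ x → Δ (ρ x) ≡ Γ x) → ∀ v → typeV Δ (renV ρ v) ≡ typeV Γ v
typeV-ren h (nm (var x)) = h x
typeV-ren h (nm (sc ω))  = refl
typeV-ren h ⋆            = refl

liftR-type : {ρ : Ren n m} → (∀ x → Δ (ρ x) ≡ Γ x) → ∀ x → (T ▹ Δ) (liftR ρ x) ≡ (T ▹ Γ) x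
liftR-type h zero    = refl
liftR-type h (suc x) = h x

⊩-ren : ∀ {P} {ρ : Ren n m} → (∀ x → Δ (ρ x) ≡ Γ x) → Γ ⊩ P → Δ ⊩ AW.ren ρ P
⊩-ren h ⊩-𝟘 = ⊩-𝟘
⊩-ren h (⊩-∣ p q) = ⊩-∣ (⊩-ren h p) (⊩-ren h q)
⊩-ren h (⊩-ν p) = ⊩-ν (⊩-ren (liftR-type (liftR-type h)) p)
⊩-ren h (⊩-out {a = a} {v} e) =
  ⊩-out (trans (typeV-ren h (nm a)) (trans e (cong o_ (sym (typeV-ren h v)))))
⊩-ren h (⊩-inp e p) = ⊩-inp (trans (h _) e) (⊩-ren (liftR-type h) p)
⊩-ren h (⊩-rep e p) = ⊩-rep (trans (h _) e) (⊩-ren (liftR-type h) p)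

⊩-ren⁻ : ∀ P {ρ : Ren n m} → (∀ x → Δ (ρ x) ≡ Γ x) → Δ ⊩ AW.ren ρ P → Γ ⊩ P
⊩-ren⁻ AW.𝟘 h ⊩-𝟘 = ⊩-𝟘
⊩-ren⁻ (P AW.∣ Q) h (⊩-∣ p q) = ⊩-∣ (⊩-ren⁻ P h p) (⊩-ren⁻ Q h q)
⊩-ren⁻ (AW.ν _ P) h (⊩-ν p) = ⊩-ν (⊩-ren⁻ P (liftR-type (liftR-type h)) p)
⊩-ren⁻ (AW.out a v) h (⊩-out e) =
  ⊩-out (trans (sym (typeV-ren h (nm a))) (trans e (cong o_ (typeV-ren h v))))
⊩-ren⁻ (AW.inp a P) h (⊩-inp e p) = ⊩-inp (trans (sym (h a)) e) (⊩-ren⁻ P (liftR-type h) p)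
⊩-ren⁻ (AW.rep a P) h (⊩-rep e p) = ⊩-rep (trans (sym (h a)) e) (⊩-ren⁻ P (liftR-type h) p)

typeV-sub : (Δ : TEnv m) (σ : Sub n m) → (∀ x → typeV Δ (σ x) ≡ Γ x) →
            ∀ v → typeV Δ (subV σ v) ≡ typeV Γ v
typeV-sub Δ σ h (nm (var x)) = h x
typeV-sub Δ σ h (nm (sc ω))  = refl
typeV-sub Δ σ h ⋆            = refl

liftσ-type : (Δ : TEnv m) (σ : Sub n m) → (∀ x → typeV Δ (σ x) ≡ Γ x) →
             ∀ x → typeV (T ▹ Δ) (liftσ σ x) ≡ (T ▹ Γ) x
liftσ-type Δ σ h zero    = refl
liftσ-type Δ σ h (suc x) = trans (typeV-ren (λ _ → refl) (σ x)) (h x)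

input-is-var : (v : Val n) → typeV Γ v ≡ i T → ∃ λ x → v ≡ nm (var x)
input-is-var (nm (var x)) e = x , refl

output-is-name : (v : Val n) → typeV Γ v ≡ o T → ∃ λ b → v ≡ nm b
output-is-name (nm b) e = b , refl

-- Types make the partial substitution succeed: only variables have an input type, and only names
-- have an output type.
⊩-sub : ∀ {P} (Δ : TEnv m) (σ : Sub n m) → (∀ x → typeV Δ (σ x) ≡ Γ x) → Γ ⊩ P →
        ∃ λ P' → AW.sub σ P ≡ just P' × Δ ⊩ P'
⊩-sub Δ σ h ⊩-𝟘 = _ , refl , ⊩-𝟘
⊩-sub Δ σ h (⊩-∣ p q) with ⊩-sub Δ σ h p | ⊩-sub Δ σ h q
... | _ , e₁ , p' | _ , e₂ , q' rewrite e₁ | e₂ = _ , refl , ⊩-∣ p' q'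
⊩-sub Δ σ h (⊩-ν p) with ⊩-sub _ (liftσ (liftσ σ)) (liftσ-type _ (liftσ σ) (liftσ-type Δ σ h)) p
... | _ , e₁ , p' rewrite e₁ = _ , refl , ⊩-ν p'
⊩-sub Δ σ h (⊩-out {a = a} {v} e)
  with trans (typeV-sub Δ σ h (nm a)) (trans e (cong o_ (sym (typeV-sub Δ σ h v))))
... | ea with output-is-name (subS σ a) ea
... | _ , eb rewrite eb = _ , refl , ⊩-out ea
⊩-sub Δ σ h (⊩-inp {a = a} e p) with trans (h a) e | ⊩-sub (_ ▹ Δ) (liftσ σ) (liftσ-type Δ σ h) p
... | ea | _ , e₁ , p' with input-is-var (σ a) ea
... | _ , eb rewrite e₁ | eb = _ , refl , ⊩-inp ea p'
⊩-sub Δ σ h (⊩-rep {a = a} e p) with trans (h a) e | ⊩-sub (_ ▹ Δ) (liftσ σ) (liftσ-type Δ σ h) p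
... | ea | _ , e₁ , p' with input-is-var (σ a) ea
... | _ , eb rewrite e₁ | eb = _ , refl , ⊩-rep ea p'

⊩-sub0 : ∀ {P} (v : Val n) → typeV Γ v ≡ T → (T ▹ Γ) ⊩ P →
         ∃ λ P' → AW.sub (sub0 v) P ≡ just P' × Γ ⊩ P'
⊩-sub0 v e = ⊩-sub _ (sub0 v) λ where
  zero    → e
  (suc x) → refl

swap22-invol : ∀ (x : Fin (suc (suc (suc (suc n))))) → swap22 (swap22 x) ≡ x
swap22-invol zero                      = refl
swap22-invol (suc zero)                = refl
swap22-invol (suc (suc zero))          = refl
swap22-invol (suc (suc (suc zero)))    = refl
swap22-invol (suc (suc (suc (suc x)))) = refl

swap22-type : ∀ {S₁ S₂ T₁ T₂} (x : Fin (suc (suc (suc (suc n))))) →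
              (S₁ ▹ (S₂ ▹ (T₁ ▹ (T₂ ▹ Γ)))) (swap22 x) ≡ (T₁ ▹ (T₂ ▹ (S₁ ▹ (S₂ ▹ Γ)))) x
swap22-type zero                      = refl
swap22-type (suc zero)                = refl
swap22-type (suc (suc zero))          = refl
swap22-type (suc (suc (suc zero)))    = refl
swap22-type (suc (suc (suc (suc x)))) = refl

mutual
  ⊩-≡s : ∀ {P Q : AW.Proc n} → P ≡s Q → Γ ⊩ P → Γ ⊩ Q
  ⊩-≡s AW.≡refl p = p
  ⊩-≡s (AW.≡sym e) p = ⊩-≡s⁻ e p
  ⊩-≡s (AW.≡trans e f) p = ⊩-≡s f (⊩-≡s e p)
  ⊩-≡s AW.∣-assoc (⊩-∣ (⊩-∣ p q) r) = ⊩-∣ p (⊩-∣ q r)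
  ⊩-≡s AW.∣-comm (⊩-∣ p q) = ⊩-∣ q p
  ⊩-≡s AW.∣-unit (⊩-∣ p _) = p
  ⊩-≡s AW.extr (⊩-∣ p (⊩-ν q)) = ⊩-ν (⊩-∣ (⊩-ren (λ _ → refl) p) q)
  ⊩-≡s AW.ν-comm (⊩-ν (⊩-ν p)) = ⊩-ν (⊩-ν (⊩-ren swap22-type p))
  ⊩-≡s AW.ν-zero _ = ⊩-𝟘
  ⊩-≡s (AW.cong-∣ e) (⊩-∣ p q) = ⊩-∣ (⊩-≡s e p) q
  ⊩-≡s (AW.cong-inp e) (⊩-inp a p) = ⊩-inp a (⊩-≡s e p)
  ⊩-≡s (AW.cong-rep e) (⊩-rep a p) = ⊩-rep a (⊩-≡s e p)
  ⊩-≡s (AW.cong-ν e) (⊩-ν p) = ⊩-ν (⊩-≡s e p)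

  ⊩-≡s⁻ : ∀ {P Q : AW.Proc n} → P ≡s Q → Γ ⊩ Q → Γ ⊩ P
  ⊩-≡s⁻ AW.≡refl p = p
  ⊩-≡s⁻ (AW.≡sym e) p = ⊩-≡s e p
  ⊩-≡s⁻ (AW.≡trans e f) p = ⊩-≡s⁻ e (⊩-≡s⁻ f p)
  ⊩-≡s⁻ AW.∣-assoc (⊩-∣ p (⊩-∣ q r)) = ⊩-∣ (⊩-∣ p q) r
  ⊩-≡s⁻ AW.∣-comm (⊩-∣ p q) = ⊩-∣ q p
  ⊩-≡s⁻ AW.∣-unit p = ⊩-∣ p ⊩-𝟘
  ⊩-≡s⁻ (AW.extr {P = P}) (⊩-ν (⊩-∣ p q)) = ⊩-∣ (⊩-ren⁻ P (λ _ → refl) p) (⊩-ν q)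
  ⊩-≡s⁻ (AW.ν-comm {P = P}) (⊩-ν (⊩-ν p)) = ⊩-ν (⊩-ν (⊩-ren⁻ P swap22-type p))
  -- An arbitrary carried type, as `𝟘` mentions neither end of the pair.
  ⊩-≡s⁻ AW.ν-zero _ = ⊩-ν {T = unit} ⊩-𝟘
  ⊩-≡s⁻ (AW.cong-∣ e) (⊩-∣ p q) = ⊩-∣ (⊩-≡s⁻ e p) q
  ⊩-≡s⁻ (AW.cong-inp e) (⊩-inp a p) = ⊩-inp a (⊩-≡s⁻ e p)
  ⊩-≡s⁻ (AW.cong-rep e) (⊩-rep a p) = ⊩-rep a (⊩-≡s⁻ e p)
  ⊩-≡s⁻ (AW.cong-ν e) (⊩-ν p) = ⊩-ν (⊩-≡s⁻ e p)

⊩-sub0-just : ∀ {P P'} (v : Val n) → typeV Γ v ≡ T → (T ▹ Γ) ⊩ P →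
              AW.sub (sub0 v) P ≡ just P' → Γ ⊩ P'
⊩-sub0-just v e p eq with ⊩-sub0 v e p
... | _ , eq' , p' with trans (sym eq) eq'
... | refl = p'

⊩-⟶ : ∀ {P Q : AW.Proc n} → P ⟶ Q → Γ ⊩ P → Γ ⊩ Q
⊩-⟶ (AW.com {v = v} eq) (⊩-ν (⊩-∣ (⊩-inp e p) (⊩-∣ (⊩-out f) q))) =
  ⊩-ν (⊩-∣ (⊩-sub0-just v (trans (o-injective (sym f)) (i-injective e)) p eq) q)
⊩-⟶ (AW.rcom {v = v} eq) (⊩-ν (⊩-∣ (⊩-rep e p) (⊩-∣ (⊩-out f) q))) =
  ⊩-ν (⊩-∣ (⊩-rep e p) (⊩-∣ (⊩-sub0-just v (trans (o-injective (sym f)) (i-injective e)) p eq) q))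
⊩-⟶ (AW.par r) (⊩-∣ p q) = ⊩-∣ (⊩-⟶ r p) q
⊩-⟶ (AW.res r) (⊩-ν p) = ⊩-ν (⊩-⟶ r p)
⊩-⟶ (AW.str e r f) p = ⊩-≡s f (⊩-⟶ r (⊩-≡s e p))

infix 4 _≼_
-- A single total environment lies above all the pieces into which `Union` and `t-rep` cut a partial
-- one.
_≼_ : AW.Env n → TEnv n → Set
Γ ≼ Θ = ∀ x t → lookup Γ x ≡ just t → Θ x ≡ t

≼-∷ : ∀ {Γ : AW.Env n} {Θ t} → Γ ≼ Θ → (just t ∷ Γ) ≼ (t ▹ Θ)
≼-∷ h zero    _ refl = refl
≼-∷ h (suc x) t e    = h x t e

union-left : ∀ {Γ Γ₁ Γ₂ : AW.Env n} → AW.Union Γ Γ₁ Γ₂ → ∀ x {t} → lookup Γ₁ x ≡ just t → lookup Γ x ≡ just t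
union-left (AW.left AW.∷ u)   zero e = e
union-left (AW.both _ AW.∷ u) zero e = e
union-left (_ AW.∷ u) (suc x) e = union-left u x e

union-right : ∀ {Γ Γ₁ Γ₂ : AW.Env n} → AW.Union Γ Γ₁ Γ₂ → ∀ x {t} → lookup Γ₂ x ≡ just t → lookup Γ x ≡ just t
union-right (AW.right AW.∷ u)  zero e = e
union-right (AW.both _ AW.∷ u) zero e = e
union-right (_ AW.∷ u) (suc x) e = union-right u x e

typeV-≼ : ∀ {Γ : AW.Env n} {Θ v t} → Γ ≼ Θ → AW.ValTy Γ v t → typeV Θ v ≡ t
typeV-≼ h (AW.nm (AW.var e)) = h _ _ e
typeV-≼ h (AW.nm AW.sc)      = refl
typeV-≼ h AW.⋆               = refl

⊢⇒⊩ : ∀ {Γ : AW.Env n} {Θ P} → Γ ≼ Θ → Γ ⊢ P → Θ ⊩ P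
⊢⇒⊩ h AW.t-nil = ⊩-𝟘
⊢⇒⊩ h (AW.t-par u p q) =
  ⊩-∣ (⊢⇒⊩ (λ x t e → h x t (union-left u x e)) p) (⊢⇒⊩ (λ x t e → h x t (union-right u x e)) q)
⊢⇒⊩ h (AW.t-res p) = ⊩-ν (⊢⇒⊩ (≼-∷ (≼-∷ h)) p)
⊢⇒⊩ h (AW.t-out a v) =
  ⊩-out (trans (typeV-≼ h (AW.nm a)) (cong o_ (sym (typeV-≼ h v))))
⊢⇒⊩ h (AW.t-inp e p) = ⊩-inp (h _ _ e) (⊢⇒⊩ (≼-∷ h) p)
⊢⇒⊩ h (AW.t-rep _ s e p) = ⊩-rep (h _ _ e) (⊢⇒⊩ (≼-∷ (λ x t e' → h x t (s x t e'))) p)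

-- The total environment at the hole emerges only while descending through the binders of `C`, so
-- the process is required to be typed in every one above `Γh`.
⊩-plug : ∀ {Γ : AW.Env n} {Γh : AW.Env m} {C Θ P} → Γ ≼ Θ → AW.CtxTy Γ C Γh →
         (∀ Θh → Γh ≼ Θh → Θh ⊩ P) → Θ ⊩ AW.plug C P
⊩-plug h AW.c-hole p = p _ h
⊩-plug h (AW.c-parL u c q) p =
  ⊩-∣ (⊩-plug (λ x t e → h x t (union-left u x e)) c p)
      (⊢⇒⊩ (λ x t e → h x t (union-right u x e)) q)
⊩-plug h (AW.c-parR u q c) p =
  ⊩-∣ (⊢⇒⊩ (λ x t e → h x t (union-left u x e)) q)
      (⊩-plug (λ x t e → h x t (union-right u x e)) c p)
⊩-plug h (AW.c-res c) p = ⊩-ν (⊩-plug (≼-∷ (≼-∷ h)) c p)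
⊩-plug h (AW.c-inp e c) p = ⊩-inp (h _ _ e) (⊩-plug (≼-∷ h) c p)
⊩-plug h (AW.c-rep _ s e c) p =
  ⊩-rep (h _ _ e) (⊩-plug (≼-∷ (λ x t e' → h x t (s x t e'))) c p)

-- From AWπ to the π-calculus and back

-- Polarity is forgotten so that the two ends `i T` and `o T` of a pair get the same sort, which
-- `merge` then respects.
sort : Ty → Sort
sort (o T) = ch (sort T)
sort (i T) = ch (sort T)
sort unit  = val

▹-sort : {Φ : SEnv n} → (∀ x → Φ x ≡ sort (Γ x)) → ∀ x → (sort T ▹ Φ) x ≡ sort ((T ▹ Γ) x)
▹-sort h zero    = refl
▹-sort h (suc x) = h x

sortV-typeV : {Φ : SEnv n} → (∀ x → Φ x ≡ sort (Γ x)) → ∀ v → sortV Φ v ≡ sort (typeV Γ v)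
sortV-typeV h (nm (var x)) = h x
sortV-typeV h (nm (sc ω))  = refl
sortV-typeV h ⋆            = refl

⊩⇒Sorted : ∀ {Φ : SEnv n} {P} → (∀ x → Φ x ≡ sort (Γ x)) → Γ ⊩ P → Sorted Φ ⟦ P ⟧
⊩⇒Sorted h ⊩-𝟘 = s-𝟘
⊩⇒Sorted h (⊩-∣ p q) = s-∣ (⊩⇒Sorted h p) (⊩⇒Sorted h q)
⊩⇒Sorted {Γ = Γ} h (⊩-ν {T = T} p) =
  s-ν {s = ch (sort T)}
    (sorted-ren pointwise (⊩⇒Sorted (▹-sort {T = i T} (▹-sort {Γ = Γ} {T = o T} h)) p))
  where
  pointwise : ∀ {Φ : SEnv n} {s} x → (s ▹ Φ) (merge x) ≡ (s ▹ (s ▹ Φ)) x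
  pointwise zero          = refl
  pointwise (suc zero)    = refl
  pointwise (suc (suc x)) = refl
⊩⇒Sorted {Γ = Γ} h (⊩-out {a = a} {v} e) =
  s-out (trans (sortV-typeV {Γ = Γ} h (nm a)) (trans (cong sort e) (cong ch (sym (sortV-typeV {Γ = Γ} h v)))))
⊩⇒Sorted {Γ = Γ} h (⊩-inp e p) = s-inp (trans (h _) (cong sort e)) (⊩⇒Sorted (▹-sort {Γ = Γ} h) p)
⊩⇒Sorted {Γ = Γ} h (⊩-rep e p) = s-rep (trans (h _) (cong sort e)) (⊩⇒Sorted (▹-sort {Γ = Γ} h) p)

-- The composite of `⟦_⟧` and `⟨_⟩`, computed directly so that merging is a substitution and
-- composes with the others.
⟪_⟫ : AW.Proc n → Proc n
⟪ AW.𝟘 ⟫       = 𝟘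
⟪ P AW.∣ Q ⟫   = ⟪ P ⟫ ∣ ⟪ Q ⟫
⟪ AW.inp a P ⟫ = inp (nm (var a)) ⟪ P ⟫
⟪ AW.out a v ⟫ = out (nm a) v
⟪ AW.ν T P ⟫   = ν (sub ⌜ merge ⌝ ⟪ P ⟫)
⟪ AW.rep a P ⟫ = rep (nm (var a)) ⟪ P ⟫

⟪⟫≡⟨⟦⟧⟩ : (P : AW.Proc n) → ⟪ P ⟫ ≡ ⟨ ⟦ P ⟧ ⟩
⟪⟫≡⟨⟦⟧⟩ AW.𝟘         = refl
⟪⟫≡⟨⟦⟧⟩ (P AW.∣ Q)   = cong₂ _∣_ (⟪⟫≡⟨⟦⟧⟩ P) (⟪⟫≡⟨⟦⟧⟩ Q)
⟪⟫≡⟨⟦⟧⟩ (AW.inp a P) = cong (inp _) (⟪⟫≡⟨⟦⟧⟩ P)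
⟪⟫≡⟨⟦⟧⟩ (AW.out a v) = refl
⟪⟫≡⟨⟦⟧⟩ (AW.ν T P)   =
  cong ν (trans (cong (sub ⌜ merge ⌝) (⟪⟫≡⟨⟦⟧⟩ P)) (sym (⟨⟩-ren merge ⟦ P ⟧)))
⟪⟫≡⟨⟦⟧⟩ (AW.rep a P) = cong (rep _) (⟪⟫≡⟨⟦⟧⟩ P)

merge-wk² : (v : Val n) → subV ⌜ merge ⌝ (renV wk2 v) ≡ wkV v
merge-wk² (nm (var x)) = refl
merge-wk² (nm (sc ω))  = refl
merge-wk² ⋆            = refl

wk∘wk : (v : Val n) → wkV (wkV v) ≡ renV wk2 v
wk∘wk (nm (var x)) = refl
wk∘wk (nm (sc ω))  = refl
wk∘wk ⋆            = refl

-- `merge` is injective away from the pair: what avoids the merged name comes from outside the pair.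
merge-wk⁻ : (u : Val (suc (suc n))) {a : Val n} → subV ⌜ merge ⌝ u ≡ wkV a → u ≡ renV wk2 a
merge-wk⁻ (nm (var zero)) e          = ⊥-elim (v0≢wk _ e)
merge-wk⁻ (nm (var (suc zero))) e    = ⊥-elim (v0≢wk _ e)
merge-wk⁻ (nm (var (suc (suc x)))) e = cong (renV wk2) (wkV-injective _ _ e)
merge-wk⁻ (nm (sc ω)) e              = cong (renV wk2) (wkV-injective (nm (sc ω)) _ e)
merge-wk⁻ ⋆ e                        = cong (renV wk2) (wkV-injective ⋆ _ e)

mutual
  ⟪⟫-ren : (ρ : Ren n m) (P : AW.Proc n) → ⟪ AW.ren ρ P ⟫ ≡ sub ⌜ ρ ⌝ ⟪ P ⟫
  ⟪⟫-ren ρ AW.𝟘         = refl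
  ⟪⟫-ren ρ (P AW.∣ Q)   = cong₂ _∣_ (⟪⟫-ren ρ P) (⟪⟫-ren ρ Q)
  ⟪⟫-ren ρ (AW.inp a P) = cong (inp _) (⟪⟫-liftR ρ P)
  ⟪⟫-ren ρ (AW.out a v) = cong₂ out (renV≗subV ρ (nm a)) (renV≗subV ρ v)
  ⟪⟫-ren ρ (AW.ν T P)   =
    cong ν (trans (cong (sub ⌜ merge ⌝) (⟪⟫-ren (liftR (liftR ρ)) P)) (sub₁₁ pointwise ⟪ P ⟫))
    where
    pointwise : ∀ x → subV ⌜ merge ⌝ (⌜ liftR (liftR ρ) ⌝ x) ≡ subV (liftσ ⌜ ρ ⌝) (⌜ merge ⌝ x)
    pointwise zero          = refl
    pointwise (suc zero)    = refl
    pointwise (suc (suc x)) = refl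
  ⟪⟫-ren ρ (AW.rep a P) = cong (rep _) (⟪⟫-liftR ρ P)

  ⟪⟫-liftR : (ρ : Ren n m) (P : AW.Proc (suc n)) → ⟪ AW.ren (liftR ρ) P ⟫ ≡ sub (liftσ ⌜ ρ ⌝) ⟪ P ⟫
  ⟪⟫-liftR ρ P = trans (⟪⟫-ren (liftR ρ) P) (sub-cong (λ x → sym (liftσ-⌜⌝ ρ x)) ⟪ P ⟫)

asVar-just : (v : Val n) {x : Fin n} → asVar v ≡ just x → v ≡ nm (var x)
asVar-just (nm (var x)) refl = refl

⟪⟫-sub : (σ : Sub n m) (P : AW.Proc n) {P' : AW.Proc m} → AW.sub σ P ≡ just P' → ⟪ P' ⟫ ≡ sub σ ⟪ P ⟫
⟪⟫-sub σ AW.𝟘 refl = refl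
⟪⟫-sub σ (P AW.∣ Q) e with AW.sub σ P in eP | AW.sub σ Q in eQ
⟪⟫-sub σ (P AW.∣ Q) refl | just _ | just _ = cong₂ _∣_ (⟪⟫-sub σ P eP) (⟪⟫-sub σ Q eQ)
⟪⟫-sub σ (AW.inp a P) e with asVar (σ a) in ea | AW.sub (liftσ σ) P in eP
⟪⟫-sub σ (AW.inp a P) refl | just _ | just _ =
  cong₂ inp (sym (asVar-just (σ a) ea)) (⟪⟫-sub (liftσ σ) P eP)
⟪⟫-sub σ (AW.out a v) e with asSubj (subS σ a) in ea
⟪⟫-sub σ (AW.out a v) refl | just _ = cong₂ out (sym (asSubj-just (subS σ a) ea)) refl
⟪⟫-sub σ (AW.ν T P) e with AW.sub (liftσ (liftσ σ)) P in eP
⟪⟫-sub σ (AW.ν T P) refl | just _ =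
  cong ν (trans (cong (sub ⌜ merge ⌝) (⟪⟫-sub (liftσ (liftσ σ)) P eP)) (sub₁₁ pointwise ⟪ P ⟫))
  where
  pointwise : ∀ x → subV ⌜ merge ⌝ (liftσ (liftσ σ) x) ≡ subV (liftσ σ) (⌜ merge ⌝ x)
  pointwise zero          = refl
  pointwise (suc zero)    = refl
  pointwise (suc (suc x)) = trans (cong (subV ⌜ merge ⌝) (wk∘wk (σ x))) (merge-wk² (σ x))
⟪⟫-sub σ (AW.rep a P) e with asVar (σ a) in ea | AW.sub (liftσ σ) P in eP
⟪⟫-sub σ (AW.rep a P) refl | just _ | just _ =
  cong₂ rep (sym (asVar-just (σ a) ea)) (⟪⟫-sub (liftσ σ) P eP)

merge∘ren-wk2 : (P : AW.Proc n) → sub ⌜ merge ⌝ ⟪ AW.ren wk2 P ⟫ ≡ wk ⟪ P ⟫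
merge∘ren-wk2 P = trans (cong (sub ⌜ merge ⌝) (⟪⟫-ren wk2 P)) (sub₂₁ (λ x → refl) ⟪ P ⟫)

-- Exchanging two pairs and then merging each is merging first and exchanging the two merged names;
-- this carries `ν-comm` to `≋-ν-swap`.
swap-merge² : (P : Proc (suc (suc (suc (suc n))))) →
  swap (sub (liftσ ⌜ merge ⌝) (sub ⌜ merge ⌝ P)) ≡
  sub (liftσ ⌜ merge ⌝) (sub ⌜ merge ⌝ (sub ⌜ swap22 ⌝ P))
swap-merge² P = trans (sub-comp₃ _ _ _ P) (trans (sub-cong pointwise P) (sym (sub-comp₃ _ _ _ P)))
  where
  pointwise : ∀ {n} (x : Fin (suc (suc (suc (suc n))))) →
    subV ⌜ swap01 ⌝ (subV (liftσ ⌜ merge ⌝) (⌜ merge ⌝ x)) ≡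
    subV (liftσ ⌜ merge ⌝) (subV ⌜ merge ⌝ (⌜ swap22 ⌝ x))
  pointwise zero                      = refl
  pointwise (suc zero)                = refl
  pointwise (suc (suc zero))          = refl
  pointwise (suc (suc (suc zero)))    = refl
  pointwise (suc (suc (suc (suc x)))) = refl

⟪⟫-≡s : {P Q : AW.Proc n} → P ≡s Q → ⟪ P ⟫ ≋ ⟪ Q ⟫
⟪⟫-≡s AW.≡refl        = ≋-refl
⟪⟫-≡s (AW.≡sym e)     = ≋-sym (⟪⟫-≡s e)
⟪⟫-≡s (AW.≡trans e f) = ≋-trans (⟪⟫-≡s e) (⟪⟫-≡s f)
⟪⟫-≡s AW.∣-assoc      = ≋-assoc
⟪⟫-≡s AW.∣-comm       = ≋-comm
⟪⟫-≡s AW.∣-unit       = ≋-unit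
⟪⟫-≡s (AW.extr {P = P}) = ≋-trans ≋-extr (≋-ν (≋-par (≡⇒≋ (sym (merge∘ren-wk2 P)))))
⟪⟫-≡s (AW.ν-comm {P = P}) = ≋-trans ≋-ν-swap (≋-ν (≋-ν (≡⇒≋ (trans (swap-merge² ⟪ P ⟫)
  (cong (λ R → sub (liftσ ⌜ merge ⌝) (sub ⌜ merge ⌝ R)) (sym (⟪⟫-ren swap22 P)))))))
⟪⟫-≡s AW.ν-zero       = ≋-ν-zero
⟪⟫-≡s (AW.cong-∣ e)   = ≋-par (⟪⟫-≡s e)
⟪⟫-≡s (AW.cong-inp e) = ≋-inp (⟪⟫-≡s e)
⟪⟫-≡s (AW.cong-rep e) = ≋-rep (⟪⟫-≡s e)
⟪⟫-≡s (AW.cong-ν e)   = ≋-ν (sub-≋ ⌜ merge ⌝ (⟪⟫-≡s e))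

⟪⟫-sub0 : ∀ (σ : Sub n m) (v : Val n) P {P'} → AW.sub (sub0 v) P ≡ just P' →
          sub (sub0 (subV σ v)) (sub (liftσ σ) ⟪ P ⟫) ≡ sub σ ⟪ P' ⟫
⟪⟫-sub0 σ v P e = trans (sym (sub-sub0 σ v ⟪ P ⟫)) (cong (sub σ) (sym (⟪⟫-sub (sub0 v) P e)))

sub0-𝟘∣wk : (v : Val n) (P : Proc n) → sub (sub0 v) (wk (𝟘 ∣ P)) ≋ P
sub0-𝟘∣wk v P = ≋-trans (≡⇒≋ (sub0-wkP v (𝟘 ∣ P))) ≋-unitˡ

⟪⟫-⟶ : {P Q : AW.Proc n} → P ⟶ Q → ∃ λ X → Tau ⟪ P ⟫ X × X ≋ ⟪ Q ⟫
⟪⟫-⟶ (AW.com {P = P} {v} {Q} eq) =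
  _ , res (seq (com (parR (parL out-ax)) (parL inp-ax))) ,
  ≋-ν (≋-trans (≋-parʳ (sub0-𝟘∣wk _ _)) (≋-par (≡⇒≋ (⟪⟫-sub0 ⌜ merge ⌝ v P eq))))
⟪⟫-⟶ (AW.rcom {P = P} {v} {Q} eq) =
  _ , res (seq (com (parR (parL out-ax)) (parL rep-ax))) ,
  -- `rep-ax` leaves the new copy to the left of the server, `AW.rcom` to its right.
  ≋-ν (≋-trans (≋-parʳ (sub0-𝟘∣wk _ _)) (≋-trans ≋-assoc (≋-trans ≋-exchange
    (≋-trans (≋-parʳ (≋-par (≡⇒≋ (⟪⟫-sub0 ⌜ merge ⌝ v P eq))))
             (≋-par (≡⇒≋ (sub0-wkP _ (sub ⌜ merge ⌝ (rep v0 ⟪ P ⟫)))))))))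
⟪⟫-⟶ (AW.par r) with ⟪⟫-⟶ r
... | _ , t , f = _ , parL t , ≋-par f
⟪⟫-⟶ (AW.res r) with ⟪⟫-⟶ r
... | _ , t , f = _ , res (tau-sub ⌜ merge ⌝ t) , ≋-ν (sub-≋ ⌜ merge ⌝ f)
⟪⟫-⟶ (AW.str e r f) with ⟪⟫-⟶ r
... | _ , t , g with tau-harmony⁻ (⟪⟫-≡s e) t
... | _ , t' , h = _ , t' , ≋-trans h (≋-trans g (⟪⟫-≡s f))

-- Algebra of renamings in AWπ

liftR-cong : {ρ ρ' : Ren n m} → (∀ x → ρ x ≡ ρ' x) → ∀ x → liftR ρ x ≡ liftR ρ' x
liftR-cong h zero    = refl
liftR-cong h (suc x) = cong suc (h x)

renV-cong : {ρ ρ' : Ren n m} → (∀ x → ρ x ≡ ρ' x) → ∀ v → renV ρ v ≡ renV ρ' v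
renV-cong h (nm (var x)) = cong (λ y → nm (var y)) (h x)
renV-cong h (nm (sc ω))  = refl
renV-cong h ⋆            = refl

renV-comp : (ρ : Ren m l) (ρ' : Ren n m) (v : Val n) → renV ρ (renV ρ' v) ≡ renV (ρ ∘ ρ') v
renV-comp ρ ρ' (nm (var x)) = refl
renV-comp ρ ρ' (nm (sc ω))  = refl
renV-comp ρ ρ' ⋆            = refl

AW-ren-cong : {ρ ρ' : Ren n m} → (∀ x → ρ x ≡ ρ' x) → ∀ P → AW.ren ρ P ≡ AW.ren ρ' P
AW-ren-cong h AW.𝟘         = refl
AW-ren-cong h (P AW.∣ Q)   = cong₂ AW._∣_ (AW-ren-cong h P) (AW-ren-cong h Q)
AW-ren-cong h (AW.inp a P) = cong₂ AW.inp (h a) (AW-ren-cong (liftR-cong h) P)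
AW-ren-cong h (AW.out a v) = cong₂ AW.out (nm-injective (renV-cong h (nm a))) (renV-cong h v)
AW-ren-cong h (AW.ν T P)   = cong (AW.ν T) (AW-ren-cong (liftR-cong (liftR-cong h)) P)
AW-ren-cong h (AW.rep a P) = cong₂ AW.rep (h a) (AW-ren-cong (liftR-cong h) P)

liftR-comp : (ρ : Ren m l) (ρ' : Ren n m) → ∀ x → liftR ρ (liftR ρ' x) ≡ liftR (ρ ∘ ρ') x
liftR-comp ρ ρ' zero    = refl
liftR-comp ρ ρ' (suc x) = refl

AW-ren-comp : (ρ : Ren m l) (ρ' : Ren n m) (P : AW.Proc n) → AW.ren ρ (AW.ren ρ' P) ≡ AW.ren (ρ ∘ ρ') P
AW-ren-comp ρ ρ' AW.𝟘         = refl
AW-ren-comp ρ ρ' (P AW.∣ Q)   = cong₂ AW._∣_ (AW-ren-comp ρ ρ' P) (AW-ren-comp ρ ρ' Q)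
AW-ren-comp ρ ρ' (AW.inp a P) =
  cong (AW.inp _) (trans (AW-ren-comp _ _ P) (AW-ren-cong (liftR-comp ρ ρ') P))
AW-ren-comp ρ ρ' (AW.out a v) = cong₂ AW.out (nm-injective (renV-comp ρ ρ' (nm a))) (renV-comp ρ ρ' v)
AW-ren-comp ρ ρ' (AW.ν T P)   = cong (AW.ν T) (trans (AW-ren-comp _ _ P)
  (AW-ren-cong (λ x → trans (liftR-comp _ _ x) (liftR-cong (liftR-comp ρ ρ') x)) P))
AW-ren-comp ρ ρ' (AW.rep a P) =
  cong (AW.rep _) (trans (AW-ren-comp _ _ P) (AW-ren-cong (liftR-comp ρ ρ') P))

liftR-id : {ρ : Ren n n} → (∀ x → ρ x ≡ x) → ∀ x → liftR ρ x ≡ x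
liftR-id h zero    = refl
liftR-id h (suc x) = cong suc (h x)

renV-id : {ρ : Ren n n} → (∀ x → ρ x ≡ x) → ∀ v → renV ρ v ≡ v
renV-id h (nm (var x)) = cong (λ y → nm (var y)) (h x)
renV-id h (nm (sc ω))  = refl
renV-id h ⋆            = refl

AW-ren-id : {ρ : Ren n n} → (∀ x → ρ x ≡ x) → ∀ P → AW.ren ρ P ≡ P
AW-ren-id h AW.𝟘         = refl
AW-ren-id h (P AW.∣ Q)   = cong₂ AW._∣_ (AW-ren-id h P) (AW-ren-id h Q)
AW-ren-id h (AW.inp a P) = cong₂ AW.inp (h a) (AW-ren-id (liftR-id h) P)
AW-ren-id h (AW.out a v) = cong₂ AW.out (nm-injective (renV-id h (nm a))) (renV-id h v)
AW-ren-id h (AW.ν T P)   = cong (AW.ν T) (AW-ren-id (liftR-id (liftR-id h)) P)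
AW-ren-id h (AW.rep a P) = cong₂ AW.rep (h a) (AW-ren-id (liftR-id h) P)

-- Reading transitions of the translation back in AWπ

≡⇒≡s : {P Q : AW.Proc n} → P ≡ Q → P ≡s Q
≡⇒≡s refl = ≡refl

cong-∣ʳ : {P Q R : AW.Proc n} → P ≡s Q → R AW.∣ P ≡s R AW.∣ Q
cong-∣ʳ e = ≡trans ∣-comm (≡trans (cong-∣ e) ∣-comm)

exchange : {P Q R : AW.Proc n} → P AW.∣ (Q AW.∣ R) ≡s Q AW.∣ (P AW.∣ R)
exchange = ≡trans (≡sym ∣-assoc) (≡trans (cong-∣ ∣-comm) ∣-assoc)

extrˡ : ∀ {U} {P : AW.Proc n} {Q} → AW.ν U Q AW.∣ P ≡s AW.ν U (Q AW.∣ AW.ren wk2 P)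
extrˡ = ≡trans ∣-comm (≡trans extr (cong-ν ∣-comm))

name-wk2 : (a : Val n) {s : Subj (suc (suc n))} → nm s ≡ renV wk2 a → ∃ λ s' → a ≡ nm s' × s ≡ renS wk2 s'
name-wk2 (nm s') refl = s' , refl , refl

-- The counterpart in AWπ of `async-ō`. Below a restriction, the label shows that neither subject
-- nor value is an end of the pair, so the message leaves by `extr`.
reflect-ō : (P : AW.Proc n) {a v : Val n} {X : Proc n} → Tr ⟪ P ⟫ (ō a v) X →
            ∃₂ λ s P' → a ≡ nm s × P ≡s AW.out s v AW.∣ P' × X ≋ ⟪ P' ⟫
reflect-ō (P AW.∣ Q) (parL t) with reflect-ō P t
... | _ , _ , refl , e , f = _ , _ , refl , ≡trans (cong-∣ e) ∣-assoc , ≋-par f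
reflect-ō (P AW.∣ Q) (parR t) with reflect-ō Q t
... | _ , _ , refl , e , f = _ , _ , refl , ≡trans (cong-∣ʳ e) exchange , ≋-parʳ f
reflect-ō (AW.out a v) out-ax = _ , _ , refl , ≡sym ∣-unit , ≋-refl
reflect-ō (AW.ν T P) (res-o {a = a} t) with inv-o ⌜ merge ⌝ ⟪ P ⟫ t
... | a' , v' , _ , t' , ea , ev , refl with merge-wk⁻ a' ea | merge-wk⁻ v' ev | reflect-ō P t'
... | ea' | refl | s , _ , es , e , f with name-wk2 a (trans (sym es) ea')
... | _ , refl , refl = _ , _ , refl , ≡trans (cong-ν e) (≡sym extr) , ≋-ν (sub-≋ ⌜ merge ⌝ f)

swap22-wk2 : (v : Val (suc (suc (suc (suc n))))) → subV ⌜ merge ⌝ v ≡ v0 →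
             ∃ λ w → renV swap22 v ≡ renV wk2 w × subV ⌜ merge ⌝ w ≡ v0
swap22-wk2 (nm (var zero)) e       = nm (var zero) , refl , refl
swap22-wk2 (nm (var (suc zero))) e = nm (var (suc zero)) , refl , refl

swap22S-wk2² : (s : Subj n) → renS swap22 (renS wk2 (renS wk2 s)) ≡ renS wk2 (renS wk2 s)
swap22S-wk2² (var x) = refl
swap22S-wk2² (sc ω)  = refl

-- An extruded name stems from a whole pair, and the message may carry either end of it. The value
-- `v` records which one, and is constrained only to become `v0` under `merge`.
reflect-β↑ : (P : AW.Proc n) {a : Val n} {X : Proc (suc n)} → Tr ⟪ P ⟫ (β ↑ a) X →
             ∃₂ λ s U → ∃₂ λ v P' →
             a ≡ nm s × P ≡s AW.ν U (AW.out (renS wk2 s) v AW.∣ P') ×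
             subV ⌜ merge ⌝ v ≡ v0 × X ≋ sub ⌜ merge ⌝ ⟪ P' ⟫
reflect-β↑ (P AW.∣ Q) (parL t) with reflect-β↑ P t
... | _ , _ , _ , _ , ea , e , ev , f =
  _ , _ , _ , _ , ea , ≡trans (cong-∣ e) (≡trans extrˡ (cong-ν ∣-assoc)) , ev ,
  ≋-trans (≋-par f) (≋-parʳ (≡⇒≋ (sym (merge∘ren-wk2 Q))))
reflect-β↑ (P AW.∣ Q) (parR t) with reflect-β↑ Q t
... | _ , _ , _ , _ , ea , e , ev , f =
  _ , _ , _ , _ , ea , ≡trans (cong-∣ʳ e) (≡trans extr (cong-ν exchange)) , ev ,
  ≋-trans (≋-parʳ f) (≋-par (≡⇒≋ (sym (merge∘ren-wk2 P))))
reflect-β↑ (AW.ν T P) (res-β {a = a} t) with inv-β ⌜ merge ⌝ ⟪ P ⟫ t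
... | a' , _ , t' , ea , refl with merge-wk⁻ a' ea | reflect-β↑ P t'
... | ea' | s , U , v , P' , es , e , ev , f with name-wk2 a (trans (sym es) ea')
... | s' , refl , refl with swap22-wk2 v ev
... | w , ew , ew' =
  _ , _ , w , _ , refl ,
  -- The extruded pair `U` is exchanged with the outer pair; the message mentions no end of the
  -- latter and leaves its scope.
  ≡trans (cong-ν e) (≡trans ν-comm (cong-ν
    (≡trans (cong-ν (cong-∣ (≡⇒≡s (cong₂ AW.out (swap22S-wk2² s') ew))))
            (≡sym extr)))) ,
  ew' ,
  ≋-ν (≋-trans (sub-≋ ⌜ swap01 ⌝ (sub-≋ (liftσ ⌜ merge ⌝) f))
    (≡⇒≋ (trans (swap-merge² ⟪ P' ⟫)
      (cong (λ R → sub (liftσ ⌜ merge ⌝) (sub ⌜ merge ⌝ R)) (sym (⟪⟫-ren swap22 P'))))))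
reflect-β↑ (AW.ν T P) (opn {a = a} t) with inv-o ⌜ merge ⌝ ⟪ P ⟫ t
... | a' , v' , _ , t' , ea , ev , refl with merge-wk⁻ a' ea | reflect-ō P t'
... | ea' | s , _ , es , e , f with name-wk2 a (trans (sym es) ea')
... | _ , refl , refl = _ , _ , _ , _ , refl , cong-ν e , ev , sub-≋ ⌜ merge ⌝ f

typeV-wk2 : (v : Val n) → typeV (S ▹ (T ▹ Γ)) (renV wk2 v) ≡ typeV Γ v
typeV-wk2 = typeV-ren (λ x → refl)

input-typed : ∀ {P} → Γ ⊩ P → {a : Val n} {X : Proc (suc n)} → Tr ⟪ P ⟫ (β ↓ a) X → ∃ λ T → typeV Γ a ≡ i T
input-typed (⊩-∣ p q) (parL t) = input-typed p t
input-typed (⊩-∣ p q) (parR t) = input-typed q t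
input-typed (⊩-inp e p) inp-ax = _ , e
input-typed (⊩-rep e p) rep-ax = _ , e
input-typed (⊩-ν {P = P} p) (res-β {a = a} t) with inv-β ⌜ merge ⌝ ⟪ P ⟫ t
... | a' , _ , t' , ea , _ with merge-wk⁻ a' ea | input-typed p t'
... | refl | T , e = T , trans (sym (typeV-wk2 a)) e

output-typed : ∀ {P P'} {s : Subj n} {v} → Γ ⊩ P → P ≡s AW.out s v AW.∣ P' →
               typeV Γ (nm s) ≡ o (typeV Γ v) × Γ ⊩ P'
output-typed p e with ⊩-≡s e p
... | ⊩-∣ (⊩-out eq) p' = eq , p'

i≢o : {U : Ty} → U ≡ i S → U ≡ o T → ⊥
i≢o refl ()

-- A free channel would have to be typed both as read and as written; only a restricted pair, once
-- merged, can do both.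
no-visible-com : ∀ {P} → Γ ⊩ P → {a : Val n} {X : Proc n} → Seq a ⟪ P ⟫ X → ⊥
no-visible-com {P = P} p (com t u) with reflect-ō P t
... | s , P' , refl , e , f with output-typed p e | harmony f u
... | eq , p' | _ , u' , _ with input-typed p' u'
... | _ , eq' = i≢o eq' eq
no-visible-com {P = P} p (close {a} t u) with reflect-β↑ P t
... | s , U , v , P' , refl , e , ev , f with ⊩-≡s e p | harmony f u
... | ⊩-ν (⊩-∣ (⊩-out eq) p') | _ , u' , _ with inv-β ⌜ merge ⌝ ⟪ P' ⟫ u'
... | d , _ , u'' , ed , _ with merge-wk⁻ d ed | input-typed p' u''
... | refl | _ , eq' = i≢o eq' eq

com-at-0 : ∀ {U} {x : Fin (suc (suc n))} {P v P' Q} → x ≡ zero → AW.sub (sub0 v) P ≡ just P' →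
           AW.ν U (AW.inp x P AW.∣ (AW.out (var (suc zero)) v AW.∣ Q)) ⟶ AW.ν U (P' AW.∣ Q)
com-at-0 refl = AW.com

rcom-at-0 : ∀ {U} {x : Fin (suc (suc n))} {P v P' Q} → x ≡ zero → AW.sub (sub0 v) P ≡ just P' →
            AW.ν U (AW.rep x P AW.∣ (AW.out (var (suc zero)) v AW.∣ Q)) ⟶
            AW.ν U ((AW.rep x P AW.∣ P') AW.∣ Q)
rcom-at-0 refl e = str ≡refl (AW.rcom e) (cong-ν (≡sym ∣-assoc))

var-nm-injective : {x y : Fin n} → nm {n} (var x) ≡ nm (var y) → x ≡ y
var-nm-injective refl = refl

-- The residual `X` of an input, moved along `ρ` and then given the message `v` for its bound name.
fetch : (ρ : Ren n (suc (suc m))) (v : Val (suc (suc m))) → Proc (suc n) → Proc (suc (suc m))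
fetch ρ v X = sub (sub0 v) (sub (liftσ ⌜ ρ ⌝) X)

liftR² : (ρ : Ren n m) → Ren (suc (suc n)) (suc (suc m))
liftR² ρ = liftR (liftR ρ)

swap-lift²-wk2 : (ρ : Ren n (suc (suc m))) (c : Val n) → subV ⌜ ρ ⌝ c ≡ v0 →
                 subV ⌜ swap22 ∘ liftR² ρ ⌝ (renV wk2 c) ≡ v0
swap-lift²-wk2 ρ (nm (var x)) e =
  cong (λ y → nm (var (swap22 (suc (suc y))))) (var-nm-injective e)

swap22-wk2-ren : (Q : AW.Proc (suc (suc n))) →
  AW.ren swap22 (AW.ren swap22 (AW.ren wk2 Q)) ≡ AW.ren wk2 Q
swap22-wk2-ren Q = trans (AW-ren-comp swap22 swap22 (AW.ren wk2 Q)) (AW-ren-id swap22-invol (AW.ren wk2 Q))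

swap22-merge-wk2 : (v : Val (suc (suc n))) → subV ⌜ merge ⌝ (subV ⌜ swap22 ⌝ (renV swap22 (renV wk2 v))) ≡ wkV v
swap22-merge-wk2 (nm (var zero))          = refl
swap22-merge-wk2 (nm (var (suc zero)))    = refl
swap22-merge-wk2 (nm (var (suc (suc x)))) = refl
swap22-merge-wk2 (nm (sc ω))              = refl
swap22-merge-wk2 ⋆                        = refl

fetch-ν : (ρ : Ren n (suc (suc m))) (v : Val (suc (suc m))) (X : Proc (suc (suc (suc n)))) →
  sub ⌜ merge ⌝ (sub ⌜ swap22 ⌝ (fetch (swap22 ∘ liftR² ρ) (renV swap22 (renV wk2 v)) X)) ≡
  sub (liftσ (sub0 v)) (sub (liftσ (liftσ ⌜ ρ ⌝)) (swap (sub (liftσ ⌜ merge ⌝) X)))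
fetch-ν {n = n} ρ v X = trans lhs (trans (sub-cong pointwise X) (sym rhs))
  where
  v' = renV swap22 (renV wk2 v)
  ρ' = swap22 ∘ liftR² ρ
  lhs : _ ≡ sub (λ x → subV ⌜ merge ⌝ (subV ⌜ swap22 ⌝ (subV (sub0 v') (liftσ ⌜ ρ' ⌝ x)))) X
  lhs = trans (cong (λ Y → sub ⌜ merge ⌝ (sub ⌜ swap22 ⌝ Y)) (sub-comp _ _ X)) (sub-comp₃ _ _ _ X)
  rhs : _ ≡ sub (λ x → subV (liftσ (sub0 v)) (subV (liftσ (liftσ ⌜ ρ ⌝))
                (subV ⌜ swap01 ⌝ (liftσ ⌜ merge ⌝ x)))) X
  rhs = trans (cong (λ Y → sub (liftσ (sub0 v)) (sub (liftσ (liftσ ⌜ ρ ⌝)) Y)) (sub-comp _ _ X))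
              (sub-comp₃ _ _ _ X)
  pointwise : (x : Fin (suc (suc (suc n)))) →
    subV ⌜ merge ⌝ (subV ⌜ swap22 ⌝ (subV (sub0 v') (liftσ ⌜ ρ' ⌝ x))) ≡
    subV (liftσ (sub0 v)) (subV (liftσ (liftσ ⌜ ρ ⌝)) (subV ⌜ swap01 ⌝ (liftσ ⌜ merge ⌝ x)))
  pointwise zero                = swap22-merge-wk2 v
  pointwise (suc zero)          = refl
  pointwise (suc (suc zero))    = refl
  pointwise (suc (suc (suc x))) = cong (λ y → nm (var (merge y))) (swap22-invol (suc (suc (ρ x))))

-- An input of P on the I-name of an enclosing pair meets the message v.  The
-- renaming ρ is what moves that pair next to P across the restrictions of P.
reflect-inp : ∀ {U} (P : AW.Proc n) {c : Val n} {X : Proc (suc n)} → Tr ⟪ P ⟫ (β ↓ c) X →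
  (ρ : Ren n (suc (suc m))) → subV ⌜ ρ ⌝ c ≡ v0 →
  {Θ : TEnv (suc (suc m))} (v : Val (suc (suc m))) → Θ ⊩ AW.ren ρ P → Θ zero ≡ i (typeV Θ v) →
  (Q : AW.Proc (suc (suc m))) → ∃ λ P' →
  AW.ν U (AW.ren ρ P AW.∣ (AW.out (var (suc zero)) v AW.∣ Q)) ⟶ AW.ν U (P' AW.∣ Q) ×
  ⟪ P' ⟫ ≋ fetch ρ v X
reflect-inp (P₁ AW.∣ P₂) (parL t) ρ ec v (⊩-∣ p q) ev Q
  with reflect-inp P₁ t ρ ec v p ev (AW.ren ρ P₂ AW.∣ Q)
... | _ , r , f =
  _ ,
  -- The idle component waits beside `Q` while the message moves next to the active one.
  str (cong-ν (≡trans ∣-assoc (cong-∣ʳ exchange))) r (cong-ν (≡sym ∣-assoc)) ,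
  ≋-trans (≋-par f) (≋-parʳ (≡⇒≋ (trans (⟪⟫-ren ρ P₂)
    (sym (trans (cong (sub (sub0 v)) (wk-sub ⌜ ρ ⌝ ⟪ P₂ ⟫)) (sub0-wkP v (sub ⌜ ρ ⌝ ⟪ P₂ ⟫)))))))
reflect-inp (P₁ AW.∣ P₂) (parR t) ρ ec v (⊩-∣ p q) ev Q
  with reflect-inp P₂ t ρ ec v q ev (AW.ren ρ P₁ AW.∣ Q)
... | P' , r , f =
  AW.ren ρ P₁ AW.∣ P' ,
  str (cong-ν (≡trans (cong-∣ ∣-comm) (≡trans ∣-assoc (cong-∣ʳ exchange)))) r
      (cong-ν (≡trans exchange (≡sym ∣-assoc))) ,
  ≋-trans (≋-parʳ f) (≋-par (≡⇒≋ (trans (⟪⟫-ren ρ P₁)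
    (sym (trans (cong (sub (sub0 v)) (wk-sub ⌜ ρ ⌝ ⟪ P₁ ⟫)) (sub0-wkP v (sub ⌜ ρ ⌝ ⟪ P₁ ⟫)))))))
reflect-inp (AW.inp x P) inp-ax ρ ec {Θ} v (⊩-inp e p) ev Q
  with var-nm-injective ec
... | eρ with ⊩-sub0 v (i-injective (trans (sym ev) (trans (cong Θ (sym eρ)) e))) p
... | _ , eq , _ =
  _ , com-at-0 eρ eq ,
  ≡⇒≋ (trans (⟪⟫-sub (sub0 v) (AW.ren (liftR ρ) P) eq) (cong (sub (sub0 v)) (⟪⟫-liftR ρ P)))
reflect-inp (AW.rep x P) rep-ax ρ ec {Θ} v (⊩-rep e p) ev Q
  with var-nm-injective ec
... | eρ with ⊩-sub0 v (i-injective (trans (sym ev) (trans (cong Θ (sym eρ)) e))) p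
... | _ , eq , _ =
  _ , rcom-at-0 eρ eq ,
  ≋-trans ≋-comm (≡⇒≋ (cong₂ _∣_
    (trans (⟪⟫-sub (sub0 v) (AW.ren (liftR ρ) P) eq) (cong (sub (sub0 v)) (⟪⟫-liftR ρ P)))
    (trans (⟪⟫-ren ρ (AW.rep x P))
      (sym (trans (cong (sub (sub0 v)) (wk-sub ⌜ ρ ⌝ ⟪ AW.rep x P ⟫))
                  (sub0-wkP v (sub ⌜ ρ ⌝ ⟪ AW.rep x P ⟫)))))))
reflect-inp {U = U} (AW.ν W P) (res-β {a = c} t) ρ ec {Θ} v (⊩-ν {T = T} p) ev Q
  with inv-β ⌜ merge ⌝ ⟪ P ⟫ t
... | c' , X₁ , t' , ec' , refl with merge-wk⁻ c' ec'
... | refl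
  -- Message and `Q` enter the scope of the pair `W`, and `ν-comm` turns `U` into the inner pair.
  -- `swap22` is the resulting change of indices, applied to the renaming, the environment, `v` and
  -- `Q`; it is undone on the reduct.
  with reflect-inp {U = U} P t' (swap22 ∘ liftR² ρ) (swap-lift²-wk2 ρ c ec)
         {Θ = λ x → (i T ▹ (o T ▹ Θ)) (swap22 x)}
         (renV swap22 (renV wk2 v))
         (subst (_ ⊩_) (AW-ren-comp swap22 (liftR² ρ) P)
           (⊩-ren {ρ = swap22} (λ x → cong (i T ▹ (o T ▹ Θ)) (swap22-invol x)) p))
         (trans ev (cong i_ (sym (trans
           (typeV-ren {Γ = i T ▹ (o T ▹ Θ)} (λ x → cong (i T ▹ (o T ▹ Θ)) (swap22-invol x)) (renV wk2 v))
           (typeV-wk2 v)))))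
         (AW.ren swap22 (AW.ren wk2 Q))
... | P' , r , f =
  AW.ν W (AW.ren swap22 P') ,
  str (≡trans (cong-ν extrˡ) (≡trans ν-comm (cong-ν (cong-ν (cong-∣
         (≡⇒≡s (AW-ren-comp swap22 (liftR² ρ) P)))))))
      (AW.res r)
      (≡trans ν-comm (cong-ν (≡trans
        (cong-ν (cong-∣ʳ (≡⇒≡s (swap22-wk2-ren Q)))) (≡sym extrˡ)))) ,
  ≋-ν (≋-trans (sub-≋ ⌜ merge ⌝ (≋-trans (≡⇒≋ (⟪⟫-ren swap22 P')) (sub-≋ ⌜ swap22 ⌝ f)))
               (≡⇒≋ (fetch-ν ρ v X₁)))

merge-v0⁻ : (u : Val (suc (suc n))) → subV ⌜ merge ⌝ u ≡ v0 → u ≡ v0 ⊎ u ≡ nm (var (suc zero))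
merge-v0⁻ (nm (var zero)) e       = inj₁ refl
merge-v0⁻ (nm (var (suc zero))) e = inj₂ refl

-- merge identifies the two ends of the pair only, and their types tell which
-- of the two is the output end.
merged-pair : (c d : Val (suc (suc n))) → subV ⌜ merge ⌝ c ≡ subV ⌜ merge ⌝ d →
              typeV (i S ▹ (o S ▹ Γ)) c ≡ o T → ∀ {T'} → typeV (i S ▹ (o S ▹ Γ)) d ≡ i T' →
              c ≡ nm (var (suc zero)) × d ≡ v0
merged-pair c d e ec ed with v0-or-wk (subV ⌜ merge ⌝ c)
... | inj₂ (a , ea) with merge-wk⁻ c ea | merge-wk⁻ d (trans (sym e) ea)
... | refl | refl = ⊥-elim (i≢o ed ec)
merged-pair c d e ec ed | inj₁ ea with merge-v0⁻ c ea | merge-v0⁻ d (trans (sym e) ea)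
... | inj₁ refl | _         = ⊥-elim (i≢o refl ec)
... | inj₂ refl | inj₁ refl = refl , refl
... | inj₂ refl | inj₂ refl = ⊥-elim (i≢o ed refl)

com-out-first : ∀ {U} {P P' : AW.Proc (suc (suc n))} {v} →
  AW.ν U (P AW.∣ (AW.out (var (suc zero)) v AW.∣ AW.𝟘)) ⟶ AW.ν U (P' AW.∣ AW.𝟘) →
  AW.ν U (AW.out (var (suc zero)) v AW.∣ P) ⟶ AW.ν U P'
com-out-first r =
  str (cong-ν (≡trans ∣-comm (cong-∣ʳ (≡sym ∣-unit)))) r (cong-ν ∣-unit)

fetch-id : (v : Val (suc (suc n))) (X : Proc (suc (suc (suc n)))) →
           fetch id v X ≡ sub (sub0 v) X
fetch-id v X = cong (sub (sub0 v)) (sub-id (λ { zero → refl ; (suc x) → refl }) X)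

-- The message splits off by `reflect-ō`. The rest then performs the input directly below its pair,
-- so `reflect-inp` starts from the identity renaming.
reflect-pair-com : ∀ {U P v} {P₁ P₂} → (i T ▹ (o T ▹ Γ)) ⊩ P →
  Tr ⟪ P ⟫ (ō (nm (var (suc zero))) v) P₁ → Tr {n = suc (suc n)} P₁ (β ↓ v0) P₂ →
  ∃ λ P' → AW.ν U P ⟶ AW.ν U P' × sub (sub0 v) P₂ ≋ ⟪ P' ⟫
reflect-pair-com {U = U} {P} {v} p t u with reflect-ō P t
... | _ , Q , refl , e , f with output-typed p e | harmony f u
... | eq , q | X , u' , g
  with reflect-inp {U = U} Q u' id refl v (subst (_ ⊩_) (sym (AW-ren-id (λ _ → refl) Q)) q)
         (cong i_ (o-injective eq)) AW.𝟘
... | P' , r , h =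
  P' ,
  str (cong-ν (≡trans e (cong-∣ʳ (≡⇒≡s (sym (AW-ren-id (λ _ → refl) Q)))))) (com-out-first r) ≡refl ,
  ≋-trans (sub-≋ (sub0 v) g) (≋-trans (≡⇒≋ (sym (fetch-id v X))) (≋-sym h))

fetch-swap22 : (v : Val (suc (suc (suc (suc n))))) → subV ⌜ merge ⌝ v ≡ v0 →
  (X : Proc (suc (suc (suc (suc (suc n)))))) →
  swap (sub (liftσ ⌜ merge ⌝) (sub ⌜ merge ⌝ (fetch swap22 (renV swap22 v) X))) ≡
  sub (sub0 v0) (sub (liftσ (liftσ ⌜ merge ⌝)) (sub (liftσ ⌜ merge ⌝) X))
fetch-swap22 {n = n} v ev X = trans lhs (trans (sub-cong (pointwise v ev) X) (sym rhs))
  where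
  lhs : _ ≡ sub (λ x → subV ⌜ swap01 ⌝ (subV (liftσ ⌜ merge ⌝) (subV ⌜ merge ⌝
                (subV (sub0 (renV swap22 v)) (liftσ ⌜ swap22 ⌝ x))))) X
  lhs = trans (cong (λ Y → swap (sub (liftσ ⌜ merge ⌝) (sub ⌜ merge ⌝ Y))) (sub-comp _ _ X))
       (trans (cong swap (sub-comp₃ _ _ _ X)) (sub-comp _ _ X))
  rhs : _ ≡ sub (λ x → subV (sub0 v0) (subV (liftσ (liftσ ⌜ merge ⌝)) (liftσ ⌜ merge ⌝ x))) X
  rhs = sub-comp₃ _ _ _ X
  pointwise : ∀ v → subV ⌜ merge ⌝ v ≡ v0 → (x : Fin (suc (suc (suc (suc (suc n)))))) →
    subV ⌜ swap01 ⌝ (subV (liftσ ⌜ merge ⌝) (subV ⌜ merge ⌝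
      (subV (sub0 (renV swap22 v)) (liftσ ⌜ swap22 ⌝ x)))) ≡
    subV (sub0 v0) (subV (liftσ (liftσ ⌜ merge ⌝)) (liftσ ⌜ merge ⌝ x))
  pointwise (nm (var zero)) e zero       = refl
  pointwise (nm (var (suc zero))) e zero = refl
  pointwise _ _ (suc zero)                            = refl
  pointwise _ _ (suc (suc zero))                      = refl
  pointwise _ _ (suc (suc (suc zero)))                = refl
  pointwise _ _ (suc (suc (suc (suc zero))))          = refl
  pointwise _ _ (suc (suc (suc (suc (suc x)))))       = refl

-- The message carries an end of the inner pair `W`, so the communicating pair `U`, at indices 2 and
-- 3, has to be brought inside `W`. This exchange is the initial renaming `swap22`.
reflect-pair-close : ∀ {U P v W P' X} → (i T ▹ (o T ▹ Γ)) ⊩ P →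
  P ≡s AW.ν W (AW.out (var (suc (suc (suc zero)))) v AW.∣ P') → subV ⌜ merge ⌝ v ≡ v0 →
  Tr {n = suc (suc (suc (suc n)))} ⟪ P' ⟫ (β ↓ (nm (var (suc (suc zero))))) X →
  ∃ λ P'' → AW.ν U P ⟶ P'' ×
  ν (ν (sub (sub0 v0) (sub (liftσ (liftσ ⌜ merge ⌝)) (sub (liftσ ⌜ merge ⌝) X)))) ≋ ⟪ P'' ⟫
reflect-pair-close {T = T} {Γ = Γ} {U = U} {v = v} {W} {P'} {X} p e ev t with ⊩-≡s e p
... | ⊩-ν {T = T'} (⊩-∣ (⊩-out eq) p')
  with reflect-inp {U = U} P' t swap22 refl
         {Θ = i T ▹ (o T ▹ (i T' ▹ (o T' ▹ Γ)))} (renV swap22 v)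
         (⊩-ren swap22-type p')
         (cong i_ (trans (o-injective eq) (sym (typeV-ren {Γ = i T' ▹ (o T' ▹ (i T ▹ (o T ▹ Γ)))} swap22-type v))))
         AW.𝟘
... | P'' , r , h =
  AW.ν W (AW.ν U P'') ,
  str (≡trans (cong-ν e) ν-comm) (AW.res (com-out-first r)) ≡refl ,
  ≋-trans (≋-ν (≋-ν (≡⇒≋ (sym (fetch-swap22 v ev X)))))
    (≋-trans (≋-sym ≋-ν-swap) (≋-ν (≋-ν (sub-≋ (liftσ ⌜ merge ⌝) (sub-≋ ⌜ merge ⌝ (≋-sym h))))))

-- One channel is written and the other is read, so `merged-pair` identifies them as the O-name and
-- the I-name of the restricted pair, which is precisely a redex of AWπ.
reflect-fused : ∀ {U P a X} → (i T ▹ (o T ▹ Γ)) ⊩ P → Fused {suc (suc n)} ⌜ merge ⌝ a ⟪ P ⟫ X →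
                ∃ λ P' → AW.ν U P ⟶ P' × ν X ≋ ⟪ P' ⟫
reflect-fused {P = P} p (com {c} {d} {v} {P₂ = P₂} ec ed t u) with reflect-ō P t
... | s , Q , refl , e , f with output-typed p e | harmony f u
... | eq , q | _ , u' , _ with input-typed q u'
... | _ , eq' with merged-pair c d (trans ec (sym ed)) eq eq'
... | refl , refl with reflect-pair-com p t u
... | P' , r , h = _ , r , ≋-ν (≋-trans (≡⇒≋ (sym (sub-sub0 ⌜ merge ⌝ v P₂))) (sub-≋ ⌜ merge ⌝ h))
reflect-fused {P = P} p (close {c} {d} ec ed t u) with reflect-β↑ P t
... | s , W , v , P' , refl , e , ev , f with ⊩-≡s e p | harmony f u
... | ⊩-ν (⊩-∣ (⊩-out eq) p') | _ , u' , g with inv-β ⌜ merge ⌝ ⟪ P' ⟫ u'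
... | d' , X , u'' , ed' , refl with merge-wk⁻ d' ed'
... | refl with input-typed p' u''
... | _ , eq' with merged-pair c d (trans ec (sym ed))
                     (trans (sym (typeV-wk2 c)) eq) (trans (sym (typeV-wk2 d)) eq')
... | refl , refl with reflect-pair-close p e ev u''
... | P'' , r , h =
  _ , r , ≋-trans (≋-ν (≋-ν (sub-≋ (sub0 v0) (sub-≋ (liftσ (liftσ ⌜ merge ⌝)) g)))) h

-- At a restriction, `tau-sub⁻` separates steps of the body from communications visible after
-- merging; typing leaves for the latter only the pair itself.
reflect-τ : ∀ {P} → Γ ⊩ P → {X : Proc n} → Tau ⟪ P ⟫ X → ∃ λ P' → P ⟶ P' × X ≋ ⟪ P' ⟫
reflect-τ (⊩-∣ p q) (parL t) with reflect-τ p t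
... | _ , r , f = _ , AW.par r , ≋-par f
reflect-τ (⊩-∣ p q) (parR t) with reflect-τ q t
... | _ , r , f = _ , str ∣-comm (AW.par r) ∣-comm , ≋-parʳ f
reflect-τ (⊩-ν {P = P} p) t with tau-ν⁻ t
... | _ , t' , g with tau-sub⁻ ⌜ merge ⌝ ⟪ P ⟫ t'
... | inj₂ (_ , _ , s , f) with reflect-fused p (seq-sub⁻ ⌜ merge ⌝ ⟪ P ⟫ s)
... | _ , r , h = _ , r , ≋-trans (≋-sym g) (≋-trans (≋-ν f) h)
reflect-τ (⊩-ν p) t | _ , t' , g | inj₁ (_ , t'' , f) with reflect-τ p t''
... | _ , r , h =
  _ , AW.res r , ≋-trans (≋-sym g) (≋-ν (≋-trans f (sub-≋ ⌜ merge ⌝ h)))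
reflect-τ p@(⊩-∣ _ _) (seq s) = ⊥-elim (no-visible-com p s)
reflect-τ p@⊩-𝟘 (seq s)       = ⊥-elim (no-visible-com p s)
reflect-τ p@(⊩-out _) (seq s) = ⊥-elim (no-visible-com p s)
reflect-τ p@(⊩-inp _ _) (seq s) = ⊥-elim (no-visible-com p s)
reflect-τ p@(⊩-rep _ _) (seq s) = ⊥-elim (no-visible-com p s)

reflect-⇛ : ∀ {P} → Γ ⊩ P → {X Y : Proc n} → X ≋ ⟪ P ⟫ → X ⇛ Y →
            ∃ λ P' → P ⟹ P' × Γ ⊩ P' × ⟪ P' ⟫ ≋ Y
reflect-⇛ p e (done f) = _ , ε , p , ≋-trans (≋-sym e) f
reflect-⇛ p e (step t w) with tau-harmony e t
... | _ , t' , f with reflect-τ p t'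
... | _ , r , g with reflect-⇛ (⊩-⟶ r p) (≋-trans f g) w
... | _ , rs , p' , h = _ , r ◅ rs , p' , h

-- The barbed bisimulation and closing contexts

module _ (R : ∀ {k} → Pi.Proc k → Pi.Proc k → Set) (bisim : IsWeakBisim R) where

  -- Typing of the answering process is what allows its weak moves in the total calculus to be read
  -- back as reductions; symmetry asks for it on both sides.
  Barbed : AW.Proc 0 → AW.Proc 0 → Set
  Barbed A B = (∃ λ Γ → Γ ⊩ A) × (∃ λ Γ → Γ ⊩ B) × Cong R bisim ⟪ A ⟫ ⟪ B ⟫

  barbed-isBarbedBisim : AW.IsBarbedBisim Barbed
  barbed-isBarbedBisim = record
    { symm = λ { (a , b , c) → b , a , cong-sym R bisim c }
    ; barb = barb
    ; step = step'
    }
    where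
    barb : ∀ {A B ω} → Barbed A B → A AW.↓ ω → B AW.⇓ ω
    barb (_ , (_ , b) , c) (_ , e) with harmony⁻ (⟪⟫-≡s e) (parL out-ax)
    ... | _ , t , _ with cong-sim R bisim c t
    ... | _ , (_ , _ , w , u , _) , _ with reflect-⇛ b ≋-refl w
    ... | B' , rs , _ , f with harmony⁻ f u
    ... | _ , u' , _ with reflect-ō B' u'
    ... | _ , B'' , refl , g , _ = B' , rs , B'' , g

    step' : ∀ {A B A'} → Barbed A B → A ⟶ A' → ∃ λ B' → B ⟹ B' × Barbed A' B'
    step' ((_ , a) , (_ , b) , c) r with ⟪⟫-⟶ r
    ... | _ , t , f with cong-sim-τ R bisim c t
    ... | _ , w , c' with reflect-⇛ b ≋-refl w
    ... | B' , rs , b' , g = B' , rs , (_ , ⊩-⟶ r a) , (_ , b') , c-≋ (≋-sym f) c' (≋-sym g)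

  -- A restriction of the context merges a pair that may be free in the processes compared, so
  -- closure under a non-injective substitution enters here.
  cong-plug : {P Q : AW.Proc m} (C : AW.Ctx n m) → Cong R bisim ⟪ P ⟫ ⟪ Q ⟫ →
              Cong R bisim ⟪ AW.plug C P ⟫ ⟪ AW.plug C Q ⟫
  cong-plug AW.hole c       = c
  cong-plug (AW.parL C Q) c = c-∣ (cong-plug C c) (cong-refl R bisim ⟪ Q ⟫)
  cong-plug (AW.parR P C) c = c-∣ (cong-refl R bisim ⟪ P ⟫) (cong-plug C c)
  cong-plug (AW.inp a C) c  = c-inp (cong-plug C c)
  cong-plug (AW.ν T C) c    = c-ν (cong-sub R bisim ⌜ merge ⌝ (cong-plug C c))
  cong-plug (AW.rep a C) c  = c-rep (cong-plug C c)

≼-lookup : (Δ : Vec Ty n) → env Δ ≼ lookup Δ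
≼-lookup Δ x t e with trans (sym e) (lookup-map x just Δ)
... | refl = refl

⟪⟫-ren-⟨⟦⟧⟩ : (ρ : Ren n m) (P : AW.Proc n) → ⟪ AW.ren ρ P ⟫ ≡ sub ⌜ ρ ⌝ ⟨ ⟦ P ⟧ ⟩
⟪⟫-ren-⟨⟦⟧⟩ ρ P = trans (⟪⟫-ren ρ P) (cong (sub ⌜ ρ ⌝) (⟪⟫≡⟨⟦⟧⟩ P))

theorem5p1 : ∀ {n} (Δ : Vec Ty n) (P Q : AW.Proc n) →
    env Δ ⊢ P → env Δ ⊢ Q → ⟦ P ⟧ ≈π ⟦ Q ⟧ → P ≅[ Δ ] Q
theorem5p1 Δ P Q p q (R , bisim , r) ρ _ Γh (agree , _) C c =
  Barbed R bisim , barbed-isBarbedBisim R bisim ,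
  (_ , typed p) , (_ , typed q) ,
  cong-plug R bisim C
    -- The given pair of `R` enters with the renaming into the scope of the hole as its first
    -- substitution.
    (c-≋ (≡⇒≋ (⟪⟫-ren-⟨⟦⟧⟩ ρ P)) (base (sorted p) (sorted q) r ⌜ ρ ⌝)
         (≡⇒≋ (sym (⟪⟫-ren-⟨⟦⟧⟩ ρ Q))))
  where
  typed : ∀ {P} → env Δ ⊢ P → (λ ()) ⊩ AW.plug C (AW.ren ρ P)
  typed p = ⊩-plug (λ ()) c
    (λ Θ h → ⊩-ren (λ x → h (ρ x) (lookup Δ x) (agree x)) (⊢⇒⊩ (≼-lookup Δ) p))
  sorted : ∀ {P} → env Δ ⊢ P → Sorted (λ x → sort (lookup Δ x)) ⟦ P ⟧
  sorted p = ⊩⇒Sorted (λ x → refl) (⊢⇒⊩ (≼-lookup Δ) p)
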